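{- Let $\mathcal{L}$ be a finite ranked atomic lattice. For each building set $\mathcal{G}$ of $\mathcal{L}$ let $\chi^{arr}_{\mathcal{G}}:N(\mathcal{G})\to\mathbb{Z}$, $I\mapsto\mathrm{rk}_{\mathbb{Z}}D(\mathcal{L},\mathcal{G},I)$. Then the collection $(\chi^{arr}_{\mathcal{G}})_{\mathcal{G}}$ is an $N$-function; that is, whenever $\mathcal{G}_1$ and $\mathcal{G}_2=\mathcal{G}_1\cup\{b\}$ with $b\notin\mathcal{G}_1$ are building sets of $\mathcal{L}$, writing $F=F_{\mathcal{G}_1}(b)$, for every $S\in N(\mathcal{G}_2)$: $\chi^{arr}_{\mathcal{G}_2}(S)=\chi^{arr}_{\mathcal{G}_1}(S)$ if $b\notin S$ and $S\cup F\notin N(\mathcal{G}_1)$; $\chi^{arr}_{\mathcal{G}_2}(S)=\chi^{arr}_{\mathcal{G}_1}(S)+\chi^{arr}_{\mathcal{G}_1}(S\cup F)(|F\setminus S|-1)$ if $b\notin S$ and $S\cup F\in N(\mathcal{G}_1)$; $\chi^{arr}_{\mathcal{G}_2}(S)=\chi^{arr}_{\mathcal{G}_1}(S\setminus\{b\}\cup F)\,|F\setminus S|$ if $b\in S$.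
   Context: All posets are finite. For $S\subset\mathcal{L}$, $x\in\mathcal{L}$: $S_{<x}=\{y\in S:y<x\}$, $S_{\le x}$ similarly; $\max S$ is the set of maximal elements; $\bigvee T$ is the join. $\hat0$ is the least element; $[a,b]=\{x:a\le x\le b\}$; products of posets carry the componentwise order. Atoms are elements covering $\hat0$; $\mathcal{L}$ is ranked if all maximal chains from $\hat0$ to any $x$ have equal length, and atomic if every element is a join of atoms. A subset $\mathcal{G}\subset\mathcal{L}\setminus\{\hat0\}$ is a building set if for every $p\ne\hat0$ there is a poset isomorphism $\phi:[\hat0,p]\to\prod_{g\in F_{\mathcal{G}}(p)}[\hat0,g]$ with $\phi(g)=(\hat0,\dots,g,\dots,\hat0)$ for all $g\in F_{\mathcal{G}}(p)$, where $F_{\mathcal{G}}(p)=\max\{g\in\mathcal{G}:g\le p\}$. $N(\mathcal{G})$ is the set of all $S\subset\mathcal{G}$ (including $\emptyset$) such that for every $T\subset S$ with $|T|\ge2$ of pairwise incomparable elements, $\bigvee T\notin\mathcal{G}$. For $S,H\subset\mathcal{L}$ and $B\in\mathcal{L}$ with $\bigvee(H\cup S_{<B})\le B$, $d^S_{H,B}$ is the minimal number $m$ of atoms $A_1,\dots,A_m$ with $B=\bigvee(H\cup S_{<B}\cup\{A_1,\dots,A_m\})$. For $I\in N(\mathcal{G})$, $D(\mathcal{L},\mathcal{G},I)=\mathbb{Z}[\{x_g\}_{g\in\mathcal{G}}]/J_I$, where $J_I$ is generated by $\prod_{A\in H}x_A\big(\sum_{C\in\mathcal{G},C\ge B}x_C\big)^{d^I_{H,B}}$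 for all $H\subset\mathcal{G}$ and all $B\in\mathcal{G}$ with $B>h$ for all $h\in H$. $\mathrm{rk}_{\mathbb{Z}}$ is the rank of a finitely generated abelian group. -}

module Defs where

open import Level using (0ℓ)
open import Data.Nat as ℕ using (ℕ; zero; suc)
open import Data.Integer as ℤ using (ℤ)
open import Data.Fin as Fin using (Fin)
open import Data.Fin.Subset using (Subset; _∈_; _∉_; _⊆_; _∪_; ∣_∣)
open import Data.Bool using (Bool; true; false; if_then_else_; _∧_)
open import Data.List as List using (List; []; _∷_; _++_; concatMap; allFin; foldr)
open import Data.List.Relation.Unary.All as LAll using ()
open import Data.Vec as Vec using (Vec; lookup; tabulate; zipWith; replicate)
open import Data.Vec.Relation.Unary.All as VAll using ()
open import Data.Vec.Membership.Propositional as VMem using ()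
open import Data.Vec.Properties using (≡-dec)
open import Data.Product using (Σ; Σ-syntax; ∃; _×_; _,_)
open import Data.Sum using (_⊎_)
open import Relation.Nullary using (¬_; Dec; does)
open import Relation.Binary using (Decidable; IsPartialOrder)
open import Relation.Binary.Lattice.Structures using (IsLattice)
open import Relation.Binary.PropositionalEquality using (_≡_; _≢_)

record FinLattice : Set₁ where
  field
    n         : ℕ
    _≤_       : Fin n → Fin n → Set
    _≤?_      : Decidable _≤_
    _∨_       : Fin n → Fin n → Fin n
    _∧ₗ_      : Fin n → Fin n → Fin n
    isLattice : IsLattice _≡_ _≤_ _∨_ _∧ₗ_
    ⊥         : Fin n
    ⊥-min     : ∀ x → ⊥ ≤ x

module _ (L : FinLattice) where
  open FinLattice L

  _<_ : Fin n → Fin n → Set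
  x < y = x ≤ y × x ≢ y

  _⋖_ : Fin n → Fin n → Set
  x ⋖ y = x < y × (∀ z → x ≤ z → z ≤ y → z ≡ x ⊎ z ≡ y)

  IsAtom : Fin n → Set
  IsAtom a = ⊥ ⋖ a

  IsJoin : (Fin n → Set) → Fin n → Set
  IsJoin P x = (∀ y → P y → y ≤ x) × (∀ z → (∀ y → P y → y ≤ z) → x ≤ z)

  data CoverChain : Fin n → Fin n → ℕ → Set where
    done : ∀ x → CoverChain x x zero
    step : ∀ {x y z k} → x ⋖ y → CoverChain y z k → CoverChain x z (suc k)

  Ranked : Set
  Ranked = ∀ x k m → CoverChain ⊥ x k → CoverChain ⊥ x m → k ≡ m

  Atomic : Set
  Atomic = ∀ x → IsJoin (λ a → IsAtom a × a ≤ x) x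

  MaxBelow : Subset n → Fin n → Fin n → Set
  MaxBelow G p g = g ∈ G × g ≤ p × (∀ g' → g' ∈ G → g' ≤ p → g ≤ g' → g' ≡ g)

  -- Elements of ∏_{g ∈ F_G(p)} [⊥, g], encoded as functions t : Fin n → Fin n
  -- with t g ∈ [⊥, g] for g ∈ F_G(p) and t g = ⊥ (dummy) otherwise.
  ProdElem : Subset n → Fin n → (Fin n → Fin n) → Set
  ProdElem G p t = ∀ g → (MaxBelow G p g → t g ≤ g) × (¬ MaxBelow G p g → t g ≡ ⊥)

  _≤ᴾ_ : (Fin n → Fin n) → (Fin n → Fin n) → Set
  t ≤ᴾ s = ∀ g → t g ≤ s g

  record BuildingIso (G : Subset n) (p : Fin n) : Set where
    field
      φ       : Fin n → (Fin n → Fin n)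
      ψ       : (Fin n → Fin n) → Fin n
      φ-into  : ∀ x → x ≤ p → ProdElem G p (φ x)
      ψ-into  : ∀ t → ProdElem G p t → ψ t ≤ p
      ψφ      : ∀ x → x ≤ p → ψ (φ x) ≡ x
      φψ      : ∀ t → ProdElem G p t → ∀ g → φ (ψ t) g ≡ t g
      φ-mono  : ∀ x y → x ≤ p → y ≤ p → x ≤ y → φ x ≤ᴾ φ y
      φ-refl  : ∀ x y → x ≤ p → y ≤ p → φ x ≤ᴾ φ y → x ≤ y
      φ-gen   : ∀ g → MaxBelow G p g → ∀ h →
                  (h ≡ g → φ g h ≡ g) × (h ≢ g → φ g h ≡ ⊥)

  IsBuildingSet : Subset n → Set
  IsBuildingSet G = ⊥ ∉ G × (∀ p → p ≢ ⊥ → BuildingIso G p)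

  PairwiseIncomparable : Subset n → Set
  PairwiseIncomparable T = ∀ x y → x ∈ T → y ∈ T → x ≢ y → ¬ (x ≤ y)

  IsNested : Subset n → Subset n → Set
  IsNested G S = S ⊆ G ×
    (∀ T → T ⊆ S → 2 ℕ.≤ ∣ T ∣ → PairwiseIncomparable T →
       ∀ x → IsJoin (_∈ T) x → x ∉ G)

  JoinWithAtoms : Subset n → Subset n → Fin n → ∀ {m} → Vec (Fin n) m → Set
  JoinWithAtoms S H B as =
    VAll.All IsAtom as ×
    IsJoin (λ y → y ∈ H ⊎ (y ∈ S × y < B) ⊎ y VMem.∈ as) B

  IsD : Subset n → Subset n → Fin n → ℕ → Set
  IsD S H B d =
    (Σ[ as ∈ Vec (Fin n) d ] JoinWithAtoms S H B as) ×
    (∀ m → m ℕ.< d → (as : Vec (Fin n) m) → ¬ JoinWithAtoms S H B as)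

  Mono : Set
  Mono = Vec ℕ n

  Poly : Set
  Poly = List (ℤ × Mono)

  coeff : Poly → Mono → ℤ
  coeff [] m = ℤ.0ℤ
  coeff ((c , m') ∷ p) m =
    if does (≡-dec ℕ._≟_ m' m) then c ℤ.+ coeff p m else coeff p m

  _≈P_ : Poly → Poly → Set
  p ≈P q = ∀ m → coeff p m ≡ coeff q m

  _+P_ : Poly → Poly → Poly
  p +P q = p ++ q

  _*P_ : Poly → Poly → Poly
  p *P q = concatMap (λ { (a , m) → List.map (λ { (b , m') → (a ℤ.* b , zipWith ℕ._+_ m m') }) q }) p

  scaleP : ℤ → Poly → Poly
  scaleP c p = List.map (λ { (a , m) → (c ℤ.* a , m) }) p

  zeroP oneP : Poly
  zeroP = []
  oneP = (ℤ.1ℤ , replicate n 0) ∷ []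

  _^P_ : Poly → ℕ → Poly
  p ^P zero = oneP
  p ^P suc k = p *P (p ^P k)

  var : Fin n → Poly
  var g = (ℤ.1ℤ , tabulate (λ h → if does (h Fin.≟ g) then 1 else 0)) ∷ []

  InRing : Subset n → Poly → Set
  InRing G p = ∀ m → coeff p m ≢ ℤ.0ℤ → ∀ g → g ∉ G → lookup m g ≡ 0

  prodVars : Subset n → Poly
  prodVars H = foldr (λ g acc → if lookup H g then var g *P acc else acc) oneP (allFin n)

  sumAbove : Subset n → Fin n → Poly
  sumAbove G B = foldr (λ g acc → if lookup G g ∧ does (B ≤? g) then var g +P acc else acc)
                       zeroP (allFin n)

  record GenTerm (G I : Subset n) : Set where
    field
      H     : Subset n
      B     : Fin n
      d     : ℕ
      H⊆G   : H ⊆ G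
      B∈G   : B ∈ G
      H<B   : ∀ h → h ∈ H → h < B
      isD   : IsD I H B d
      mult  : Poly
      multR : InRing G mult

  genTermPoly : ∀ {G I} → GenTerm G I → Poly
  genTermPoly {G} t = GenTerm.mult t *P (prodVars (GenTerm.H t) *P (sumAbove G (GenTerm.B t) ^P GenTerm.d t))

  InIdeal : Subset n → Subset n → Poly → Set
  InIdeal G I p = Σ[ ts ∈ List (GenTerm G I) ]
                    p ≈P foldr (λ t acc → genTermPoly t +P acc) zeroP ts

  -- rank over ℤ of D(L,G,I) = ℤ[x_g]_{g∈G} / J_I :
  -- the maximal size of a ℤ-linearly independent family in D.

  linComb : ∀ {k} → Vec ℤ k → Vec Poly k → Poly
  linComb Vec.[] Vec.[] = zeroP
  linComb (c Vec.∷ cs) (p Vec.∷ ps) = scaleP c p +P linComb cs ps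

  LinIndepD : Subset n → Subset n → ∀ {k} → Vec Poly k → Set
  LinIndepD G I {k} ps =
    ∀ (cs : Vec ℤ k) → InIdeal G I (linComb cs ps) → VAll.All (_≡ ℤ.0ℤ) cs

  IsRankD : Subset n → Subset n → ℕ → Set
  IsRankD G I r =
    (Σ[ ps ∈ Vec Poly r ] VAll.All (InRing G) ps × LinIndepD G I ps) ×
    (∀ (ps : Vec Poly (suc r)) → VAll.All (InRing G) ps → ¬ LinIndepD G I ps)

{-# OPTIONS --safe #-}
module Submission where

-- Modulo the linear forms Σ_{C ≥ a} x_C of the atoms a, the powers of Σ_{C ≥ B} x_C among the generators of J_I follow
-- from those generators with d = 0. So D(L,G,I) is the Stanley–Reisner ring of the star of I modulo one linear form per
-- atom. Adding b to G₁ is then a blow-up with centre F: put S₀ = S ∖ {b}, R = D(L,G₁,S₀), R′ = D(L,G₁,S₀ ∪ F) and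
-- m = |F ∖ S|. With x_f ↦ x_f + x_b for f ∈ F and ε = x_b,
--   D(L,G₂,S₀ ∪ {b}) = R′[ε] / ∏_{f ∈ F∖S} (x_f − ε),
--   D(L,G₂,S₀) = R[ε] / (ε ker(R → R′), ∏_{f ∈ F∖S} (x_f − ε)),
-- where ∏_{f ∈ F∖S} x_f kills ker(R → R′). As abelian groups these are R′^m and R ⊕ R′^{m−1}, and R′ = 0 when
-- S₀ ∪ F is not nested.

open import Defs
open import Level using (0ℓ)
open import Data.Bool as Bool using (Bool; true; false; if_then_else_; _∧_)
open import Data.Nat as ℕ using (ℕ; zero; suc)
import Data.Nat.Properties as ℕ
open import Data.Integer as ℤ using (ℤ; 0ℤ; 1ℤ; -1ℤ; +_; _+_; _*_; _-_)
import Data.Integer.Properties as ℤ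
open import Data.Integer.Solver using (module +-*-Solver)
open import Data.Fin as Fin using (Fin; zero; suc; punchIn; splitAt; _↑ˡ_; _↑ʳ_)
import Data.Fin.Properties as Fin
open import Data.Fin.Subset as Subset using (Subset; _∈_; _∉_; _⊆_; _∪_; _─_; ⁅_⁆; ∣_∣)
import Data.Fin.Subset.Properties as Sub
open import Data.Vec as Vec using (Vec; lookup; tabulate; zipWith; replicate)
import Data.Vec.Properties as Vec
open import Data.Vec.Functional using (insertAt)
import Data.Vec.Functional.Properties as VecF
open import Data.Vec.Membership.Propositional as VMem using ()
open import Data.Vec.Relation.Unary.All as VAll using ()
import Data.Vec.Relation.Unary.All.Properties as VAll
open import Data.Vec.Relation.Unary.Any as VAny using ()
open import Data.List as List using (List; []; _∷_; _++_; foldr; filter; allFin; length)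
import Data.List.Properties as List
open import Data.List.Membership.DecPropositional using () renaming (_∈?_ to memberOf)
open import Data.List.Membership.Propositional as LMem using ()
open import Data.List.Membership.Propositional.Properties as LMem using ()
open import Data.List.Relation.Unary.All as LAll using ([]; _∷_)
import Data.List.Relation.Unary.All.Properties as LAll
open import Data.List.Relation.Unary.AllPairs using ([]; _∷_)
open import Data.List.Relation.Unary.Any using (here; there)
open import Data.List.Relation.Unary.Unique.Propositional using (Unique)
import Data.List.Relation.Unary.Unique.Propositional.Properties as Unique
open import Data.Product using (Σ; Σ-syntax; ∃-syntax; _×_; _,_; proj₁; proj₂)
open import Data.Sum using (_⊎_; inj₁; inj₂; [_,_]′)
open import Data.Empty using (⊥; ⊥-elim)
open import Relation.Nullary using (¬_; Dec; yes; no; does)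
open import Relation.Nullary.Decidable using (dec-true; dec-false; _×-dec_; _⊎-dec_; ¬?)
open import Relation.Binary.PropositionalEquality as ≡ using (_≡_; _≢_; refl; sym; trans; cong; cong₂; subst)
open import Relation.Binary.Lattice.Structures using (IsLattice)
open import Function using (_∘_; id; case_of_; _|>_)
open import Algebra.Bundles using (CommutativeRing)
open import Algebra.Module.Bundles using (LeftModule)
open import Algebra.Module.Construct.DirectProduct using (leftModule)
import Algebra.Module.Construct.TensorUnit as TensorUnit
import Algebra.Properties.CommutativeMonoid.Sum as Sum

-- Ranks of ℤ-modules

-- Neither R nor R′ is known to be free and no monomial basis enters; ranks are compared by
-- injective homomorphisms in both directions. The obstacle is to show that a blown-up ring is large
-- enough. The candidate answer is therefore built as a group of sequences on which x_g acts as x_g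
-- + c_g ε, and a homomorphism into it needs only that every relator acts as zero. With e_k =
-- ∏_{j<k} (x_{f_j} - ε) as basis instead of the powers of ε, multiplication by ε has two terms, ε
-- e_k = x_{f_k} e_k - e_{k+1}; the relation ∏ (x_f - ε) = 0 is truncation; and the inverse map ε ↦
-- x_b sends e_k to the monomial ∏_{j<k} x_{f_j}, because (x_f + x_b) - x_b = x_f. The substitution
-- x_f ↦ x_f + x_b is the pullback of a divisor through the centre: strict transform plus
-- exceptional divisor.

ℤ-Module : Set₁
ℤ-Module = LeftModule (CommutativeRing.ring ℤ.+-*-commutativeRing) 0ℓ 0ℓ

module ∑ℤ where
  open Sum (CommutativeRing.+-commutativeMonoid ℤ.+-*-commutativeRing) public

  sum-*ˡ : ∀ {n} a (f : Fin n → ℤ) → sum (λ i → a ℤ.* f i) ≡ a ℤ.* sum f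
  sum-*ˡ {zero} a f = sym (ℤ.*-zeroʳ a)
  sum-*ˡ {suc n} a f =
    trans (cong (λ s → a ℤ.* f zero ℤ.+ s) (sum-*ˡ a (f ∘ suc))) (sym (ℤ.*-distribˡ-+ a (f zero) (sum (f ∘ suc))))

  sum-*ʳ : ∀ {n} a (f : Fin n → ℤ) → sum (λ i → f i ℤ.* a) ≡ sum f ℤ.* a
  sum-*ʳ a f = trans (sum-cong-≗ (λ i → ℤ.*-comm (f i) a)) (trans (sum-*ˡ a f) (ℤ.*-comm a (sum f)))

nonzero-product : ∀ {a b : ℤ} → a ≢ 0ℤ → b ≢ 0ℤ → a ℤ.* b ≢ 0ℤ
nonzero-product {a} a≢0 b≢0 ab≡0 with ℤ.i*j≡0⇒i≡0∨j≡0 a ab≡0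
... | inj₁ a≡0 = a≢0 a≡0
... | inj₂ b≡0 = b≢0 b≡0

Relation : ∀ {m k} → (Fin m → Fin k → ℤ) → Set
Relation {m} rows =
  Σ[ c ∈ (Fin m → ℤ) ] (∃[ i ] c i ≢ 0ℤ) × (∀ j → ∑ℤ.sum (λ i → c i ℤ.* rows i j) ≡ 0ℤ)

-- Fraction-free Gaussian elimination: clearing a column by cross-multiplication with the pivot
-- keeps all entries integral and leaves one row and one column fewer.
integer-relation : ∀ k (rows : Fin (suc k) → Fin k → ℤ) → Relation rows
integer-relation zero rows = (λ _ → 1ℤ) , (zero , λ ()) , λ ()
integer-relation (suc k) rows with Fin.any? (λ i → ¬? (rows i zero ℤ.≟ 0ℤ))
-- A zero column imposes no condition. Row 0 is discarded to restore the shape and gets coefficient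
-- 0.
... | no ¬pivot = relation (integer-relation k (λ i j → rows (suc i) (suc j)))
  where
  open ∑ℤ
  head≡0 : ∀ i → rows i zero ≡ 0ℤ
  head≡0 i with rows i zero ℤ.≟ 0ℤ
  ... | yes eq = eq
  ... | no neq = ⊥-elim (¬pivot (i , neq))
  relation : Relation (λ i j → rows (suc i) (suc j)) → Relation rows
  relation (c , (i₀ , c≢0) , eqs) = c′ , (suc i₀ , c≢0) , eqs′
    where
    c′ : Fin (suc (suc k)) → ℤ
    c′ zero = 0ℤ
    c′ (suc i) = c i
    eqs′ : ∀ j → sum (λ i → c′ i ℤ.* rows i j) ≡ 0ℤ
    eqs′ zero = trans (sum-cong-≗ (λ i → trans (cong (c′ i ℤ.*_) (head≡0 i)) (ℤ.*-zeroʳ (c′ i))))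
                        (sum-replicate-zero (suc (suc k)))
    eqs′ (suc j) = trans (ℤ.+-identityˡ _) (eqs j)
... | yes (p , a≢0) = relation (integer-relation k reduced)
  where
  open ∑ℤ
  a : ℤ
  a = rows p zero
  other : Fin (suc k) → Fin (suc k) → ℤ
  other i = rows (punchIn p i)
  reduced : Fin (suc k) → Fin k → ℤ
  reduced i j = a ℤ.* other i (suc j) ℤ.- other i zero ℤ.* rows p (suc j)
  relation : Relation reduced → Relation rows
  relation (c , (i₀ , c≢0) , eqs) = c′ , (punchIn p i₀ , c′≢0) , eqs′
    where
    -- Forced by the first column: the other rows, weighted by `a ℤ.* c i`, contribute `a` times the
    -- sum that is negated here.
    cₚ : ℤ
    cₚ = ℤ.- sum (λ i → c i ℤ.* other i zero)
    c′ : Fin (suc (suc k)) → ℤ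
    c′ = insertAt (λ i → a ℤ.* c i) p cₚ
    c′ₚ : c′ p ≡ cₚ
    c′ₚ = VecF.insertAt-lookup (λ i → a ℤ.* c i) p cₚ
    c′ₒ : ∀ i → c′ (punchIn p i) ≡ a ℤ.* c i
    c′ₒ = VecF.insertAt-punchIn (λ i → a ℤ.* c i) p cₚ
    c′≢0 : c′ (punchIn p i₀) ≢ 0ℤ
    c′≢0 eq = nonzero-product a≢0 c≢0 (trans (sym (c′ₒ i₀)) eq)
    split : ∀ j → sum (λ i → c′ i ℤ.* rows i j) ≡ cₚ ℤ.* rows p j ℤ.+ sum (λ i → a ℤ.* c i ℤ.* other i j)
    split j = trans (sum-remove {i = p} (λ i → c′ i ℤ.* rows i j))
      (cong₂ ℤ._+_ (cong (ℤ._* rows p j) c′ₚ) (sum-cong-≗ (λ i → cong (ℤ._* other i j) (c′ₒ i))))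
    open +-*-Solver using (solve; _:+_; _:*_; _:-_; :-_; _:=_; con)
    eqs′ : ∀ j → sum (λ i → c′ i ℤ.* rows i j) ≡ 0ℤ
    eqs′ zero = begin
      sum (λ i → c′ i ℤ.* rows i zero)                            ≡⟨ split zero ⟩
      cₚ ℤ.* a ℤ.+ sum (λ i → a ℤ.* c i ℤ.* other i zero)         ≡⟨ cong (λ s → cₚ ℤ.* a ℤ.+ s) (trans (sum-cong-≗ (λ i → ℤ.*-assoc a (c i) (other i zero))) (sum-*ˡ a (λ i → c i ℤ.* other i zero))) ⟩
      cₚ ℤ.* a ℤ.+ a ℤ.* sum (λ i → c i ℤ.* other i zero)         ≡⟨ solve 2 (λ s a → (:- s) :* a :+ a :* s := con 0ℤ) refl (sum (λ i → c i ℤ.* other i zero)) a ⟩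
      0ℤ ∎
      where open ≡.≡-Reasoning
    eqs′ (suc j) = begin
      sum (λ i → c′ i ℤ.* rows i (suc j))                         ≡⟨ split (suc j) ⟩
      cₚ ℤ.* q ℤ.+ sum (λ i → a ℤ.* c i ℤ.* other i (suc j))      ≡⟨ cong (λ s → cₚ ℤ.* q ℤ.+ s) (sum-cong-≗ (λ i →
          solve 5 (λ a c o z q → a :* c :* o := c :* (a :* o :- z :* q) :+ c :* z :* q) refl a (c i) (other i (suc j)) (other i zero) q)) ⟩
      cₚ ℤ.* q ℤ.+ sum (λ i → c i ℤ.* reduced i j ℤ.+ c i ℤ.* other i zero ℤ.* q)
                                                                  ≡⟨ cong (λ s → cₚ ℤ.* q ℤ.+ s) (∑-distrib-+ (λ i → c i ℤ.* reduced i j) (λ i → c i ℤ.* other i zero ℤ.* q)) ⟩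
      cₚ ℤ.* q ℤ.+ (sum (λ i → c i ℤ.* reduced i j) ℤ.+ sum (λ i → c i ℤ.* other i zero ℤ.* q))
                                                                  ≡⟨ cong (λ s → cₚ ℤ.* q ℤ.+ s) (cong₂ ℤ._+_ (eqs j) (sum-*ʳ q (λ i → c i ℤ.* other i zero))) ⟩
      cₚ ℤ.* q ℤ.+ (0ℤ ℤ.+ sum (λ i → c i ℤ.* other i zero) ℤ.* q)
                                                                  ≡⟨ solve 2 (λ s q → (:- s) :* q :+ (con 0ℤ :+ s :* q) := con 0ℤ) refl (sum (λ i → c i ℤ.* other i zero)) q ⟩
      0ℤ ∎
      where
      open ≡.≡-Reasoning
      q = rows p (suc j)

-- Whether a multiple of a vector lies in a given span cannot be decided, so the dimension count for
-- direct sums runs under double negation. Its goal is a negation, and only finitely many instances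
-- are needed.
¬¬-Fin : ∀ {k} {P : Fin k → Set} → (∀ i → ¬ ¬ P i) → ¬ ¬ (∀ i → P i)
¬¬-Fin {zero} _ ¬all = ¬all λ ()
¬¬-Fin {suc k} nn ¬all = nn zero λ p₀ → ¬¬-Fin (nn ∘ suc) λ ps → ¬all λ { zero → p₀ ; (suc i) → ps i }

module Rank (M : ℤ-Module) where
  open LeftModule M public
  open Sum +ᴹ-commutativeMonoid public using (sum; sum-cong-≋; ∑-distrib-+; ∑-comm; sum-replicate-zero)

  lin : ∀ {k} → (Fin k → ℤ) → (Fin k → Carrierᴹ) → Carrierᴹ
  lin c v = sum (λ i → c i *ₗ v i)

  Indep : ∀ {k} → (Fin k → Carrierᴹ) → Set
  Indep {k} v = ∀ (c : Fin k → ℤ) → lin c v ≈ᴹ 0ᴹ → ∀ i → c i ≡ 0ℤ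

  HasRank : ℕ → Set
  HasRank r = (∃[ v ] Indep {r} v) × (∀ (v : Fin (suc r) → Carrierᴹ) → ¬ Indep v)

  sum-*ₗ : ∀ {k} a (f : Fin k → Carrierᴹ) → a *ₗ sum f ≈ᴹ sum (λ i → a *ₗ f i)
  sum-*ₗ {zero} a f = *ₗ-zeroʳ a
  sum-*ₗ {suc k} a f = ≈ᴹ-trans (*ₗ-distribˡ a _ _) (+ᴹ-congˡ (sum-*ₗ a (f ∘ suc)))

  sum-*ₗʳ : ∀ {k} (c : Fin k → ℤ) v → sum (λ i → c i *ₗ v) ≈ᴹ ∑ℤ.sum c *ₗ v
  sum-*ₗʳ {zero} c v = ≈ᴹ-sym (*ₗ-zeroˡ v)
  sum-*ₗʳ {suc k} c v = ≈ᴹ-trans (+ᴹ-congˡ (sum-*ₗʳ (c ∘ suc) v)) (≈ᴹ-sym (*ₗ-distribʳ v _ _))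

  sum-zero : ∀ {k} {f : Fin k → Carrierᴹ} → (∀ i → f i ≈ᴹ 0ᴹ) → sum f ≈ᴹ 0ᴹ
  sum-zero {k} z = ≈ᴹ-trans (sum-cong-≋ z) (sum-replicate-zero k)

  indep-tail : ∀ {k} (v : Fin (suc k) → Carrierᴹ) → Indep v → Indep (v ∘ suc)
  indep-tail {k} v ind c eq i = ind c′ (≈ᴹ-trans (+ᴹ-cong (*ₗ-zeroˡ (v zero)) eq) (+ᴹ-identityˡ 0ᴹ)) (suc i)
    where
    c′ : Fin (suc k) → ℤ
    c′ zero = 0ℤ
    c′ (suc i) = c i

  indep-truncate : ∀ d {k} (v : Fin (d ℕ.+ k) → Carrierᴹ) → Indep v → ∃[ w ] Indep {k} w
  indep-truncate zero v ind = v , ind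
  indep-truncate (suc d) v ind = indep-truncate d (v ∘ suc) (indep-tail v ind)

  indep-≤ : ∀ {r k} → HasRank r → (v : Fin k → Carrierᴹ) → Indep v → k ℕ.≤ r
  indep-≤ {r} {k} (_ , max) v ind with k ℕ.≤? r
  ... | yes k≤r = k≤r
  ... | no k≰r = ⊥-elim (max (w .proj₁) (w .proj₂))
    where
    k≡ : k ≡ (k ℕ.∸ suc r) ℕ.+ suc r
    k≡ = sym (ℕ.m∸n+n≡m (ℕ.≰⇒> k≰r))
    v′ : ∃[ v ] Indep {(k ℕ.∸ suc r) ℕ.+ suc r} v
    v′ = subst (λ k → ∃[ v ] Indep {k} v) k≡ (v , ind)
    w : ∃[ w ] Indep {suc r} w
    w = indep-truncate (k ℕ.∸ suc r) (v′ .proj₁) (v′ .proj₂)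

  rank-unique : ∀ {r s} → HasRank r → HasRank s → r ≡ s
  rank-unique ρ σ = ℕ.≤-antisym (indep-≤ σ _ (ρ .proj₁ .proj₂)) (indep-≤ ρ _ (σ .proj₁ .proj₂))

  Multiple : ∀ {k} → (Fin k → Carrierᴹ) → Carrierᴹ → ℤ → Set
  Multiple {k} α v N = Σ[ c ∈ (Fin k → ℤ) ] N *ₗ v ≈ᴹ lin c α

  -- By maximality the family extended by v is not independent, and independence of the family
  -- itself forbids a relation in which v has coefficient 0. The result is doubly negated because
  -- maximality refutes independence without exhibiting a relation.
  rank-multiple : ∀ {r} (ρ : HasRank r) v → ¬ ¬ (∃[ N ] N ≢ 0ℤ × Multiple (ρ .proj₁ .proj₁) v N)
  rank-multiple {r} ((α , ind) , max) v none = max v∷α λ c eq → indep c eq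
    where
    v∷α : Fin (suc r) → Carrierᴹ
    v∷α zero = v
    v∷α (suc i) = α i
    move : ∀ N c → N *ₗ v +ᴹ lin c α ≈ᴹ 0ᴹ → N *ₗ v ≈ᴹ lin (λ i → -1ℤ ℤ.* c i) α
    move N c eq = begin
      N *ₗ v ≈⟨ +ᴹ-identityʳ _ ⟨
      N *ₗ v +ᴹ 0ᴹ ≈⟨ +ᴹ-congˡ (*ₗ-zeroˡ _) ⟨
      N *ₗ v +ᴹ 0ℤ *ₗ lin c α ≈⟨ +ᴹ-congˡ (*ₗ-distribʳ _ 1ℤ -1ℤ) ⟩
      N *ₗ v +ᴹ (1ℤ *ₗ lin c α +ᴹ -1ℤ *ₗ lin c α) ≈⟨ +ᴹ-congˡ (+ᴹ-congʳ (*ₗ-identityˡ _)) ⟩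
      N *ₗ v +ᴹ (lin c α +ᴹ -1ℤ *ₗ lin c α) ≈⟨ +ᴹ-assoc _ _ _ ⟨
      N *ₗ v +ᴹ lin c α +ᴹ -1ℤ *ₗ lin c α ≈⟨ +ᴹ-congʳ eq ⟩
      0ᴹ +ᴹ -1ℤ *ₗ lin c α ≈⟨ +ᴹ-identityˡ _ ⟩
      -1ℤ *ₗ lin c α ≈⟨ sum-*ₗ -1ℤ (λ i → c i *ₗ α i) ⟩
      sum (λ i → -1ℤ *ₗ (c i *ₗ α i)) ≈⟨ sum-cong-≋ (λ i → *ₗ-assoc -1ℤ (c i) (α i)) ⟨
      lin (λ i → -1ℤ ℤ.* c i) α ∎
      where open import Relation.Binary.Reasoning.Setoid ≈ᴹ-setoid
    indep : Indep v∷α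
    indep c eq with c zero ℤ.≟ 0ℤ
    ... | no c₀≢0 = ⊥-elim (none (c zero , c₀≢0 , _ , move (c zero) (c ∘ suc) eq))
    ... | yes c₀≡0 = λ { zero → c₀≡0 ; (suc i) → ind (c ∘ suc) tail≈0 i }
      where
      tail≈0 : lin (c ∘ suc) α ≈ᴹ 0ᴹ
      tail≈0 = ≈ᴹ-trans (≈ᴹ-sym (+ᴹ-identityˡ _)) (≈ᴹ-trans (+ᴹ-congʳ (≈ᴹ-sym (≈ᴹ-trans (*ₗ-cong c₀≡0 ≈ᴹ-refl) (*ₗ-zeroˡ v)))) eq)

  multiple-scale : ∀ {k} {α : Fin k → Carrierᴹ} {v N} K → Multiple α v N → Multiple α v (K ℤ.* N)
  multiple-scale {α = α} {v} {N} K (c , eq) = (λ j → K ℤ.* c j) ,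
    ≈ᴹ-trans (*ₗ-assoc K N v) (≈ᴹ-trans (*ₗ-cong refl eq)
      (≈ᴹ-trans (sum-*ₗ K (λ j → c j *ₗ α j)) (sum-cong-≋ λ j → ≈ᴹ-sym (*ₗ-assoc K (c j) (α j)))))

  -- Carries a relation between coordinate rows, as `integer-relation` provides, back into the
  -- module; the multipliers `N i` are absorbed into its coefficients.
  combine-multiples : ∀ {k l} {α : Fin k → Carrierᴹ} {v : Fin l → Carrierᴹ} {N : Fin l → ℤ}
    (μ : ∀ i → Multiple α (v i) (N i)) (λs : Fin l → ℤ) →
    (∀ j → ∑ℤ.sum (λ i → λs i ℤ.* μ i .proj₁ j) ≡ 0ℤ) → lin (λ i → λs i ℤ.* N i) v ≈ᴹ 0ᴹ
  combine-multiples {α = α} {v} {N} μ λs eqs = begin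
    sum (λ i → (λs i ℤ.* N i) *ₗ v i) ≈⟨ sum-cong-≋ (λ i → *ₗ-assoc (λs i) (N i) (v i)) ⟩
    sum (λ i → λs i *ₗ (N i *ₗ v i)) ≈⟨ sum-cong-≋ (λ i → *ₗ-cong refl (μ i .proj₂)) ⟩
    sum (λ i → λs i *ₗ sum (λ j → μ i .proj₁ j *ₗ α j)) ≈⟨ sum-cong-≋ (λ i → sum-*ₗ (λs i) (λ j → μ i .proj₁ j *ₗ α j)) ⟩
    sum (λ i → sum (λ j → λs i *ₗ (μ i .proj₁ j *ₗ α j))) ≈⟨ ∑-comm (λ i j → λs i *ₗ (μ i .proj₁ j *ₗ α j)) ⟩
    sum (λ j → sum (λ i → λs i *ₗ (μ i .proj₁ j *ₗ α j))) ≈⟨ sum-cong-≋ (λ j → sum-cong-≋ λ i → *ₗ-assoc (λs i) (μ i .proj₁ j) (α j)) ⟨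
    sum (λ j → sum (λ i → (λs i ℤ.* μ i .proj₁ j) *ₗ α j)) ≈⟨ sum-zero (λ j → ≈ᴹ-trans (sum-*ₗʳ (λ i → λs i ℤ.* μ i .proj₁ j) (α j)) (≈ᴹ-trans (*ₗ-cong (eqs j) ≈ᴹ-refl) (*ₗ-zeroˡ (α j)))) ⟩
    0ᴹ ∎
    where open import Relation.Binary.Reasoning.Setoid ≈ᴹ-setoid

  sum-++ : ∀ m {n} (f : Fin (m ℕ.+ n) → Carrierᴹ) → sum f ≈ᴹ sum (λ i → f (i ↑ˡ n)) +ᴹ sum (λ j → f (m ↑ʳ j))
  sum-++ zero f = ≈ᴹ-sym (+ᴹ-identityˡ _)
  sum-++ (suc m) f = ≈ᴹ-trans (+ᴹ-congˡ (sum-++ m (f ∘ suc))) (≈ᴹ-sym (+ᴹ-assoc _ _ _))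

record _↪_ (M N : ℤ-Module) : Set where
  private
    module M = Rank M
    module N = Rank N
  field
    to      : M.Carrierᴹ → N.Carrierᴹ
    cong-to : ∀ {u v} → u M.≈ᴹ v → to u N.≈ᴹ to v
    to-+    : ∀ u v → to (u M.+ᴹ v) N.≈ᴹ to u N.+ᴹ to v
    to-*    : ∀ c v → to (c M.*ₗ v) N.≈ᴹ c N.*ₗ to v
    reflect : ∀ v → to v N.≈ᴹ N.0ᴹ → v M.≈ᴹ M.0ᴹ

  to-0 : to M.0ᴹ N.≈ᴹ N.0ᴹ
  to-0 = N.≈ᴹ-trans (cong-to (M.≈ᴹ-sym (M.*ₗ-zeroˡ M.0ᴹ))) (N.≈ᴹ-trans (to-* 0ℤ M.0ᴹ) (N.*ₗ-zeroˡ _))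

  to-lin : ∀ {k} (c : Fin k → ℤ) v → to (M.lin c v) N.≈ᴹ N.lin c (to ∘ v)
  to-lin {zero} c v = to-0
  to-lin {suc k} c v = N.≈ᴹ-trans (to-+ _ _) (N.+ᴹ-cong (to-* _ _) (to-lin (c ∘ suc) (v ∘ suc)))

  indep-to : ∀ {k} (v : Fin k → M.Carrierᴹ) → M.Indep v → N.Indep (to ∘ v)
  indep-to v ind c eq = ind c (reflect _ (N.≈ᴹ-trans (to-lin c v) eq))

-- Each embedding carries independent families to independent families, so the two need not be
-- inverse to each other.
rank-transport : ∀ {M N} → M ↪ N → N ↪ M → ∀ {r} → Rank.HasRank M r → Rank.HasRank N r
rank-transport f g ((v , ind) , max) = (_↪_.to f ∘ v , _↪_.indep-to f v ind) , λ w indw → max (_↪_.to g ∘ w) (_↪_.indep-to g w indw)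

module _ (M N : ℤ-Module) where
  private
    module M = Rank M
    module N = Rank N
    module P = Rank (leftModule M N)

  proj₁-lin : ∀ {k} (c : Fin k → ℤ) v → P.lin c v .proj₁ ≡ M.lin c (proj₁ ∘ v)
  proj₁-lin {zero} c v = refl
  proj₁-lin {suc k} c v = cong (λ s → _ M.+ᴹ s) (proj₁-lin (c ∘ suc) (v ∘ suc))

  proj₂-lin : ∀ {k} (c : Fin k → ℤ) v → P.lin c v .proj₂ ≡ N.lin c (proj₂ ∘ v)
  proj₂-lin {zero} c v = refl
  proj₂-lin {suc k} c v = cong (λ s → _ N.+ᴹ s) (proj₂-lin (c ∘ suc) (v ∘ suc))

  -- Maximal families of both summands combine to an independent one. Conversely, r + s + 1 vectors
  -- have nonzero multiples with integer coordinates in r + s columns, and these rows are dependent.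
  rank-⊕ : ∀ {r s} → M.HasRank r → N.HasRank s → P.HasRank (r ℕ.+ s)
  rank-⊕ {r} {s} ρ@((α , indα) , _) σ@((β , indβ) , _) = (v , indep) , upper
    where
    v : Fin (r ℕ.+ s) → P.Carrierᴹ
    v i = [ (λ j → α j , N.0ᴹ) , (λ j → M.0ᴹ , β j) ]′ (splitAt r i)

    vˡ : ∀ j → v (j ↑ˡ s) ≡ (α j , N.0ᴹ)
    vˡ j = cong [ _ , _ ]′ (Fin.splitAt-↑ˡ r j s)
    vʳ : ∀ j → v (r ↑ʳ j) ≡ (M.0ᴹ , β j)
    vʳ j = cong [ _ , _ ]′ (Fin.splitAt-↑ʳ r s j)

    indep : P.Indep v
    indep c eq i = trans (cong c (sym (Fin.join-splitAt r s i))) (coeff≡0 (splitAt r i))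
      where
      M-part : M.lin (λ j → c (j ↑ˡ s)) α M.≈ᴹ M.0ᴹ
      M-part = begin
        M.lin (λ j → c (j ↑ˡ s)) α ≈⟨ M.sum-cong-≋ (λ j → M.*ₗ-cong refl (M.≈ᴹ-reflexive (cong proj₁ (vˡ j)))) ⟨
        M.sum (λ j → c (j ↑ˡ s) M.*ₗ v (j ↑ˡ s) .proj₁) ≈⟨ M.+ᴹ-identityʳ _ ⟨
        M.sum (λ j → c (j ↑ˡ s) M.*ₗ v (j ↑ˡ s) .proj₁) M.+ᴹ M.0ᴹ
          ≈⟨ M.+ᴹ-congˡ (M.sum-zero (λ j → M.≈ᴹ-trans (M.*ₗ-cong refl (M.≈ᴹ-reflexive (cong proj₁ (vʳ j)))) (M.*ₗ-zeroʳ (c (r ↑ʳ j))))) ⟨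
        M.sum (λ j → c (j ↑ˡ s) M.*ₗ v (j ↑ˡ s) .proj₁) M.+ᴹ M.sum (λ j → c (r ↑ʳ j) M.*ₗ v (r ↑ʳ j) .proj₁) ≈⟨ M.sum-++ r _ ⟨
        M.lin c (proj₁ ∘ v) ≡⟨ proj₁-lin c v ⟨
        P.lin c v .proj₁ ≈⟨ eq .proj₁ ⟩
        M.0ᴹ ∎
        where open import Relation.Binary.Reasoning.Setoid M.≈ᴹ-setoid
      N-part : N.lin (λ j → c (r ↑ʳ j)) β N.≈ᴹ N.0ᴹ
      N-part = begin
        N.lin (λ j → c (r ↑ʳ j)) β ≈⟨ N.sum-cong-≋ (λ j → N.*ₗ-cong refl (N.≈ᴹ-reflexive (cong proj₂ (vʳ j)))) ⟨
        N.sum (λ j → c (r ↑ʳ j) N.*ₗ v (r ↑ʳ j) .proj₂) ≈⟨ N.+ᴹ-identityˡ _ ⟨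
        N.0ᴹ N.+ᴹ N.sum (λ j → c (r ↑ʳ j) N.*ₗ v (r ↑ʳ j) .proj₂)
          ≈⟨ N.+ᴹ-congʳ (N.sum-zero (λ j → N.≈ᴹ-trans (N.*ₗ-cong refl (N.≈ᴹ-reflexive (cong proj₂ (vˡ j)))) (N.*ₗ-zeroʳ (c (j ↑ˡ s))))) ⟨
        N.sum (λ j → c (j ↑ˡ s) N.*ₗ v (j ↑ˡ s) .proj₂) N.+ᴹ N.sum (λ j → c (r ↑ʳ j) N.*ₗ v (r ↑ʳ j) .proj₂) ≈⟨ N.sum-++ r _ ⟨
        N.lin c (proj₂ ∘ v) ≡⟨ proj₂-lin c v ⟨
        P.lin c v .proj₂ ≈⟨ eq .proj₂ ⟩
        N.0ᴹ ∎
        where open import Relation.Binary.Reasoning.Setoid N.≈ᴹ-setoid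
      coeff≡0 : ∀ t → c (Fin.join r s t) ≡ 0ℤ
      coeff≡0 (inj₁ j) = indα _ M-part j
      coeff≡0 (inj₂ j) = indβ _ N-part j

    Multiples : (Fin (suc (r ℕ.+ s)) → P.Carrierᴹ) → Fin (suc (r ℕ.+ s)) → Set
    Multiples w i = ∃[ N ] N ≢ 0ℤ × M.Multiple α (w i .proj₁) N × N.Multiple β (w i .proj₂) N

    upper : ∀ w → ¬ P.Indep w
    upper w ind = ¬¬-Fin multiples contradiction
      where
      multiples : ∀ i → ¬ ¬ Multiples w i
      multiples i k = M.rank-multiple ρ (w i .proj₁) λ (a , a≢0 , μ) →
        N.rank-multiple σ (w i .proj₂) λ (b , b≢0 , ν) →
        -- One multiplier has to serve both components, hence the product of the two.
        k (b ℤ.* a , nonzero-product b≢0 a≢0 , M.multiple-scale b μ ,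
           subst (N.Multiple β (w i .proj₂)) (ℤ.*-comm a b) (N.multiple-scale a ν))
      contradiction : ¬ (∀ i → Multiples w i)
      contradiction μν = absurd (integer-relation (r ℕ.+ s) (λ i j → row i (splitAt r j)))
        where
        row : Fin (suc (r ℕ.+ s)) → Fin r ⊎ Fin s → ℤ
        row i = [ μν i .proj₂ .proj₂ .proj₁ .proj₁ , μν i .proj₂ .proj₂ .proj₂ .proj₁ ]′
        absurd : ¬ Relation (λ i j → row i (splitAt r j))
        absurd (λs , (i₀ , λ≢0) , eqs) = nonzero-product λ≢0 (μν i₀ .proj₂ .proj₁)
          (ind (λ i → λs i ℤ.* μν i .proj₁) (M-part , N-part) i₀)
          where
          M-part = M.≈ᴹ-trans (M.≈ᴹ-reflexive (proj₁-lin (λ i → λs i ℤ.* μν i .proj₁) w))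
            (M.combine-multiples (λ i → μν i .proj₂ .proj₂ .proj₁) λs λ j →
              trans (∑ℤ.sum-cong-≗ λ i → cong (λ t → λs i ℤ.* row i t) (sym (Fin.splitAt-↑ˡ r j s))) (eqs (j ↑ˡ s)))
          N-part = N.≈ᴹ-trans (N.≈ᴹ-reflexive (proj₂-lin (λ i → λs i ℤ.* μν i .proj₁) w))
            (N.combine-multiples (λ i → μν i .proj₂ .proj₂ .proj₂) λs λ j →
              trans (∑ℤ.sum-cong-≗ λ i → cong (λ t → λs i ℤ.* row i t) (sym (Fin.splitAt-↑ʳ r s j))) (eqs (r ↑ʳ j)))

module _ (M : ℤ-Module) where
  private module M = Rank M

  -- The power M^m. Elements are infinite sequences of which equality sees the first m entries only,
  -- so that shifts and tails need no index arithmetic.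
  seqModule : ℕ → ℤ-Module
  seqModule m = record
    { Carrierᴹ = ℕ → M.Carrierᴹ
    ; _≈ᴹ_ = λ u v → ∀ k → k ℕ.< m → u k M.≈ᴹ v k
    ; _+ᴹ_ = λ u v k → u k M.+ᴹ v k
    ; _*ₗ_ = λ c v k → c M.*ₗ v k
    ; 0ᴹ = λ _ → M.0ᴹ
    ; -ᴹ_ = λ v k → M.-ᴹ v k
    ; isLeftModule = record
      { isLeftSemimodule = record
        { +ᴹ-isCommutativeMonoid = record
          { isMonoid = record
            { isSemigroup = record
              { isMagma = record
                { isEquivalence = record
                  { refl = λ _ _ → M.≈ᴹ-refl
                  ; sym = λ eq k lt → M.≈ᴹ-sym (eq k lt)
                  ; trans = λ eq eq′ k lt → M.≈ᴹ-trans (eq k lt) (eq′ k lt) }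
                ; ∙-cong = λ eq eq′ k lt → M.+ᴹ-cong (eq k lt) (eq′ k lt) }
              ; assoc = λ u v w k _ → M.+ᴹ-assoc (u k) (v k) (w k) }
            ; identity = (λ v k _ → M.+ᴹ-identityˡ (v k)) , (λ v k _ → M.+ᴹ-identityʳ (v k)) }
          ; comm = λ u v k _ → M.+ᴹ-comm (u k) (v k) }
        ; isPreleftSemimodule = record
          { *ₗ-cong = λ eq eq′ k lt → M.*ₗ-cong eq (eq′ k lt)
          ; *ₗ-zeroˡ = λ v k _ → M.*ₗ-zeroˡ (v k)
          ; *ₗ-distribʳ = λ v x y k _ → M.*ₗ-distribʳ (v k) x y
          ; *ₗ-identityˡ = λ v k _ → M.*ₗ-identityˡ (v k)
          ; *ₗ-assoc = λ x y v k _ → M.*ₗ-assoc x y (v k)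
          ; *ₗ-zeroʳ = λ x k _ → M.*ₗ-zeroʳ x
          ; *ₗ-distribˡ = λ x u v k _ → M.*ₗ-distribˡ x (u k) (v k) } }
      ; -ᴹ‿cong = λ eq k lt → M.-ᴹ‿cong (eq k lt)
      ; -ᴹ‿inverse = (λ v k _ → M.-ᴹ‿inverseˡ (v k)) , (λ v k _ → M.-ᴹ‿inverseʳ (v k)) } }

  rank-seq : ∀ m {r} → M.HasRank r → Rank.HasRank (seqModule m) (m ℕ.* r)
  rank-seq zero ρ = ((λ ()) , λ _ _ ()) , λ v ind → case ind (λ _ → 1ℤ) (λ _ ()) zero of λ ()
  rank-seq (suc m) ρ = rank-transport uncons cons (rank-⊕ M (seqModule m) ρ (rank-seq m ρ))
    where
    uncons : leftModule M (seqModule m) ↪ seqModule (suc m)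
    uncons = record
      { to = λ { (u , v) zero → u ; (u , v) (suc k) → v k }
      ; cong-to = λ { (eq , eqs) zero _ → eq ; (eq , eqs) (suc k) (ℕ.s≤s lt) → eqs k lt }
      ; to-+ = λ { _ _ zero _ → M.≈ᴹ-refl ; _ _ (suc k) _ → M.≈ᴹ-refl }
      ; to-* = λ { _ _ zero _ → M.≈ᴹ-refl ; _ _ (suc k) _ → M.≈ᴹ-refl }
      ; reflect = λ v eq → eq zero (ℕ.s≤s ℕ.z≤n) , λ k lt → eq (suc k) (ℕ.s≤s lt) }
    cons : seqModule (suc m) ↪ leftModule M (seqModule m)
    cons = record
      { to = λ v → v zero , v ∘ suc
      ; cong-to = λ eq → eq zero (ℕ.s≤s ℕ.z≤n) , λ k lt → eq (suc k) (ℕ.s≤s lt)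
      ; to-+ = λ _ _ → M.≈ᴹ-refl , λ _ _ → M.≈ᴹ-refl
      ; to-* = λ _ _ → M.≈ᴹ-refl , λ _ _ → M.≈ᴹ-refl
      ; reflect = λ { v (eq , eqs) zero _ → eq ; v (eq , eqs) (suc k) (ℕ.s≤s lt) → eqs k lt } }

-- Presented commutative rings

infixl 6 _⊕_
infixl 7 _⊗_

data Expr (n : ℕ) : Set where
  con     : ℤ → Expr n
  X       : Fin n → Expr n
  _⊕_ _⊗_ : Expr n → Expr n → Expr n

pattern 𝟘 = con (ℤ.+ 0)
pattern 𝟙 = con (ℤ.+ 1)

module _ {n : ℕ} where

  neg : Expr n → Expr n
  neg p = con -1ℤ ⊗ p

  prodX : List (Fin n) → Expr n
  prodX = foldr (λ g p → X g ⊗ p) 𝟙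

  sumOf : (Fin n → Expr n) → List (Fin n) → Expr n
  sumOf t = foldr (λ g p → t g ⊕ p) 𝟘

  bind : (Fin n → Expr n) → Expr n → Expr n
  bind σ (con c) = con c
  bind σ (X g) = σ g
  bind σ (p ⊕ q) = bind σ p ⊕ bind σ q
  bind σ (p ⊗ q) = bind σ p ⊗ bind σ q

  bind-X : ∀ p → bind X p ≡ p
  bind-X (con c) = refl
  bind-X (X g) = refl
  bind-X (p ⊕ q) = cong₂ _⊕_ (bind-X p) (bind-X q)
  bind-X (p ⊗ q) = cong₂ _⊗_ (bind-X p) (bind-X q)

module Quotient {n : ℕ} (Z : Expr n → Set) where

  infix 4 _∼_

  -- The congruence generated by the ring axioms, the arithmetic of constants and the relators. Maps
  -- out of the quotient are then checked by recursion on derivations, without normal forms or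
  -- explicit ideal membership.
  data _∼_ : Expr n → Expr n → Set where
    ∼-refl    : ∀ {p} → p ∼ p
    ∼-sym     : ∀ {p q} → p ∼ q → q ∼ p
    ∼-trans   : ∀ {p q r} → p ∼ q → q ∼ r → p ∼ r
    ⊕-cong    : ∀ {p p′ q q′} → p ∼ p′ → q ∼ q′ → p ⊕ q ∼ p′ ⊕ q′
    ⊗-cong    : ∀ {p p′ q q′} → p ∼ p′ → q ∼ q′ → p ⊗ q ∼ p′ ⊗ q′
    ⊕-assoc   : ∀ p q r → p ⊕ q ⊕ r ∼ p ⊕ (q ⊕ r)
    ⊕-comm    : ∀ p q → p ⊕ q ∼ q ⊕ p
    ⊕-zeroˡ   : ∀ p → 𝟘 ⊕ p ∼ p
    ⊗-assoc   : ∀ p q r → p ⊗ q ⊗ r ∼ p ⊗ (q ⊗ r)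
    ⊗-comm    : ∀ p q → p ⊗ q ∼ q ⊗ p
    ⊗-oneˡ    : ∀ p → 𝟙 ⊗ p ∼ p
    ⊗-zeroˡ   : ∀ p → 𝟘 ⊗ p ∼ 𝟘
    ⊗-distrib : ∀ p q r → (p ⊕ q) ⊗ r ∼ p ⊗ r ⊕ q ⊗ r
    con-+     : ∀ a b → con (a ℤ.+ b) ∼ con a ⊕ con b
    con-*     : ∀ a b → con (a ℤ.* b) ∼ con a ⊗ con b
    vanish    : ∀ {p} → Z p → p ∼ 𝟘

  ⊕-congˡ : ∀ {p q q′} → q ∼ q′ → p ⊕ q ∼ p ⊕ q′
  ⊕-congˡ = ⊕-cong ∼-refl

  ⊗-congˡ : ∀ {p q q′} → q ∼ q′ → p ⊗ q ∼ p ⊗ q′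
  ⊗-congˡ = ⊗-cong ∼-refl

  ⊗-oneʳ : ∀ p → p ⊗ 𝟙 ∼ p
  ⊗-oneʳ p = ∼-trans (⊗-comm p _) (⊗-oneˡ p)

  ⊕-zeroʳ : ∀ p → p ⊕ 𝟘 ∼ p
  ⊕-zeroʳ p = ∼-trans (⊕-comm p _) (⊕-zeroˡ p)

  ⊗-zeroʳ : ∀ p → p ⊗ 𝟘 ∼ 𝟘
  ⊗-zeroʳ p = ∼-trans (⊗-comm p _) (⊗-zeroˡ p)

  ⊗-distribˡ : ∀ r p q → r ⊗ (p ⊕ q) ∼ r ⊗ p ⊕ r ⊗ q
  ⊗-distribˡ r p q = ∼-trans (⊗-comm r _) (∼-trans (⊗-distrib p q r) (⊕-cong (⊗-comm p r) (⊗-comm q r)))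

  ⊕-neg : ∀ p → p ⊕ neg p ∼ 𝟘
  ⊕-neg p = ∼-trans (⊕-cong (∼-sym (⊗-oneˡ p)) ∼-refl) (∼-trans (∼-sym (⊗-distrib _ _ p))
    (∼-trans (⊗-cong (∼-sym (con-+ 1ℤ -1ℤ)) ∼-refl) (⊗-zeroˡ p)))

  neg-⊕ : ∀ p → neg p ⊕ p ∼ 𝟘
  neg-⊕ p = ∼-trans (⊕-comm _ p) (⊕-neg p)

  ring : CommutativeRing 0ℓ 0ℓ
  ring = record
    { Carrier = Expr n ; _≈_ = _∼_ ; _+_ = _⊕_ ; _*_ = _⊗_ ; -_ = neg ; 0# = 𝟘 ; 1# = 𝟙
    ; isCommutativeRing = record
      { isRing = record
        { +-isAbelianGroup = record
          { isGroup = record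
            { isMonoid = record
              { isSemigroup = record
                { isMagma = record
                  { isEquivalence = record { refl = ∼-refl ; sym = ∼-sym ; trans = ∼-trans }
                  ; ∙-cong = ⊕-cong }
                ; assoc = ⊕-assoc }
              ; identity = ⊕-zeroˡ , ⊕-zeroʳ }
            ; inverse = neg-⊕ , ⊕-neg
            ; ⁻¹-cong = ⊗-congˡ }
          ; comm = ⊕-comm }
        ; *-cong = ⊗-cong
        ; *-assoc = ⊗-assoc
        ; *-identity = ⊗-oneˡ , ⊗-oneʳ
        ; distrib = ⊗-distribˡ , λ r p q → ⊗-distrib p q r }
      ; *-comm = ⊗-comm } }

  open CommutativeRing ring public using (setoid; commutativeSemiring; reflexive)

  con-reflexive : ∀ {a b} → a ≡ b → con a ∼ con b
  con-reflexive refl = ∼-refl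

  additive : ℤ-Module
  additive = record
    { Carrierᴹ = Expr n ; _≈ᴹ_ = _∼_ ; _+ᴹ_ = _⊕_ ; _*ₗ_ = λ c p → con c ⊗ p ; 0ᴹ = 𝟘 ; -ᴹ_ = neg
    ; isLeftModule = record
      { isLeftSemimodule = record
        { +ᴹ-isCommutativeMonoid = CommutativeRing.+-isCommutativeMonoid ring
        ; isPreleftSemimodule = record
          { *ₗ-cong = λ eq eq′ → ⊗-cong (con-reflexive eq) eq′
          ; *ₗ-zeroˡ = ⊗-zeroˡ
          ; *ₗ-distribʳ = λ p a b → ∼-trans (⊗-cong (con-+ a b) ∼-refl) (⊗-distrib _ _ p)
          ; *ₗ-identityˡ = ⊗-oneˡ
          ; *ₗ-assoc = λ a b p → ∼-trans (⊗-cong (con-* a b) ∼-refl) (⊗-assoc _ _ p)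
          ; *ₗ-zeroʳ = λ a → ⊗-zeroʳ _
          ; *ₗ-distribˡ = λ a → ⊗-distribˡ (con a) } }
      ; -ᴹ‿cong = ⊗-cong ∼-refl
      ; -ᴹ‿inverse = neg-⊕ , ⊕-neg } }

  open import Algebra.Solver.Ring.NaturalCoefficients.Default commutativeSemiring public
    using (solve; _:+_; _:*_; _:=_)

  swap-⊗ : ∀ p q r → p ⊗ (q ⊗ r) ∼ q ⊗ (p ⊗ r)
  swap-⊗ = solve 3 (λ p q r → p :* (q :* r) := q :* (p :* r)) ∼-refl

  annihilate : ∀ {p} q → p ∼ 𝟘 → q ⊗ p ∼ 𝟘
  annihilate q eq = ∼-trans (⊗-congˡ eq) (⊗-zeroʳ q)

  annihilateˡ : ∀ {p q} → p ∼ 𝟘 → p ⊗ q ∼ 𝟘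
  annihilateˡ eq = ∼-trans (⊗-cong eq ∼-refl) (⊗-zeroˡ _)

  ⊕-vanish : ∀ {p q} → p ∼ 𝟘 → q ∼ 𝟘 → p ⊕ q ∼ 𝟘
  ⊕-vanish eq eq′ = ∼-trans (⊕-cong eq eq′) (⊕-zeroˡ 𝟘)

  prodX-++ : ∀ us vs → prodX (us ++ vs) ∼ prodX us ⊗ prodX vs
  prodX-++ [] vs = ∼-sym (⊗-oneˡ _)
  prodX-++ (u ∷ us) vs = ∼-trans (⊗-congˡ (prodX-++ us vs)) (∼-sym (⊗-assoc _ _ _))

  -- Every element of `us` uses up one occurrence in `vs`; since `us` has no duplicates, the rest of
  -- `us` is still found in what remains.
  prodX-divides : ∀ {us} vs → Unique us → (∀ {u} → u LMem.∈ us → u LMem.∈ vs) →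
                  ∃[ ws ] (prodX vs ∼ prodX us ⊗ prodX ws)
  prodX-divides {[]} vs _ _ = vs , ∼-sym (⊗-oneˡ _)
  prodX-divides {u ∷ us} vs (u∉us ∷ unique) us⊆vs with LMem.∈-∃++ (us⊆vs (here refl))
  ... | ys , zs , refl = extend (prodX-divides (ys ++ zs) unique us⊆rest)
    where
    us⊆rest : ∀ {v} → v LMem.∈ us → v LMem.∈ ys ++ zs
    us⊆rest {v} v∈us with LMem.∈-++⁻ ys (us⊆vs (there v∈us))
    ... | inj₁ v∈ys = LMem.∈-++⁺ˡ v∈ys
    ... | inj₂ (here refl) = ⊥-elim (LAll.lookup u∉us v∈us refl)
    ... | inj₂ (there v∈zs) = LMem.∈-++⁺ʳ ys v∈zs
    extend : ∃[ ws ] (prodX (ys ++ zs) ∼ prodX us ⊗ prodX ws) →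
             ∃[ ws ] (prodX (ys ++ u ∷ zs) ∼ X u ⊗ prodX us ⊗ prodX ws)
    extend (ws , eq) = ws , (begin
      prodX (ys ++ u ∷ zs)          ≈⟨ prodX-++ ys (u ∷ zs) ⟩
      prodX ys ⊗ (X u ⊗ prodX zs)   ≈⟨ swap-⊗ _ _ _ ⟩
      X u ⊗ (prodX ys ⊗ prodX zs)   ≈⟨ ⊗-congˡ (prodX-++ ys zs) ⟨
      X u ⊗ prodX (ys ++ zs)        ≈⟨ ⊗-congˡ eq ⟩
      X u ⊗ (prodX us ⊗ prodX ws)   ≈⟨ ⊗-assoc _ _ _ ⟨
      X u ⊗ prodX us ⊗ prodX ws     ∎)
      where open import Relation.Binary.Reasoning.Setoid setoid

  prodX-vanish : ∀ {us} vs → Unique us → (∀ {u} → u LMem.∈ us → u LMem.∈ vs) →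
                 prodX us ∼ 𝟘 → prodX vs ∼ 𝟘
  prodX-vanish vs unique us⊆vs eq with prodX-divides vs unique us⊆vs
  ... | ws , eq′ = ∼-trans eq′ (annihilateˡ eq)

  sumOf-cong : ∀ {t t′} → (∀ g → t g ∼ t′ g) → ∀ gs → sumOf t gs ∼ sumOf t′ gs
  sumOf-cong eq [] = ∼-refl
  sumOf-cong eq (g ∷ gs) = ⊕-cong (eq g) (sumOf-cong eq gs)

  sumOf-⊕ : ∀ t t′ gs → sumOf (λ g → t g ⊕ t′ g) gs ∼ sumOf t gs ⊕ sumOf t′ gs
  sumOf-⊕ t t′ [] = ∼-sym (⊕-zeroˡ 𝟘)
  sumOf-⊕ t t′ (g ∷ gs) = ∼-trans (⊕-congˡ (sumOf-⊕ t t′ gs))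
    (solve 4 (λ a b c d → (a :+ b) :+ (c :+ d) := (a :+ c) :+ (b :+ d)) ∼-refl _ _ _ _)

  sumOf-⊗ : ∀ p t gs → p ⊗ sumOf t gs ∼ sumOf (λ g → p ⊗ t g) gs
  sumOf-⊗ p t [] = ⊗-zeroʳ p
  sumOf-⊗ p t (g ∷ gs) = ∼-trans (⊗-distribˡ p _ _) (⊕-congˡ (sumOf-⊗ p t gs))

  sumOf-vanish : ∀ {t} → (∀ g → t g ∼ 𝟘) → ∀ gs → sumOf t gs ∼ 𝟘
  sumOf-vanish eq [] = ∼-refl
  sumOf-vanish eq (g ∷ gs) = ⊕-vanish (eq g) (sumOf-vanish eq gs)

module _ {n : ℕ} {Z Z′ : Expr n → Set} where
  private
    module Q = Quotient Z
    module Q′ = Quotient Z′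
  open Q using (_∼_)
  open Q′ hiding (_∼_)
  open Q′ using () renaming (_∼_ to _∼′_)

  -- The weight w makes this cover the Gysin-type map p ↦ w ⊗ p as well as honest ring homomorphisms (w = 1).
  bind-transfer : ∀ σ w → (∀ {p} → Z p → w ⊗ bind σ p ∼′ 𝟘) →
                  ∀ {p q} → p ∼ q → w ⊗ bind σ p ∼′ w ⊗ bind σ q
  bind-transfer σ w kill = go
    where
    go : ∀ {p q} → p ∼ q → w ⊗ bind σ p ∼′ w ⊗ bind σ q
    go Q.∼-refl = ∼-refl
    go (Q.∼-sym eq) = ∼-sym (go eq)
    go (Q.∼-trans eq eq′) = ∼-trans (go eq) (go eq′)
    go (Q.⊕-cong eq eq′) = ∼-trans (⊗-distribˡ w _ _) (∼-trans (⊕-cong (go eq) (go eq′)) (∼-sym (⊗-distribˡ w _ _)))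
    go (Q.⊗-cong {p} {p′} {q} {q′} eq eq′) = begin
      w ⊗ (bind σ p ⊗ bind σ q)     ≈⟨ ⊗-assoc _ _ _ ⟨
      w ⊗ bind σ p ⊗ bind σ q       ≈⟨ ⊗-cong (go eq) ∼-refl ⟩
      w ⊗ bind σ p′ ⊗ bind σ q      ≈⟨ solve 3 (λ a b c → (a :* b) :* c := b :* (a :* c)) ∼-refl w _ _ ⟩
      bind σ p′ ⊗ (w ⊗ bind σ q)    ≈⟨ ⊗-congˡ (go eq′) ⟩
      bind σ p′ ⊗ (w ⊗ bind σ q′)   ≈⟨ swap-⊗ _ _ _ ⟩
      w ⊗ (bind σ p′ ⊗ bind σ q′)   ∎
      where open import Relation.Binary.Reasoning.Setoid setoid
    go (Q.⊕-assoc p q r) = ⊗-congˡ (⊕-assoc _ _ _)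
    go (Q.⊕-comm p q) = ⊗-congˡ (⊕-comm _ _)
    go (Q.⊕-zeroˡ p) = ⊗-congˡ (⊕-zeroˡ _)
    go (Q.⊗-assoc p q r) = ⊗-congˡ (⊗-assoc _ _ _)
    go (Q.⊗-comm p q) = ⊗-congˡ (⊗-comm _ _)
    go (Q.⊗-oneˡ p) = ⊗-congˡ (⊗-oneˡ _)
    go (Q.⊗-zeroˡ p) = ⊗-congˡ (⊗-zeroˡ _)
    go (Q.⊗-distrib p q r) = ⊗-congˡ (⊗-distrib _ _ _)
    go (Q.con-+ a b) = ⊗-congˡ (con-+ a b)
    go (Q.con-* a b) = ⊗-congˡ (con-* a b)
    go (Q.vanish z) = ∼-trans (kill z) (∼-sym (⊗-zeroʳ w))

  bind-sound : ∀ σ → (∀ {p} → Z p → bind σ p ∼′ 𝟘) → ∀ {p q} → p ∼ q → bind σ p ∼′ bind σ q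
  bind-sound σ kill eq = ∼-trans (∼-sym (⊗-oneˡ _))
    (∼-trans (bind-transfer σ 𝟙 (λ z → ∼-trans (⊗-oneˡ _) (kill z)) eq) (⊗-oneˡ _))

  multiply-sound : ∀ w → (∀ {p} → Z p → w ⊗ p ∼′ 𝟘) → ∀ {p q} → p ∼ q → w ⊗ p ∼′ w ⊗ q
  multiply-sound w kill {p} {q} eq = ≡.subst₂ (λ p q → w ⊗ p ∼′ w ⊗ q) (bind-X p) (bind-X q)
    (bind-transfer X w (λ {p} z → subst (λ p → w ⊗ p ∼′ 𝟘) (sym (bind-X p)) (kill z)) eq)

  coarsen : (∀ {p} → Z p → p ∼′ 𝟘) → ∀ {p q} → p ∼ q → p ∼′ q
  coarsen kill {p} {q} eq = ≡.subst₂ _∼′_ (bind-X p) (bind-X q)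
    (bind-sound X (λ {p} z → subst (_∼′ 𝟘) (sym (bind-X p)) (kill z)) eq)

-- Presented rings acting on ℤ-modules

actOn : ∀ {n} {C : Set} (_+_ : C → C → C) (_*_ : ℤ → C → C) (op : Fin n → C → C) → Expr n → C → C
actOn _+_ _*_ op (con c) v = c * v
actOn _+_ _*_ op (X g) v = op g v
actOn _+_ _*_ op (p ⊕ q) v = actOn _+_ _*_ op p v + actOn _+_ _*_ op q v
actOn _+_ _*_ op (p ⊗ q) v = actOn _+_ _*_ op p (actOn _+_ _*_ op q v)

-- Commuting linear operators make M a module over the polynomial ring, and over a quotient ring as
-- soon as the relators act as zero. Acting on a fixed vector then gives a homomorphism out of the
-- quotient into a group that carries no multiplication of its own.
record Operators (n : ℕ) (M : ℤ-Module) : Set where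
  open LeftModule M
  field
    op      : Fin n → Carrierᴹ → Carrierᴹ
    op-cong : ∀ g {u v} → u ≈ᴹ v → op g u ≈ᴹ op g v
    op-+    : ∀ g u v → op g (u +ᴹ v) ≈ᴹ op g u +ᴹ op g v
    op-*    : ∀ g c v → op g (c *ₗ v) ≈ᴹ c *ₗ op g v
    op-comm : ∀ g h v → op g (op h v) ≈ᴹ op h (op g v)

  act : Expr n → Carrierᴹ → Carrierᴹ
  act = actOn _+ᴹ_ _*ₗ_ op

  private
    interchange : ∀ a b c d → (a +ᴹ b) +ᴹ (c +ᴹ d) ≈ᴹ (a +ᴹ c) +ᴹ (b +ᴹ d)
    interchange = solve 4 (λ a b c d → (a ⊞ b) ⊞ (c ⊞ d) ⊜ (a ⊞ c) ⊞ (b ⊞ d)) ≈ᴹ-refl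
      where open import Algebra.Solver.CommutativeMonoid +ᴹ-commutativeMonoid using (solve; _⊜_) renaming (_⊕_ to _⊞_)

    *ₗ-comm : ∀ a b v → a *ₗ (b *ₗ v) ≈ᴹ b *ₗ (a *ₗ v)
    *ₗ-comm a b v = ≈ᴹ-trans (≈ᴹ-sym (*ₗ-assoc a b v)) (≈ᴹ-trans (*ₗ-cong (ℤ.*-comm a b) ≈ᴹ-refl) (*ₗ-assoc b a v))

  act-cong : ∀ p {u v} → u ≈ᴹ v → act p u ≈ᴹ act p v
  act-cong (con c) eq = *ₗ-cong refl eq
  act-cong (X g) eq = op-cong g eq
  act-cong (p ⊕ q) eq = +ᴹ-cong (act-cong p eq) (act-cong q eq)
  act-cong (p ⊗ q) eq = act-cong p (act-cong q eq)

  act-+ : ∀ p u v → act p (u +ᴹ v) ≈ᴹ act p u +ᴹ act p v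
  act-+ (con c) u v = *ₗ-distribˡ c u v
  act-+ (X g) u v = op-+ g u v
  act-+ (p ⊕ q) u v = ≈ᴹ-trans (+ᴹ-cong (act-+ p u v) (act-+ q u v)) (interchange _ _ _ _)
  act-+ (p ⊗ q) u v = ≈ᴹ-trans (act-cong p (act-+ q u v)) (act-+ p _ _)

  act-* : ∀ p c v → act p (c *ₗ v) ≈ᴹ c *ₗ act p v
  act-* (con a) c v = *ₗ-comm a c v
  act-* (X g) c v = op-* g c v
  act-* (p ⊕ q) c v = ≈ᴹ-trans (+ᴹ-cong (act-* p c v) (act-* q c v)) (≈ᴹ-sym (*ₗ-distribˡ c _ _))
  act-* (p ⊗ q) c v = ≈ᴹ-trans (act-cong p (act-* q c v)) (act-* p c _)

  op-act : ∀ g p v → op g (act p v) ≈ᴹ act p (op g v)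
  op-act g (con c) v = op-* g c v
  op-act g (X h) v = op-comm g h v
  op-act g (p ⊕ q) v = ≈ᴹ-trans (op-+ g _ _) (+ᴹ-cong (op-act g p v) (op-act g q v))
  op-act g (p ⊗ q) v = ≈ᴹ-trans (op-act g p _) (act-cong p (op-act g q v))

  act-comm : ∀ p q v → act p (act q v) ≈ᴹ act q (act p v)
  act-comm (con c) q v = ≈ᴹ-sym (act-* q c v)
  act-comm (X g) q v = op-act g q v
  act-comm (p ⊕ p′) q v = ≈ᴹ-trans (+ᴹ-cong (act-comm p q v) (act-comm p′ q v)) (≈ᴹ-sym (act-+ q _ _))
  act-comm (p ⊗ p′) q v = ≈ᴹ-trans (act-cong p (act-comm p′ q v)) (act-comm p q _)

  module _ {Z : Expr n → Set} (kill : ∀ {p} → Z p → ∀ v → act p v ≈ᴹ 0ᴹ) where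
    private module Q = Quotient Z
    open Q using (_∼_)

    act-sound : ∀ {p q} → p ∼ q → ∀ v → act p v ≈ᴹ act q v
    act-sound Q.∼-refl v = ≈ᴹ-refl
    act-sound (Q.∼-sym eq) v = ≈ᴹ-sym (act-sound eq v)
    act-sound (Q.∼-trans eq eq′) v = ≈ᴹ-trans (act-sound eq v) (act-sound eq′ v)
    act-sound (Q.⊕-cong eq eq′) v = +ᴹ-cong (act-sound eq v) (act-sound eq′ v)
    act-sound (Q.⊗-cong {p} {p′} eq eq′) v = ≈ᴹ-trans (act-cong p (act-sound eq′ v)) (act-sound eq _)
    act-sound (Q.⊕-assoc p q r) v = +ᴹ-assoc _ _ _
    act-sound (Q.⊕-comm p q) v = +ᴹ-comm _ _
    act-sound (Q.⊕-zeroˡ p) v = ≈ᴹ-trans (+ᴹ-congʳ (*ₗ-zeroˡ v)) (+ᴹ-identityˡ _)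
    act-sound (Q.⊗-assoc p q r) v = ≈ᴹ-refl
    act-sound (Q.⊗-comm p q) v = act-comm p q v
    act-sound (Q.⊗-oneˡ p) v = *ₗ-identityˡ _
    act-sound (Q.⊗-zeroˡ p) v = ≈ᴹ-trans (*ₗ-zeroˡ _) (≈ᴹ-sym (*ₗ-zeroˡ v))
    act-sound (Q.⊗-distrib p q r) v = ≈ᴹ-refl
    act-sound (Q.con-+ a b) v = *ₗ-distribʳ v a b
    act-sound (Q.con-* a b) v = *ₗ-assoc a b v
    act-sound (Q.vanish z) v = ≈ᴹ-trans (kill z v) (≈ᴹ-sym (*ₗ-zeroˡ v))

  act-prodX-vanish : ∀ {us} vs → Unique us → (∀ {u} → u LMem.∈ us → u LMem.∈ vs) →
                     (∀ v → act (prodX us) v ≈ᴹ 0ᴹ) → ∀ v → act (prodX vs) v ≈ᴹ 0ᴹ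
  -- Over the empty set of relators the factorisation is an identity of polynomials, hence valid for
  -- any commuting operators.
  act-prodX-vanish vs unique us⊆vs kill v with Quotient.prodX-divides (λ _ → ⊥) vs unique us⊆vs
  ... | ws , eq = ≈ᴹ-trans (act-sound (λ ()) eq v) (kill _)

-- Lattices, building sets and the Stanley–Reisner presentation

module _ {n : ℕ} where

  elems : Subset n → List (Fin n)
  elems H = filter (λ g → lookup H g Bool.≟ true) (allFin n)

  ∈-elems⁺ : ∀ {H g} → g ∈ H → g LMem.∈ elems H
  ∈-elems⁺ {H} {g} g∈H = LMem.∈-filter⁺ _ (LMem.∈-allFin g) (Vec.[]=⇒lookup g∈H)

  ∈-elems⁻ : ∀ {H g} → g LMem.∈ elems H → g ∈ H
  ∈-elems⁻ {H} {g} g∈ = Vec.lookup⇒[]= g H (LMem.∈-filter⁻ _ {xs = allFin n} g∈ .proj₂)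

  elems-unique : ∀ H → Unique (elems H)
  elems-unique H = Unique.filter⁺ _ (Unique.allFin⁺ n)

  support : List (Fin n) → Subset n
  support gs = tabulate (λ g → does (memberOf Fin._≟_ g gs))

  ∈-support⁺ : ∀ {gs g} → g LMem.∈ gs → g ∈ support gs
  ∈-support⁺ {gs} {g} g∈ = Vec.lookup⇒[]= g _ (trans (Vec.lookup∘tabulate _ g) (dec-true (memberOf Fin._≟_ g gs) g∈))

  ∈-support⁻ : ∀ {gs g} → g ∈ support gs → g LMem.∈ gs
  ∈-support⁻ {gs} {g} g∈ with memberOf Fin._≟_ g gs | trans (sym (Vec.lookup∘tabulate (λ g → does (memberOf Fin._≟_ g gs)) g)) (Vec.[]=⇒lookup g∈)
  ... | yes p | _ = p
  ... | no _ | ()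

  lookup-∈ : ∀ {G : Subset n} {g} → g ∈ G → lookup G g ≡ true
  lookup-∈ = Vec.[]=⇒lookup

  lookup-∉ : ∀ {G : Subset n} {g} → g ∉ G → lookup G g ≡ false
  lookup-∉ {G} {g} g∉G with lookup G g in eq
  ... | false = refl
  ... | true = ⊥-elim (g∉G (Vec.lookup⇒[]= g G eq))

  ∈-─⁻ : ∀ {p q : Subset n} {x} → x ∈ p ─ q → x ∈ p × x ∉ q
  ∈-─⁻ {p} {q} {x} x∈ = Sub.p─q⊆p p q x∈ , λ x∈q → case trans (sym (Vec.[]=⇒lookup x∈)) (lookup-─ p q x (Vec.[]=⇒lookup x∈q)) of λ ()
    where
    lookup-─ : ∀ {m} (p q : Subset m) x → lookup q x ≡ true → lookup (p ─ q) x ≡ false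
    lookup-─ (_ Vec.∷ p) (true Vec.∷ q) zero eq = refl
    lookup-─ (_ Vec.∷ p) (true Vec.∷ q) (suc x) eq = lookup-─ p q x eq
    lookup-─ (_ Vec.∷ p) (false Vec.∷ q) (suc x) eq = lookup-─ p q x eq

module Lattice (L : FinLattice) where
  open FinLattice L public renaming (_∧ₗ_ to _⊓_; _∨_ to _⊔_; ⊥ to 0̂; ⊥-min to 0̂-min)
  open IsLattice isLattice public
    using (x≤x∨y; y≤x∨y; ∨-least; x∧y≤x; x∧y≤y; ∧-greatest; antisym)
    renaming (refl to ≤-refl; trans to ≤-trans; reflexive to ≤-reflexive)

  infix 4 _⊏_
  _⊏_ : Fin n → Fin n → Set
  _⊏_ = _<_ L

  _⊏?_ : ∀ x y → Dec (x ⊏ y)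
  x ⊏? y = (x ≤? y) ×-dec ¬? (x Fin.≟ y)

  ⊏-≤-trans : ∀ {x y z} → x ⊏ y → y ≤ z → x ⊏ z
  ⊏-≤-trans (x≤y , x≢y) y≤z = ≤-trans x≤y y≤z , λ { refl → x≢y (antisym x≤y y≤z) }

  ≱⇒⊏⊔ : ∀ {x y} → ¬ (y ≤ x) → x ⊏ (x ⊔ y)
  ≱⇒⊏⊔ {x} {y} y≰x = x≤x∨y x y , λ eq → y≰x (≤-trans (y≤x∨y x y) (≤-reflexive (sym eq)))

  -- The half B ≤ ⋁ P of being a join. In circuits the other half is carried by the strict
  -- inequalities.
  Covers : (Fin n → Set) → Fin n → Set
  Covers P B = ∀ z → (∀ y → P y → y ≤ z) → B ≤ z

  covers-mono : ∀ {P Q B} → (∀ {y} → P y → ∃[ z ] y ≤ z × Q z) → Covers P B → Covers Q B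
  covers-mono P⇒Q cov z ub = cov z λ y Py → let w , y≤w , Qw = P⇒Q Py in ≤-trans y≤w (ub w Qw)

  covers-⊆ : ∀ {P Q B} → (∀ {y} → P y → Q y) → Covers P B → Covers Q B
  covers-⊆ P⇒Q = covers-mono λ {y} Py → y , ≤-refl , P⇒Q Py

  -- A circuit with join B: the factors hs still to be processed, those already processed, and the fixed nested set J.
  Circuit : List (Fin n) → List (Fin n) → Subset n → Fin n → Set
  Circuit hs ks J B = Covers (λ y → y LMem.∈ hs ⊎ y LMem.∈ ks ⊎ (y ∈ J × y ⊏ B)) B

  circuit-start : ∀ {H J B} → Covers (λ y → y ∈ H ⊎ (y ∈ J × y ⊏ B)) B → Circuit (elems H) [] J B
  circuit-start = covers-⊆ λ { (inj₁ y∈H) → inj₁ (∈-elems⁺ y∈H) ; (inj₂ i) → inj₂ (inj₂ i) }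

  circuit-move : ∀ {h hs ks J B} → Circuit (h ∷ hs) ks J B → Circuit hs (h ∷ ks) J B
  circuit-move = covers-⊆ λ { (inj₁ (here refl)) → inj₂ (inj₁ (here refl))
                            ; (inj₁ (there y∈)) → inj₁ y∈
                            ; (inj₂ (inj₁ y∈)) → inj₂ (inj₁ (there y∈))
                            ; (inj₂ (inj₂ i)) → inj₂ (inj₂ i) }

  module Climb (P : Fin n → Set) (P? : ∀ x → Dec (P x)) where
    climb : List (Fin n) → Fin n → Fin n
    climb [] m = m
    climb (x ∷ xs) m with P? x ×-dec (m ≤? x)
    ... | yes _ = climb xs x
    ... | no _ = climb xs m

    climb-≥ : ∀ xs m → m ≤ climb xs m
    climb-≥ [] m = ≤-refl
    climb-≥ (x ∷ xs) m with P? x ×-dec (m ≤? x)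
    ... | yes (_ , m≤x) = ≤-trans m≤x (climb-≥ xs x)
    ... | no _ = climb-≥ xs m

    climb-P : ∀ xs m → P m → P (climb xs m)
    climb-P [] m Pm = Pm
    climb-P (x ∷ xs) m Pm with P? x ×-dec (m ≤? x)
    ... | yes (Px , _) = climb-P xs x Px
    ... | no _ = climb-P xs m Pm

    -- An element y of P above the final value was already above the current value when the pass met
    -- it. The pass therefore moved to y and ended at or above it.
    climb-max : ∀ xs m {y} → y LMem.∈ xs → P y → climb xs m ≤ y → climb xs m ≡ y
    climb-max (x ∷ xs) m y∈ Py le with P? x ×-dec (m ≤? x)
    climb-max (x ∷ xs) m (here refl) Py le | yes _ = antisym le (climb-≥ xs x)
    climb-max (x ∷ xs) m (here refl) Py le | no ¬P = ⊥-elim (¬P (Py , ≤-trans (climb-≥ xs m) le))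
    climb-max (x ∷ xs) m (there y∈) Py le | yes _ = climb-max xs x y∈ Py le
    climb-max (x ∷ xs) m (there y∈) Py le | no _ = climb-max xs m y∈ Py le

  maximal-above : ∀ G {p g} → g ∈ G → g ≤ p → ∃[ f ] MaxBelow L G p f × g ≤ f
  maximal-above G {p} {g} g∈G g≤p =
    climb (allFin n) g ,
    (climb-P (allFin n) g (g∈G , g≤p) .proj₁ , climb-P (allFin n) g (g∈G , g≤p) .proj₂ ,
     λ h h∈G h≤p le → sym (climb-max (allFin n) g (LMem.∈-allFin h) (h∈G , h≤p) le)) ,
    climb-≥ (allFin n) g
    where open Climb (λ x → x ∈ G × x ≤ p) (λ x → (x Sub.∈? G) ×-dec (x ≤? p))

  module Building (G : Subset n) (building : IsBuildingSet L G) where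
    0̂∉G : 0̂ ∉ G
    0̂∉G = building .proj₁

    module Iso {p} (p≢0̂ : p ≢ 0̂) = BuildingIso (building .proj₂ p p≢0̂)

    ∈G⇒≢0̂ : ∀ {g} → g ∈ G → g ≢ 0̂
    ∈G⇒≢0̂ g∈G refl = 0̂∉G g∈G

    φ-off : ∀ {p} (p≢0̂ : p ≢ 0̂) {x f h} → MaxBelow L G p f → x ≤ f → h ≢ f → Iso.φ p≢0̂ x h ≡ 0̂
    φ-off p≢0̂ {x} {f} {h} mb@(_ , f≤p , _) x≤f h≢f = antisym
      (≤-trans (φ-mono x f (≤-trans x≤f f≤p) f≤p x≤f h) (≤-reflexive (φ-gen f mb h .proj₂ h≢f)))
      (0̂-min _)
      where open Iso p≢0̂

    -- Below f only the coordinate f can differ from 0̂, and below f′ only the coordinate f′. A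
    -- common lower bound of distinct factors thus has all coordinates 0̂.
    factor-unique : ∀ {p a f f′} → a ≢ 0̂ → a ≤ f → a ≤ f′ → MaxBelow L G p f → MaxBelow L G p f′ → f ≡ f′
    factor-unique {p} {a} {f} {f′} a≢0̂ a≤f a≤f′ mb mb′ with f Fin.≟ f′
    ... | yes eq = eq
    ... | no f≢f′ = ⊥-elim (a≢0̂ (antisym (φ-refl a 0̂ a≤p (0̂-min p) below) (0̂-min a)))
      where
      a≤p : a ≤ p
      a≤p = ≤-trans a≤f (mb .proj₂ .proj₁)
      p≢0̂ : p ≢ 0̂
      p≢0̂ refl = a≢0̂ (antisym a≤p (0̂-min a))
      open Iso p≢0̂
      below : ∀ h → φ a h ≤ φ 0̂ h
      below h with h Fin.≟ f
      ... | yes refl = ≤-trans (≤-reflexive (φ-off p≢0̂ mb′ a≤f′ f≢f′)) (0̂-min _)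
      ... | no h≢f = ≤-trans (≤-reflexive (φ-off p≢0̂ mb a≤f h≢f)) (0̂-min _)

    -- The factors of g ∨ h above g and above h have the nonzero lower bound a in common, so they
    -- coincide. This single factor bounds g ∨ h from above and hence equals it.
    join-closed : ∀ {a g h} → a ≢ 0̂ → a ≤ g → a ≤ h → g ∈ G → h ∈ G → (g ⊔ h) ∈ G
    join-closed {a} {g} {h} a≢0̂ a≤g a≤h g∈G h∈G
      with maximal-above G g∈G (x≤x∨y g h) | maximal-above G h∈G (y≤x∨y g h)
    ... | f , mb@(f∈G , f≤ , _) , g≤f | f′ , mb′ , h≤f′
      with factor-unique a≢0̂ (≤-trans a≤g g≤f) (≤-trans a≤h h≤f′) mb mb′
    ... | refl = subst (_∈ G) (antisym f≤ (∨-least g≤f h≤f′)) f∈G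

    -- An atom outside G would have no factor, and [0̂,a] would be an empty product, that is, a
    -- single point.
    atom∈G : ∀ {a} → IsAtom L a → a ∈ G
    atom∈G {a} ((_ , 0̂≢a) , cover) with a Sub.∈? G
    ... | yes a∈G = a∈G
    ... | no a∉G = ⊥-elim (a≢0̂ (antisym (φ-refl a 0̂ ≤-refl (0̂-min a) below) (0̂-min a)))
      where
      a≢0̂ : a ≢ 0̂
      a≢0̂ = 0̂≢a ∘ sym
      open Iso a≢0̂
      no-factor : ∀ g → ¬ MaxBelow L G a g
      no-factor g (g∈G , g≤a , _) with cover g (0̂-min g) g≤a
      ... | inj₁ refl = 0̂∉G g∈G
      ... | inj₂ refl = a∉G g∈G
      below : ∀ h → φ a h ≤ φ 0̂ h
      below h = ≤-trans (≤-reflexive (φ-into a ≤-refl h .proj₂ (no-factor h))) (0̂-min _)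

    -- Given an upper bound z of the elements of P below f, let w be p with its f-coordinate
    -- replaced by that of z ∧ f. Then w still bounds all of P, so p ≤ w, and comparing
    -- f-coordinates yields f ≤ z.
    covers-factor : ∀ {P p f} → p ≢ 0̂ → MaxBelow L G p f → (∀ {y} → P y → ∃[ f′ ] MaxBelow L G p f′ × y ≤ f′) →
                    Covers P p → Covers (λ y → P y × y ≤ f) f
    covers-factor {P} {p} {f} p≢0̂ mb@(_ , f≤p , _) factor cov z ub = ≤-trans f≤z⊓f (x∧y≤x z f)
      where
      open Iso p≢0̂
      z⊓f≤p : (z ⊓ f) ≤ p
      z⊓f≤p = ≤-trans (x∧y≤y z f) f≤p
      t : Fin n → Fin n
      t h with h Fin.≟ f
      ... | yes _ = φ (z ⊓ f) h
      ... | no _ = φ p h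
      t-elem : ProdElem L G p t
      t-elem h with h Fin.≟ f
      ... | yes _ = φ-into (z ⊓ f) z⊓f≤p h
      ... | no _ = φ-into p ≤-refl h
      w : Fin n
      w = ψ t
      w≤p : w ≤ p
      w≤p = ψ-into t t-elem
      P⇒≤w : ∀ y → P y → y ≤ w
      P⇒≤w y Py with factor Py
      ... | f′ , mb′@(_ , f′≤p , _) , y≤f′ = φ-refl y w (≤-trans y≤f′ f′≤p) w≤p
              λ h → ≤-trans (coordinate h) (≤-reflexive (sym (φψ t t-elem h)))
        where
        coordinate : ∀ h → φ y h ≤ t h
        coordinate h with h Fin.≟ f
        ... | no _ = φ-mono y p (≤-trans y≤f′ f′≤p) ≤-refl (≤-trans y≤f′ f′≤p) h
        ... | yes refl with f Fin.≟ f′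
        ...   | no f≢f′ = ≤-trans (≤-reflexive (φ-off p≢0̂ mb′ y≤f′ f≢f′)) (0̂-min _)
        ...   | yes refl = φ-mono y (z ⊓ f) (≤-trans y≤f′ f′≤p) z⊓f≤p (∧-greatest (ub y (Py , y≤f′)) y≤f′) h
      p≤w : p ≤ w
      p≤w = cov w P⇒≤w
      f≤z⊓f : f ≤ (z ⊓ f)
      f≤z⊓f = φ-refl f (z ⊓ f) f≤p z⊓f≤p coordinate
        where
        coordinate : ∀ h → φ f h ≤ φ (z ⊓ f) h
        coordinate h with h Fin.≟ f
        ... | no h≢f = ≤-trans (≤-reflexive (φ-off p≢0̂ mb ≤-refl h≢f)) (0̂-min _)
        ... | yes refl = ≤-trans (φ-mono f w f≤p w≤p (≤-trans f≤p p≤w) f) (≤-reflexive (trans (φψ t t-elem f) t-f))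
          where
          t-f : t f ≡ φ (z ⊓ f) f
          t-f with f Fin.≟ f
          ... | yes _ = refl
          ... | no f≢f = ⊥-elim (f≢f refl)

  above : Subset n → Fin n → Fin n → Expr n
  above G B C = if lookup G C ∧ does (B ≤? C) then X C else 𝟘

  above-in : ∀ {G B C} → C ∈ G → B ≤ C → above G B C ≡ X C
  above-in {G} {B} {C} C∈G B≤C rewrite lookup-∈ C∈G | dec-true (B ≤? C) B≤C = refl

  above-∉ : ∀ {G B C} → C ∉ G → above G B C ≡ 𝟘
  above-∉ {G} {B} {C} C∉G rewrite lookup-∉ C∉G = refl

  above-≰ : ∀ {G B C} → ¬ (B ≤ C) → above G B C ≡ 𝟘
  above-≰ {G} {B} {C} B≰C rewrite dec-false (B ≤? C) B≰C with lookup G C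
  ... | true = refl
  ... | false = refl

  sumUp : Subset n → Fin n → Expr n
  sumUp G B = sumOf (above G B) (allFin n)

  -- Stanley–Reisner presentation of D(L,G,I): non-faces of the star of I, and one linear form for each atom.
  data Relator (G I : Subset n) : Expr n → Set where
    outside : ∀ {g} → g ∉ G → Relator G I (X g)
    linear  : ∀ {a} → IsAtom L a → Relator G I (sumUp G a)
    circuit : ∀ H {B} → H ⊆ G → B ∈ G → (∀ h → h ∈ H → h ⊏ B) →
              Covers (λ y → y ∈ H ⊎ (y ∈ I × y ⊏ B)) B → Relator G I (prodX (elems H))

  module D (G I : Subset n) where
    open Quotient (Relator G I) public

    -- Passing to the support forgets repetitions, and the squarefree product over the support
    -- divides `prodX hs`.
    circuit-list : ∀ hs {B} → (∀ {h} → h LMem.∈ hs → h ∈ G) → B ∈ G → (∀ {h} → h LMem.∈ hs → h ⊏ B) →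
                   Covers (λ y → y LMem.∈ hs ⊎ (y ∈ I × y ⊏ B)) B → prodX hs ∼ 𝟘
    circuit-list hs {B} hs⊆G B∈G hs⊏B cov = prodX-vanish hs (elems-unique (support hs)) (∈-support⁻ ∘ ∈-elems⁻ {H = support hs})
      (vanish (circuit (support hs) (hs⊆G ∘ ∈-support⁻) B∈G (λ h → hs⊏B ∘ ∈-support⁻)
        (covers-⊆ (λ { (inj₁ y∈) → inj₁ (∈-support⁺ y∈) ; (inj₂ i) → inj₂ i }) cov)))

    pow : Expr n → ℕ → Expr n
    pow p zero = 𝟙
    pow p (suc k) = p ⊗ pow p k

    module _ (building : IsBuildingSet L G) where
      open Building G building

      -- The common lower bound a puts g ∨ h into G, and incomparability places g and h strictly
      -- below it: they form a circuit.
      incomparable-product : ∀ {a g h} → a ≢ 0̂ → a ≤ g → a ≤ h → g ∈ G → h ∈ G → ¬ (g ≤ h) → ¬ (h ≤ g) → X g ⊗ X h ∼ 𝟘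
      incomparable-product {a} {g} {h} a≢0̂ a≤g a≤h g∈G h∈G g≰h h≰g =
        ∼-trans (⊗-congˡ (∼-sym (⊗-oneʳ _)))
          (circuit-list (g ∷ h ∷ []) (λ { (here refl) → g∈G ; (there (here refl)) → h∈G })
            (join-closed a≢0̂ a≤g a≤h g∈G h∈G)
            (λ { (here refl) → ≱⇒⊏⊔ h≰g
               ; (there (here refl)) → y≤x∨y g h , λ eq → g≰h (≤-trans (x≤x∨y g h) (≤-reflexive (sym eq))) })
            (λ z ub → ∨-least (ub g (inj₁ (here refl))) (ub h (inj₁ (there (here refl))))))

      -- The two sums differ by the x_g with g ≥ B and g ≱ C. Such a g is not below C either, since
      -- B ≰ C, and it shares the lower bound a with C, so x_C x_g = 0.
      absorb : ∀ {a B C} → a ≢ 0̂ → a ≤ B → a ≤ C → B ∈ G → C ∈ G → ¬ (B ≤ C) → X C ⊗ sumUp G B ∼ X C ⊗ sumUp G (B ⊔ C)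
      absorb {a} {B} {C} a≢0̂ a≤B a≤C B∈G C∈G B≰C =
        ∼-trans (sumOf-⊗ _ _ (allFin n)) (∼-trans (sumOf-cong termwise (allFin n)) (∼-sym (sumOf-⊗ _ _ (allFin n))))
        where
        termwise : ∀ g → X C ⊗ above G B g ∼ X C ⊗ above G (B ⊔ C) g
        termwise g = by-cases (g Sub.∈? G) (B ≤? g) (C ≤? g)
          where
          by-cases : Dec (g ∈ G) → Dec (B ≤ g) → Dec (C ≤ g) → X C ⊗ above G B g ∼ X C ⊗ above G (B ⊔ C) g
          by-cases (no g∉G) _ _ = ⊗-congˡ (reflexive (trans (above-∉ g∉G) (sym (above-∉ g∉G))))
          by-cases (yes g∈G) (no B≰g) _ = ⊗-congˡ (reflexive (trans (above-≰ {G} B≰g)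
                                       (sym (above-≰ {G} (λ le → B≰g (≤-trans (x≤x∨y B C) le))))))
          by-cases (yes g∈G) (yes B≤g) (yes C≤g) = ⊗-congˡ (reflexive (trans (above-in g∈G B≤g)
                                       (sym (above-in g∈G (∨-least B≤g C≤g)))))
          by-cases (yes g∈G) (yes B≤g) (no C≰g) = ∼-trans (⊗-congˡ (reflexive (above-in g∈G B≤g)))
                (∼-trans (incomparable-product a≢0̂ a≤C (≤-trans a≤B B≤g) C∈G g∈G C≰g (λ g≤C → B≰C (≤-trans B≤g g≤C)))
                  (∼-sym (annihilate _ (reflexive (above-≰ {G} (λ le → C≰g (≤-trans (y≤x∨y B C) le)))))))

      absorb-pow : ∀ {a B C} → a ≢ 0̂ → a ≤ B → a ≤ C → B ∈ G → C ∈ G → ¬ (B ≤ C) → ∀ d →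
                   X C ⊗ pow (sumUp G B) d ∼ X C ⊗ pow (sumUp G (B ⊔ C)) d
      absorb-pow _ _ _ _ _ _ zero = ∼-refl
      absorb-pow {a} {B} {C} a≢0̂ a≤B a≤C B∈G C∈G B≰C (suc d) = begin
        X C ⊗ (y ⊗ pow y d)     ≈⟨ swap-⊗ _ _ _ ⟩
        y ⊗ (X C ⊗ pow y d)     ≈⟨ ⊗-congˡ (absorb-pow a≢0̂ a≤B a≤C B∈G C∈G B≰C d) ⟩
        y ⊗ (X C ⊗ pow y′ d)    ≈⟨ solve 3 (λ a b c → a :* (b :* c) := (b :* a) :* c) ∼-refl _ _ _ ⟩
        X C ⊗ y ⊗ pow y′ d      ≈⟨ ⊗-cong (absorb a≢0̂ a≤B a≤C B∈G C∈G B≰C) ∼-refl ⟩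
        X C ⊗ y′ ⊗ pow y′ d     ≈⟨ ⊗-assoc _ _ _ ⟩
        X C ⊗ (y′ ⊗ pow y′ d)   ∎
        where
        open import Relation.Binary.Reasoning.Setoid setoid
        y = sumUp G B
        y′ = sumUp G (B ⊔ C)

      -- Trade one factor y_B for the linear form of the next atom a: what remains are terms x_C with C ≥ a, C ≱ B,
      -- and on x_C the sums y_B and y_{B ∨ C} agree.
      defining-relation : ∀ {d} (as : Vec (Fin n) d) hs {B} → (∀ {h} → h LMem.∈ hs → h ∈ G) → B ∈ G →
        (∀ {h} → h LMem.∈ hs → h ⊏ B) → VAll.All (IsAtom L) as → VAll.All (_≤ B) as →
        Covers (λ y → y LMem.∈ hs ⊎ (y ∈ I × y ⊏ B) ⊎ y VMem.∈ as) B →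
        prodX hs ⊗ pow (sumUp G B) d ∼ 𝟘
      defining-relation Vec.[] hs hs⊆G B∈G hs⊏B _ _ cov = ∼-trans (⊗-oneʳ _) (circuit-list hs hs⊆G B∈G hs⊏B
        (covers-⊆ (λ { (inj₁ y∈) → inj₁ y∈ ; (inj₂ (inj₁ i)) → inj₂ i }) cov))
      defining-relation {suc d} (a Vec.∷ as) hs {B} hs⊆G B∈G hs⊏B (atom VAll.∷ atoms) (a≤B VAll.∷ as≤B) cov = begin
        prodX hs ⊗ (y ⊗ pow y d)                        ≈⟨ swap-⊗ _ _ _ ⟩
        y ⊗ Q                                           ≈⟨ ⊕-zeroʳ _ ⟨
        y ⊗ Q ⊕ 𝟘                                       ≈⟨ ⊕-congˡ remainder ⟨
        y ⊗ Q ⊕ sumOf rest (allFin n) ⊗ Q               ≈⟨ ⊗-distrib _ _ _ ⟨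
        (y ⊕ sumOf rest (allFin n)) ⊗ Q                 ≈⟨ ⊗-cong split ∼-refl ⟨
        sumUp G a ⊗ Q                                   ≈⟨ ⊗-cong (vanish (linear atom)) ∼-refl ⟩
        𝟘 ⊗ Q                                           ≈⟨ ⊗-zeroˡ _ ⟩
        𝟘                                               ∎
        where
        open import Relation.Binary.Reasoning.Setoid setoid
        y = sumUp G B
        Q = prodX hs ⊗ pow y d
        a≢0̂ : a ≢ 0̂
        a≢0̂ eq = atom .proj₁ .proj₂ (sym eq)
        rest : Fin n → Expr n
        rest C = if does (B ≤? C) then 𝟘 else above G a C
        rest-in : ∀ {C} → B ≤ C → rest C ≡ 𝟘
        rest-in {C} B≤C rewrite dec-true (B ≤? C) B≤C = refl
        rest-out : ∀ {C} → ¬ (B ≤ C) → rest C ≡ above G a C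
        rest-out {C} B≰C rewrite dec-false (B ≤? C) B≰C = refl
        split : sumUp G a ∼ y ⊕ sumOf rest (allFin n)
        split = ∼-trans (sumOf-cong termwise (allFin n)) (sumOf-⊕ _ _ (allFin n))
          where
          termwise : ∀ C → above G a C ∼ above G B C ⊕ rest C
          termwise C = by-cases (B ≤? C) (C Sub.∈? G)
            where
            by-cases : Dec (B ≤ C) → Dec (C ∈ G) → above G a C ∼ above G B C ⊕ rest C
            by-cases (yes B≤C) (no C∉G) = ∼-trans (reflexive (trans (above-∉ C∉G) (sym (above-∉ C∉G))))
              (∼-trans (∼-sym (⊕-zeroʳ _)) (⊕-congˡ (reflexive (sym (rest-in B≤C)))))
            by-cases (yes B≤C) (yes C∈G) = ∼-trans (reflexive (trans (above-in C∈G (≤-trans a≤B B≤C)) (sym (above-in C∈G B≤C))))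
              (∼-trans (∼-sym (⊕-zeroʳ _)) (⊕-congˡ (reflexive (sym (rest-in B≤C)))))
            by-cases (no B≰C) _ = ∼-trans (∼-sym (⊕-zeroˡ _))
              (⊕-cong (reflexive (sym (above-≰ {G} B≰C))) (reflexive (sym (rest-out B≰C))))
        term : ∀ C → Q ⊗ rest C ∼ 𝟘
        term C = by-cases (B ≤? C) (C Sub.∈? G) (a ≤? C)
          where
          by-cases : Dec (B ≤ C) → Dec (C ∈ G) → Dec (a ≤ C) → Q ⊗ rest C ∼ 𝟘
          by-cases (yes B≤C) _ _ = annihilate _ (reflexive (rest-in B≤C))
          by-cases (no B≰C) (no C∉G) _ = annihilate _ (reflexive (trans (rest-out B≰C) (above-∉ C∉G)))
          by-cases (no B≰C) (yes _) (no a≰C) = annihilate _ (reflexive (trans (rest-out B≰C) (above-≰ {G} a≰C)))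
          by-cases (no B≰C) (yes C∈G) (yes a≤C) = begin
            Q ⊗ rest C                                   ≈⟨ ⊗-congˡ (reflexive (trans (rest-out B≰C) (above-in C∈G a≤C))) ⟩
            prodX hs ⊗ pow y d ⊗ X C                     ≈⟨ solve 3 (λ a b c → (a :* b) :* c := a :* (c :* b)) ∼-refl _ _ _ ⟩
            prodX hs ⊗ (X C ⊗ pow y d)                   ≈⟨ ⊗-congˡ (absorb-pow a≢0̂ a≤B a≤C B∈G C∈G B≰C d) ⟩
            prodX hs ⊗ (X C ⊗ pow (sumUp G (B ⊔ C)) d)   ≈⟨ solve 3 (λ a b c → a :* (c :* b) := (c :* a) :* b) ∼-refl _ _ _ ⟩
            -- The atom a is now accounted for by C ≥ a, so the remaining `d` atoms suffice to reach
            -- the join B ∨ C.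
            prodX (C ∷ hs) ⊗ pow (sumUp G (B ⊔ C)) d     ≈⟨ defining-relation as (C ∷ hs)
                (λ { (here refl) → C∈G ; (there h∈) → hs⊆G h∈ })
                (join-closed a≢0̂ a≤B a≤C B∈G C∈G)
                (λ { (here refl) → y≤x∨y B C , (λ eq → B≰C (≤-trans (x≤x∨y B C) (≤-reflexive (sym eq))))
                   ; (there h∈) → ⊏-≤-trans (hs⊏B h∈) (x≤x∨y B C) })
                atoms (VAll.map (λ le → ≤-trans le (x≤x∨y B C)) as≤B)
                (λ z ub → ∨-least (cov z (λ { h (inj₁ h∈) → ub h (inj₁ (there h∈))
                                           ; h (inj₂ (inj₁ (h∈I , h⊏B))) → ub h (inj₂ (inj₁ (h∈I , ⊏-≤-trans h⊏B (x≤x∨y B C))))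
                                           ; h (inj₂ (inj₂ (VAny.here refl))) → ≤-trans a≤C (ub C (inj₁ (here refl)))
                                           ; h (inj₂ (inj₂ (VAny.there h∈))) → ub h (inj₂ (inj₂ h∈)) }))
                                  (ub C (inj₁ (here refl)))) ⟩
            𝟘                                            ∎
        remainder : sumOf rest (allFin n) ⊗ Q ∼ 𝟘
        remainder = ∼-trans (⊗-comm _ _) (∼-trans (sumOf-⊗ Q rest (allFin n)) (sumOf-vanish term (allFin n)))

  module _ {G I J : Subset n} where
    private
      module D₁ = D G I
      module D₂ = D G J

    enlarge : I ⊆ J → ∀ {p q} → p D₁.∼ q → p D₂.∼ q
    enlarge I⊆J = coarsen λ
      { (outside g∉G) → D₂.vanish (outside g∉G)
      ; (linear atom) → D₂.vanish (linear atom)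
      ; (circuit H H⊆G B∈G H⊏B cov) → D₂.vanish (circuit H H⊆G B∈G H⊏B
          (covers-⊆ (λ { (inj₁ y∈) → inj₁ y∈ ; (inj₂ (y∈ , y⊏)) → inj₂ (I⊆J y∈ , y⊏) }) cov)) }

    -- The Gysin map of the divisor x_b. A circuit that draws on b as a member of J becomes one over
    -- I once the factor x_b is supplied; if b is not strictly below its join, it never drew on b.
    restrict-multiply : ∀ b → b ∈ G → J ⊆ I ∪ ⁅ b ⁆ → ∀ {p q} → p D₂.∼ q → X b ⊗ p D₁.∼ X b ⊗ q
    restrict-multiply b b∈G J⊆ = multiply-sound (X b) kill
      where
      kill : ∀ {p} → Relator G J p → X b ⊗ p D₁.∼ 𝟘
      kill (outside g∉G) = D₁.annihilate _ (D₁.vanish (outside g∉G))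
      kill (linear atom) = D₁.annihilate _ (D₁.vanish (linear atom))
      kill (circuit H {B} H⊆G B∈G H⊏B cov) with b ⊏? B
      ... | yes b⊏B = D₁.circuit-list (b ∷ elems H)
              (λ { (here refl) → b∈G ; (there h∈) → H⊆G (∈-elems⁻ h∈) }) B∈G
              (λ { (here refl) → b⊏B ; (there h∈) → H⊏B _ (∈-elems⁻ h∈) })
              (covers-mono part cov)
        where
        part : ∀ {y} → y ∈ H ⊎ (y ∈ J × y ⊏ B) → ∃[ z ] y ≤ z × (z LMem.∈ b ∷ elems H ⊎ (z ∈ I × z ⊏ B))
        part {y} (inj₁ y∈H) = y , ≤-refl , inj₁ (there (∈-elems⁺ y∈H))
        part {y} (inj₂ (y∈J , y⊏B)) with Sub.x∈p∪q⁻ I ⁅ b ⁆ (J⊆ y∈J)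
        ... | inj₁ y∈I = y , ≤-refl , inj₂ (y∈I , y⊏B)
        ... | inj₂ y∈b = y , ≤-refl , inj₁ (here (Sub.x∈⁅y⁆⇒x≡y b y∈b))
      ... | no ¬b⊏B = D₁.annihilate _ (D₁.vanish (circuit H H⊆G B∈G H⊏B (covers-mono part cov)))
        where
        part : ∀ {y} → y ∈ H ⊎ (y ∈ J × y ⊏ B) → ∃[ z ] y ≤ z × (z ∈ H ⊎ (z ∈ I × z ⊏ B))
        part {y} (inj₁ y∈H) = y , ≤-refl , inj₁ y∈H
        part {y} (inj₂ (y∈J , y⊏B)) with Sub.x∈p∪q⁻ I ⁅ b ⁆ (J⊆ y∈J)
        ... | inj₁ y∈I = y , ≤-refl , inj₂ (y∈I , y⊏B)
        ... | inj₂ y∈b with Sub.x∈⁅y⁆⇒x≡y b y∈b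
        ...   | refl = ⊥-elim (¬b⊏B y⊏B)

-- Comparison with the polynomial model

vec-ext : ∀ {A : Set} {k} {u v : Vec A k} → (∀ i → lookup u i ≡ lookup v i) → u ≡ v
vec-ext {u = u} {v} eq = trans (sym (Vec.tabulate∘lookup u)) (trans (Vec.tabulate-cong eq) (Vec.tabulate∘lookup v))

all-∈ : ∀ {A : Set} {P : A → Set} {k} (as : Vec A k) → (∀ {a} → a VMem.∈ as → P a) → VAll.All P as
all-∈ Vec.[] h = VAll.[]
all-∈ (a Vec.∷ as) h = h (VAny.here refl) VAll.∷ all-∈ as (h ∘ VAny.there)

module Polynomials (L : FinLattice) where
  private
    n = FinLattice.n L
    infix 4 _≟ᴹ_
    _≟ᴹ_ : (m m′ : Mono L) → Dec (m ≡ m′)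
    _≟ᴹ_ = Vec.≡-dec ℕ._≟_

  infixl 7 _·_
  _·_ : Mono L → Mono L → Mono L
  _·_ = zipWith ℕ._+_

  one : Mono L
  one = replicate n 0

  unit : Fin n → Mono L
  unit g = tabulate (λ h → if does (h Fin.≟ g) then 1 else 0)

  ·-assoc : ∀ m m′ m″ → (m · m′) · m″ ≡ m · (m′ · m″)
  ·-assoc = Vec.zipWith-assoc ℕ.+-assoc

  ·-comm : ∀ m m′ → m · m′ ≡ m′ · m
  ·-comm = Vec.zipWith-comm ℕ.+-comm

  ·-oneˡ : ∀ m → one · m ≡ m
  ·-oneˡ = Vec.zipWith-identityˡ ℕ.+-identityˡ

  ·-oneʳ : ∀ m → m · one ≡ m
  ·-oneʳ = Vec.zipWith-identityʳ ℕ.+-identityʳ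

  mulTerm : ℤ × Mono L → Poly L → Poly L
  mulTerm (a , m) = List.map (λ (c , m′) → a ℤ.* c , m · m′)

  *P-++ : ∀ p p′ q → _*P_ L (p ++ p′) q ≡ _*P_ L p q ++ _*P_ L p′ q
  *P-++ [] p′ q = refl
  *P-++ (t ∷ p) p′ q = trans (cong (mulTerm t q ++_) (*P-++ p p′ q)) (sym (List.++-assoc (mulTerm t q) _ _))

  mulTerm-mulTerm : ∀ a m b m′ q → mulTerm (a , m) (mulTerm (b , m′) q) ≡ mulTerm (a ℤ.* b , m · m′) q
  mulTerm-mulTerm a m b m′ q = trans (sym (List.map-∘ q))
    (List.map-cong (λ (c , m″) → cong₂ _,_ (sym (ℤ.*-assoc a b c)) (sym (·-assoc m m′ m″))) q)

  mulTerm-*P : ∀ t p q → mulTerm t (_*P_ L p q) ≡ _*P_ L (mulTerm t p) q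
  mulTerm-*P t [] q = refl
  mulTerm-*P t@(a , m) ((b , m′) ∷ p) q = trans (List.map-++ _ (mulTerm (b , m′) q) (_*P_ L p q))
    (cong₂ _++_ (mulTerm-mulTerm a m b m′ q) (mulTerm-*P t p q))

  *P-assoc : ∀ p q r → _*P_ L (_*P_ L p q) r ≡ _*P_ L p (_*P_ L q r)
  *P-assoc [] q r = refl
  *P-assoc (t ∷ p) q r = trans (*P-++ (mulTerm t q) (_*P_ L p q) r)
    (cong₂ _++_ (sym (mulTerm-*P t q r)) (*P-assoc p q r))

  *P-zeroʳ : ∀ p → _*P_ L p [] ≡ []
  *P-zeroʳ [] = refl
  *P-zeroʳ (t ∷ p) = *P-zeroʳ p

  *P-term : ∀ p t → _*P_ L p (t ∷ []) ≡ mulTerm t p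
  *P-term [] t = refl
  *P-term ((a , m) ∷ p) t@(b , m′) = cong₂ _∷_ (cong₂ _,_ (ℤ.*-comm a b) (·-comm m m′)) (*P-term p t)

  mulTerm-one : ∀ a p → mulTerm (a , one) p ≡ scaleP L a p
  mulTerm-one a p = List.map-cong (λ (c , m) → cong (a ℤ.* c ,_) (·-oneˡ m)) p

  scale-one : ∀ p → scaleP L 1ℤ p ≡ p
  scale-one p = trans (List.map-cong (λ (c , m) → cong (_, m) (ℤ.*-identityˡ c)) p) (List.map-id p)

  coeff-++ : ∀ p q m → coeff L (p ++ q) m ≡ coeff L p m ℤ.+ coeff L q m
  coeff-++ [] q m = sym (ℤ.+-identityˡ _)
  coeff-++ ((c , m′) ∷ p) q m with does (m′ ≟ᴹ m)
  ... | true = trans (cong (λ s → c ℤ.+ s) (coeff-++ p q m)) (sym (ℤ.+-assoc c _ _))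
  ... | false = coeff-++ p q m

  coeff-scale : ∀ a p m → coeff L (scaleP L a p) m ≡ a ℤ.* coeff L p m
  coeff-scale a [] m = sym (ℤ.*-zeroʳ a)
  coeff-scale a ((c , m′) ∷ p) m with does (m′ ≟ᴹ m)
  ... | true = trans (cong (λ s → a ℤ.* c ℤ.+ s) (coeff-scale a p m)) (sym (ℤ.*-distribˡ-+ a c _))
  ... | false = coeff-scale a p m

  *P-distribˡ : ∀ p q r m → coeff L (_*P_ L p (q ++ r)) m ≡ coeff L (_*P_ L p q ++ _*P_ L p r) m
  *P-distribˡ [] q r m = refl
  *P-distribˡ (t ∷ p) q r m = begin
    coeff L (mulTerm t (q ++ r) ++ _*P_ L p (q ++ r)) m
      ≡⟨ cong (λ s → coeff L (s ++ _*P_ L p (q ++ r)) m) (List.map-++ _ q r) ⟩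
    coeff L ((mulTerm t q ++ mulTerm t r) ++ _*P_ L p (q ++ r)) m
      ≡⟨ trans (coeff-++ (mulTerm t q ++ mulTerm t r) _ m) (cong₂ ℤ._+_ (coeff-++ (mulTerm t q) (mulTerm t r) m) (trans (*P-distribˡ p q r m) (coeff-++ (_*P_ L p q) (_*P_ L p r) m))) ⟩
    (coeff L (mulTerm t q) m ℤ.+ coeff L (mulTerm t r) m) ℤ.+ (coeff L (_*P_ L p q) m ℤ.+ coeff L (_*P_ L p r) m)
      ≡⟨ interchange (coeff L (mulTerm t q) m) _ _ _ ⟩
    (coeff L (mulTerm t q) m ℤ.+ coeff L (_*P_ L p q) m) ℤ.+ (coeff L (mulTerm t r) m ℤ.+ coeff L (_*P_ L p r) m)
      ≡⟨ trans (coeff-++ (_*P_ L (t ∷ p) q) (_*P_ L (t ∷ p) r) m) (cong₂ ℤ._+_ (coeff-++ (mulTerm t q) _ m) (coeff-++ (mulTerm t r) _ m)) ⟨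
    coeff L (_*P_ L (t ∷ p) q ++ _*P_ L (t ∷ p) r) m ∎
    where
    open ≡.≡-Reasoning
    open import Algebra.Properties.CommutativeSemigroup ℤ.+-commutativeSemigroup using (interchange)

  module _ {P : Mono L → Set} (P? : ∀ m → Dec (P m)) where

    keep : Poly L → Poly L
    keep = filter (λ t → P? (t .proj₂))

    coeff-keep : ∀ p {m} → P m → coeff L (keep p) m ≡ coeff L p m
    coeff-keep [] Pm = refl
    coeff-keep ((c , m′) ∷ p) {m} Pm with P? m′
    ... | yes _ with does (m′ ≟ᴹ m)
    ...   | true = cong (λ s → c ℤ.+ s) (coeff-keep p Pm)
    ...   | false = coeff-keep p Pm
    coeff-keep ((c , m′) ∷ p) {m} Pm | no ¬Pm′ with m′ ≟ᴹ m
    ...   | yes refl = ⊥-elim (¬Pm′ Pm)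
    ...   | no _ = coeff-keep p Pm

    coeff-dropped : ∀ p {m} → ¬ P m → coeff L (keep p) m ≡ 0ℤ
    coeff-dropped [] ¬Pm = refl
    coeff-dropped ((c , m′) ∷ p) {m} ¬Pm with P? m′
    ... | no _ = coeff-dropped p ¬Pm
    ... | yes Pm′ with m′ ≟ᴹ m
    ...   | yes refl = ⊥-elim (¬Pm Pm′)
    ...   | no _ = coeff-dropped p ¬Pm

  remove : Mono L → Poly L → Poly L
  remove m = keep (λ k → ¬? (k ≟ᴹ m))

  coeff-remove-≡ : ∀ p m → coeff L (remove m p) m ≡ 0ℤ
  coeff-remove-≡ p m = coeff-dropped (λ k → ¬? (k ≟ᴹ m)) p (λ m≢m → m≢m refl)

  coeff-remove-≢ : ∀ p m {k} → k ≢ m → coeff L (remove m p) k ≡ coeff L p k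
  coeff-remove-≢ p m k≢m = coeff-keep (λ k → ¬? (k ≟ᴹ m)) p k≢m

  length-remove : ∀ c m p → length (remove m ((c , m) ∷ p)) ℕ.≤ length p
  length-remove c m p with m ≟ᴹ m
  ... | yes _ = List.length-filter _ p
  ... | no m≢m = ⊥-elim (m≢m refl)

  module LinearExtension (M : ℤ-Module) (h : Mono L → LeftModule.Carrierᴹ M) where
    open LeftModule M

    ev : Poly L → Carrierᴹ
    ev [] = 0ᴹ
    ev ((c , m) ∷ p) = c *ₗ h m +ᴹ ev p

    ev-++ : ∀ p q → ev (p ++ q) ≈ᴹ ev p +ᴹ ev q
    ev-++ [] q = ≈ᴹ-sym (+ᴹ-identityˡ _)
    ev-++ (t ∷ p) q = ≈ᴹ-trans (+ᴹ-congˡ (ev-++ p q)) (≈ᴹ-sym (+ᴹ-assoc _ _ _))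

    ev-scale : ∀ a p → ev (scaleP L a p) ≈ᴹ a *ₗ ev p
    ev-scale a [] = ≈ᴹ-sym (*ₗ-zeroʳ a)
    ev-scale a ((c , m) ∷ p) = ≈ᴹ-trans (+ᴹ-cong (*ₗ-assoc a c (h m)) (ev-scale a p)) (≈ᴹ-sym (*ₗ-distribˡ a _ _))

    ev-remove : ∀ p m → ev p ≈ᴹ coeff L p m *ₗ h m +ᴹ ev (remove m p)
    ev-remove [] m = ≈ᴹ-sym (≈ᴹ-trans (+ᴹ-congʳ (*ₗ-zeroˡ _)) (+ᴹ-identityˡ _))
    ev-remove ((c , m′) ∷ p) m with m′ ≟ᴹ m
    ... | yes refl = ≈ᴹ-trans (+ᴹ-congˡ (ev-remove p m)) (≈ᴹ-trans (≈ᴹ-sym (+ᴹ-assoc _ _ _)) (+ᴹ-congʳ (≈ᴹ-sym (*ₗ-distribʳ (h m) c (coeff L p m)))))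
    ... | no _ = ≈ᴹ-trans (+ᴹ-congˡ (ev-remove p m)) (≈ᴹ-trans (≈ᴹ-sym (+ᴹ-assoc _ _ _))
                   (≈ᴹ-trans (+ᴹ-congʳ (+ᴹ-comm _ _)) (+ᴹ-assoc _ _ _)))

    -- All terms with the leading monomial are collected into its total coefficient, which is zero,
    -- and at least one term disappears. The bound k on the length drives the recursion, which is
    -- not structural in p.
    ev-zero : ∀ k p → length p ℕ.≤ k → (∀ m → coeff L p m ≡ 0ℤ) → ev p ≈ᴹ 0ᴹ
    ev-zero k [] _ _ = ≈ᴹ-refl
    ev-zero (suc k) p₀@((c , m) ∷ p) (ℕ.s≤s le) eq = ≈ᴹ-trans (ev-remove p₀ m)
      (≈ᴹ-trans (+ᴹ-cong (≈ᴹ-trans (*ₗ-cong (eq m) ≈ᴹ-refl) (*ₗ-zeroˡ _))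
        (ev-zero k (remove m p₀) (ℕ.≤-trans (length-remove c m p) le) removed)) (+ᴹ-identityˡ _))
      where
      removed : ∀ k → coeff L (remove m p₀) k ≡ 0ℤ
      removed k with k ≟ᴹ m
      ... | yes refl = coeff-remove-≡ p₀ k
      ... | no k≢m = trans (coeff-remove-≢ p₀ m k≢m) (eq k)

    ev-resp : ∀ {p q} → (∀ m → coeff L p m ≡ coeff L q m) → ev p ≈ᴹ ev q
    ev-resp {p} {q} eq = begin
      ev p                                      ≈⟨ +ᴹ-identityʳ _ ⟨
      ev p +ᴹ 0ᴹ                                ≈⟨ +ᴹ-congˡ (*ₗ-zeroˡ (ev q)) ⟨
      ev p +ᴹ 0ℤ *ₗ ev q                        ≈⟨ +ᴹ-congˡ (*ₗ-distribʳ (ev q) -1ℤ 1ℤ) ⟩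
      ev p +ᴹ (-1ℤ *ₗ ev q +ᴹ 1ℤ *ₗ ev q)       ≈⟨ +ᴹ-congˡ (+ᴹ-congˡ (*ₗ-identityˡ _)) ⟩
      ev p +ᴹ (-1ℤ *ₗ ev q +ᴹ ev q)             ≈⟨ +ᴹ-assoc _ _ _ ⟨
      ev p +ᴹ -1ℤ *ₗ ev q +ᴹ ev q               ≈⟨ +ᴹ-congʳ (+ᴹ-congˡ (ev-scale -1ℤ q)) ⟨
      ev p +ᴹ ev (scaleP L -1ℤ q) +ᴹ ev q       ≈⟨ +ᴹ-congʳ (ev-++ p _) ⟨
      ev (p ++ scaleP L -1ℤ q) +ᴹ ev q          ≈⟨ +ᴹ-congʳ (ev-zero _ (p ++ scaleP L -1ℤ q) ℕ.≤-refl difference) ⟩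
      0ᴹ +ᴹ ev q                                ≈⟨ +ᴹ-identityˡ _ ⟩
      ev q ∎
      where
      open import Relation.Binary.Reasoning.Setoid ≈ᴹ-setoid
      difference : ∀ m → coeff L (p ++ scaleP L -1ℤ q) m ≡ 0ℤ
      difference m rewrite coeff-++ p (scaleP L -1ℤ q) m | coeff-scale -1ℤ q m | eq m =
        solve 1 (λ x → x :+ con -1ℤ :* x := con 0ℤ) refl (coeff L q m)
        where open +-*-Solver

  -- The coefficient of a fixed monomial in the product is itself a linear function of p, so
  -- `ev-resp` with values in ℤ applies and no monomial has to be cancelled.
  mulTerm-resp : ∀ t {p q} → (∀ m → coeff L p m ≡ coeff L q m) → ∀ m → coeff L (mulTerm t p) m ≡ coeff L (mulTerm t q) m
  mulTerm-resp t@(a , k) {p} {q} eq m = trans (as-ev p) (trans (ev-resp {p} {q} eq) (sym (as-ev q)))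
    where
    open LinearExtension TensorUnit.leftModule (λ m′ → if does (k · m′ ≟ᴹ m) then a else 0ℤ)
    as-ev : ∀ p → coeff L (mulTerm t p) m ≡ ev p
    as-ev [] = refl
    as-ev ((c , m′) ∷ p) with does (k · m′ ≟ᴹ m)
    ... | true = cong₂ ℤ._+_ (ℤ.*-comm a c) (as-ev p)
    ... | false = trans (as-ev p) (sym (trans (cong (λ s → s ℤ.+ ev p) (ℤ.*-zeroʳ c)) (ℤ.+-identityˡ _)))

module Link (L : FinLattice) (G I : Subset (FinLattice.n L)) (building : IsBuildingSet L G) where
  open Lattice L
  open Polynomials L
  private module Q = D G I
  open Q using (_∼_; ∼-refl; ∼-sym; ∼-trans; ⊕-cong; ⊗-cong; ⊕-congˡ; ⊗-congˡ)
  open Building G building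

  monoOf : ∀ {k} → (Fin k → Fin n) → Vec ℕ k → Expr n
  monoOf f Vec.[] = 𝟙
  monoOf f (e Vec.∷ m) = Q.pow (X (f zero)) e ⊗ monoOf (f ∘ suc) m

  mono : Mono L → Expr n
  mono = monoOf id

  open LinearExtension Q.additive mono using () renaming (ev to toExpr; ev-++ to toExpr-++; ev-scale to toExpr-scale; ev-resp to toExpr-resp)

  pow-+ : ∀ p a b → Q.pow p (a ℕ.+ b) ∼ Q.pow p a ⊗ Q.pow p b
  pow-+ p zero b = ∼-sym (Q.⊗-oneˡ _)
  pow-+ p (suc a) b = ∼-trans (⊗-congˡ (pow-+ p a b)) (∼-sym (Q.⊗-assoc _ _ _))

  monoOf-· : ∀ {k} (f : Fin k → Fin n) m m′ → monoOf f (zipWith ℕ._+_ m m′) ∼ monoOf f m ⊗ monoOf f m′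
  monoOf-· f Vec.[] Vec.[] = ∼-sym (Q.⊗-oneˡ _)
  monoOf-· f (a Vec.∷ m) (b Vec.∷ m′) = ∼-trans (⊗-cong (pow-+ _ a b) (monoOf-· (f ∘ suc) m m′))
    (Q.solve 4 (λ a b c d → (a Q.:* b) Q.:* (c Q.:* d) Q.:= (a Q.:* c) Q.:* (b Q.:* d)) ∼-refl _ _ _ _)

  monoOf-one : ∀ {k} (f : Fin k → Fin n) → monoOf f (replicate k 0) ∼ 𝟙
  monoOf-one {zero} f = ∼-refl
  monoOf-one {suc k} f = ∼-trans (Q.⊗-oneˡ _) (monoOf-one (f ∘ suc))

  monoOf-zeros : ∀ {k} (f : Fin k → Fin n) → monoOf f (tabulate (λ _ → 0)) ∼ 𝟙
  monoOf-zeros {zero} f = ∼-refl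
  monoOf-zeros {suc k} f = ∼-trans (Q.⊗-oneˡ _) (monoOf-zeros (f ∘ suc))

  monoOf-unit : ∀ {k} (f : Fin k → Fin n) g → monoOf f (tabulate (λ h → if does (h Fin.≟ g) then 1 else 0)) ∼ X (f g)
  monoOf-unit {suc k} f zero = ∼-trans (⊗-cong (Q.⊗-oneʳ _) (monoOf-zeros (f ∘ suc))) (Q.⊗-oneʳ _)
  monoOf-unit {suc k} f (suc g) = ∼-trans (Q.⊗-oneˡ _) (monoOf-unit (f ∘ suc) g)

  toExpr-term : ∀ a m → toExpr ((a , m) ∷ []) ∼ con a ⊗ mono m
  toExpr-term a m = Q.⊕-zeroʳ _

  toExpr-mulTerm : ∀ a m q → toExpr (mulTerm (a , m) q) ∼ con a ⊗ mono m ⊗ toExpr q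
  toExpr-mulTerm a m [] = ∼-sym (Q.⊗-zeroʳ _)
  toExpr-mulTerm a m ((b , m′) ∷ q) = ∼-trans (⊕-cong (⊗-cong (Q.con-* a b) (monoOf-· id m m′)) (toExpr-mulTerm a m q))
    (Q.solve 5 (λ a b m m′ q → (a Q.:* b) Q.:* (m Q.:* m′) Q.:+ a Q.:* m Q.:* q Q.:= a Q.:* m Q.:* (b Q.:* m′ Q.:+ q)) ∼-refl _ _ _ _ _)

  toExpr-* : ∀ p q → toExpr (_*P_ L p q) ∼ toExpr p ⊗ toExpr q
  toExpr-* [] q = ∼-sym (Q.⊗-zeroˡ _)
  toExpr-* ((a , m) ∷ p) q = ∼-trans (toExpr-++ (mulTerm (a , m) q) (_*P_ L p q))
    (∼-trans (⊕-cong (toExpr-mulTerm a m q) (toExpr-* p q)) (∼-sym (Q.⊗-distrib _ _ _)))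

  toExpr-one : toExpr (oneP L) ∼ 𝟙
  toExpr-one = ∼-trans (toExpr-term 1ℤ one) (∼-trans (Q.⊗-oneˡ _) (monoOf-one id))

  toExpr-var : ∀ g → toExpr (var L g) ∼ X g
  toExpr-var g = ∼-trans (toExpr-term 1ℤ (unit g)) (∼-trans (Q.⊗-oneˡ _) (monoOf-unit id g))

  toExpr-^ : ∀ p d → toExpr (_^P_ L p d) ∼ Q.pow (toExpr p) d
  toExpr-^ p zero = toExpr-one
  toExpr-^ p (suc d) = ∼-trans (toExpr-* p (_^P_ L p d)) (⊗-congˡ (toExpr-^ p d))

  toExpr-prodVars : ∀ H → toExpr (prodVars L H) ∼ prodX (elems H)
  toExpr-prodVars H = go (allFin n)
    where
    product : List (Fin n) → Poly L
    product = foldr (λ g acc → if lookup H g then _*P_ L (var L g) acc else acc) (oneP L)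
    go : ∀ gs → toExpr (product gs) ∼ prodX (filter (λ g → lookup H g Bool.≟ true) gs)
    go [] = toExpr-one
    go (g ∷ gs) with lookup H g
    ... | true = ∼-trans (toExpr-* (var L g) (product gs)) (⊗-cong (toExpr-var g) (go gs))
    ... | false = go gs

  toExpr-sumAbove : ∀ B → toExpr (sumAbove L G B) ∼ sumUp G B
  toExpr-sumAbove B = go (allFin n)
    where
    total : List (Fin n) → Poly L
    total = foldr (λ g acc → if lookup G g ∧ does (B ≤? g) then _+P_ L (var L g) acc else acc) (zeroP L)
    go : ∀ gs → toExpr (total gs) ∼ sumOf (above G B) gs
    go [] = ∼-refl
    go (g ∷ gs) with lookup G g ∧ does (B ≤? g)
    ... | true = ∼-trans (toExpr-++ (var L g) (total gs)) (⊕-cong (toExpr-var g) (go gs))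
    ... | false = ∼-trans (go gs) (∼-sym (Q.⊕-zeroˡ _))

  pow-cong : ∀ {p q} d → p ∼ q → Q.pow p d ∼ Q.pow q d
  pow-cong zero eq = ∼-refl
  pow-cong (suc d) eq = ⊗-cong eq (pow-cong d eq)

  genTerm∼𝟘 : ∀ (t : GenTerm L G I) → toExpr (genTermPoly L t) ∼ 𝟘
  genTerm∼𝟘 t = ∼-trans (toExpr-* mult (_*P_ L (prodVars L H) (_^P_ L (sumAbove L G B) d))) (Q.annihilate _ (∼-trans (toExpr-* (prodVars L H) (_^P_ L (sumAbove L G B) d))
      (∼-trans (⊗-cong (toExpr-prodVars H) (∼-trans (toExpr-^ (sumAbove L G B) d) (pow-cong d (toExpr-sumAbove B)))) relation)))
    where
    open GenTerm t
    as = isD .proj₁ .proj₁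
    atoms = isD .proj₁ .proj₂ .proj₁
    join = isD .proj₁ .proj₂ .proj₂
    relation : prodX (elems H) ⊗ Q.pow (sumUp G B) d ∼ 𝟘
    relation = Q.defining-relation building as (elems H) (H⊆G ∘ ∈-elems⁻) B∈G (H<B _ ∘ ∈-elems⁻) atoms
      (all-∈ as (λ a∈ → join .proj₁ _ (inj₂ (inj₂ a∈))))
      (covers-⊆ (λ { (inj₁ y∈H) → inj₁ (∈-elems⁺ y∈H) ; (inj₂ i) → inj₂ i }) (join .proj₂))

  combination : List (GenTerm L G I) → Poly L
  combination = foldr (λ t acc → _+P_ L (genTermPoly L t) acc) (zeroP L)

  ideal⇒∼𝟘 : ∀ p → InIdeal L G I p → toExpr p ∼ 𝟘
  ideal⇒∼𝟘 p (ts , eq) = ∼-trans (toExpr-resp {p} {combination ts} eq) (go ts)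
    where
    go : ∀ ts → toExpr (combination ts) ∼ 𝟘
    go [] = ∼-refl
    go (t ∷ ts) = ∼-trans (toExpr-++ (genTermPoly L t) (combination ts)) (Q.⊕-vanish (genTerm∼𝟘 t) (go ts))

  Supp : Mono L → Set
  Supp m = ∀ g → g ∈ G ⊎ lookup m g ≡ 0

  supp? : ∀ m → Dec (Supp m)
  supp? m = Fin.all? (λ g → (g Sub.∈? G) ⊎-dec (lookup m g ℕ.≟ 0))

  -- Stronger than `InRing`: it constrains also listed monomials whose coefficients cancel, and so
  -- passes through list operations term by term.
  Supported : Poly L → Set
  Supported = LAll.All (Supp ∘ proj₂)

  supp-one : Supp one
  supp-one g = inj₂ (Vec.lookup-replicate g 0)

  supp-unit : ∀ {g} → g ∈ G → Supp (unit g)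
  supp-unit {g} g∈G h = by-cases (h Fin.≟ g)
    where
    by-cases : Dec (h ≡ g) → h ∈ G ⊎ lookup (unit g) h ≡ 0
    by-cases (yes refl) = inj₁ g∈G
    by-cases (no h≢g) = inj₂ (trans (Vec.lookup∘tabulate _ h) (cong (λ d → if d then 1 else 0) (dec-false (h Fin.≟ g) h≢g)))

  supp-· : ∀ {m m′} → Supp m → Supp m′ → Supp (m · m′)
  supp-· {m} {m′} s s′ g with s g | s′ g
  ... | inj₁ g∈G | _ = inj₁ g∈G
  ... | _ | inj₁ g∈G = inj₁ g∈G
  ... | inj₂ eq | inj₂ eq′ = inj₂ (trans (Vec.lookup-zipWith ℕ._+_ g m m′) (cong₂ ℕ._+_ eq eq′))

  supported-mulTerm : ∀ a m {p} → Supp m → Supported p → Supported (mulTerm (a , m) p)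
  supported-mulTerm a m s sp = LAll.map⁺ (LAll.map (λ {t} → supp-· {m} {t .proj₂} s) sp)

  supported-scale : ∀ a {p} → Supported p → Supported (scaleP L a p)
  supported-scale a sp = LAll.map⁺ (LAll.map id sp)

  supported-* : ∀ {p q} → Supported p → Supported q → Supported (_*P_ L p q)
  supported-* [] sq = []
  supported-* (_∷_ {x = a , m} s sp) sq = LAll.++⁺ (supported-mulTerm a m s sq) (supported-* sp sq)

  supported⇒InRing : ∀ {p} → Supported p → InRing L G p
  supported⇒InRing {p} sp m c≢0 g g∉G = [ ⊥-elim ∘ g∉G , id ]′ (occurs p sp m c≢0 g)
    where
    occurs : ∀ p → Supported p → ∀ m → coeff L p m ≢ 0ℤ → Supp m
    occurs [] _ m c≢0 = ⊥-elim (c≢0 refl)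
    occurs ((c , m′) ∷ p) (s ∷ sp) m c≢0 with Vec.≡-dec ℕ._≟_ m′ m
    ... | yes refl = s
    ... | no _ = occurs p sp m c≢0

  -- `InIdeal` restricted to `Supported` multipliers, with the closure properties as constructors;
  -- multiplication by monomials is then shown by recursion.
  data Ideal : Poly L → Set where
    gen  : (t : GenTerm L G I) → Supported (GenTerm.mult t) → Ideal (genTermPoly L t)
    add  : ∀ {p q} → Ideal p → Ideal q → Ideal (p ++ q)
    nil  : Ideal []
    resp : ∀ {p q} → (∀ m → coeff L p m ≡ coeff L q m) → Ideal p → Ideal q

  ideal⇒InIdeal : ∀ {p} → Ideal p → InIdeal L G I p
  ideal⇒InIdeal (gen t _) = t ∷ [] , λ m → cong (λ p → coeff L p m) (sym (List.++-identityʳ (genTermPoly L t)))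
  ideal⇒InIdeal (add {p} {q} i j) with ideal⇒InIdeal i | ideal⇒InIdeal j
  ... | ts , eq | us , eq′ = ts ++ us , λ m → trans (coeff-++ p q m)
          (trans (cong₂ ℤ._+_ (eq m) (eq′ m)) (sym (trans (cong (λ p → coeff L p m) (combination-++ ts us)) (coeff-++ (combination ts) _ m))))
    where
    combination-++ : ∀ ts us → combination (ts ++ us) ≡ combination ts ++ combination us
    combination-++ [] us = refl
    combination-++ (t ∷ ts) us = trans (cong (genTermPoly L t ++_) (combination-++ ts us))
      (sym (List.++-assoc (genTermPoly L t) _ _))
  ideal⇒InIdeal nil = [] , λ _ → refl
  ideal⇒InIdeal (resp eq i) = let ts , eq′ = ideal⇒InIdeal i in ts , λ m → trans (sym (eq m)) (eq′ m)

  ideal-mulTerm : ∀ a m {p} → Supp m → Ideal p → Ideal (mulTerm (a , m) p)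
  ideal-mulTerm a m s (gen t st) = subst Ideal (sym (mulTerm-*P (a , m) (GenTerm.mult t) _))
    (gen (record { GenTerm t ; mult = mulTerm (a , m) (GenTerm.mult t) ; multR = supported⇒InRing (supported-mulTerm a m s st) })
         (supported-mulTerm a m s st))
  ideal-mulTerm a m s (add {p} {q} i j) = subst Ideal (sym (List.map-++ _ p q)) (add (ideal-mulTerm a m s i) (ideal-mulTerm a m s j))
  ideal-mulTerm a m s nil = nil
  ideal-mulTerm a m s (resp {p} {q} eq i) = resp (mulTerm-resp (a , m) {p} {q} eq) (ideal-mulTerm a m s i)

  ideal-scale : ∀ a {p} → Ideal p → Ideal (scaleP L a p)
  ideal-scale a {p} i = subst Ideal (mulTerm-one a p) (ideal-mulTerm a one supp-one i)

  infix 4 _≈ᴵ_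
  _≈ᴵ_ : Poly L → Poly L → Set
  p ≈ᴵ q = Ideal (p ++ scaleP L -1ℤ q)

  coeff-difference : ∀ p q m → coeff L (p ++ scaleP L -1ℤ q) m ≡ coeff L p m ℤ.+ -1ℤ ℤ.* coeff L q m
  coeff-difference p q m = trans (coeff-++ p _ m) (cong (λ s → coeff L p m ℤ.+ s) (coeff-scale -1ℤ q m))

  modulo : ∀ {p q i} → Ideal i → (∀ m → coeff L i m ≡ coeff L p m ℤ.+ -1ℤ ℤ.* coeff L q m) → p ≈ᴵ q
  modulo {p} {q} ideal eq = resp (λ m → trans (eq m) (sym (coeff-difference p q m))) ideal

  open +-*-Solver using (_:+_; _:*_; _:=_) renaming (solve to solveℤ; con to κℤ)

  ≈P⇒≈ᴵ : ∀ p q → (∀ m → coeff L p m ≡ coeff L q m) → p ≈ᴵ q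
  ≈P⇒≈ᴵ p q eq = modulo {p} {q} nil λ m → trans (solveℤ 1 (λ x → κℤ 0ℤ := x :+ κℤ -1ℤ :* x) refl (coeff L q m))
    (cong (λ s → s ℤ.+ -1ℤ ℤ.* coeff L q m) (sym (eq m)))

  ≈ᴵ-refl : ∀ {p} → p ≈ᴵ p
  ≈ᴵ-refl {p} = ≈P⇒≈ᴵ p p (λ _ → refl)

  ≈ᴵ-reflexive : ∀ {p q} → p ≡ q → p ≈ᴵ q
  ≈ᴵ-reflexive {p} refl = ≈ᴵ-refl {p}

  ≈ᴵ-sym : ∀ {p q} → p ≈ᴵ q → q ≈ᴵ p
  ≈ᴵ-sym {p} {q} i = modulo {q} {p} (ideal-scale -1ℤ i) λ m → trans (coeff-scale -1ℤ (p ++ scaleP L -1ℤ q) m)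
    (trans (cong (-1ℤ ℤ.*_) (coeff-difference p q m))
      (solveℤ 2 (λ x y → κℤ -1ℤ :* (x :+ κℤ -1ℤ :* y) := y :+ κℤ -1ℤ :* x) refl (coeff L p m) (coeff L q m)))

  ≈ᴵ-trans : ∀ {p q r} → p ≈ᴵ q → q ≈ᴵ r → p ≈ᴵ r
  ≈ᴵ-trans {p} {q} {r} i j = modulo {p} {r} (add i j) λ m → trans (coeff-++ (p ++ scaleP L -1ℤ q) _ m)
    (trans (cong₂ ℤ._+_ (coeff-difference p q m) (coeff-difference q r m))
      (solveℤ 3 (λ x y z → (x :+ κℤ -1ℤ :* y) :+ (y :+ κℤ -1ℤ :* z) := x :+ κℤ -1ℤ :* z) refl (coeff L p m) (coeff L q m) (coeff L r m)))

  ≈ᴵ-++ : ∀ {p p′ q q′} → p ≈ᴵ p′ → q ≈ᴵ q′ → p ++ q ≈ᴵ p′ ++ q′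
  ≈ᴵ-++ {p} {p′} {q} {q′} i j = modulo {p ++ q} {p′ ++ q′} (add i j) λ m → trans (coeff-++ (p ++ scaleP L -1ℤ p′) _ m)
    (trans (cong₂ ℤ._+_ (coeff-difference p p′ m) (coeff-difference q q′ m))
      (trans (solveℤ 4 (λ x x′ y y′ → (x :+ κℤ -1ℤ :* x′) :+ (y :+ κℤ -1ℤ :* y′) := (x :+ y) :+ κℤ -1ℤ :* (x′ :+ y′))
          refl (coeff L p m) (coeff L p′ m) (coeff L q m) (coeff L q′ m))
        (sym (cong₂ (λ s t → s ℤ.+ -1ℤ ℤ.* t) (coeff-++ p q m) (coeff-++ p′ q′ m)))))

  ≈ᴵ-mulTerm : ∀ a k {p q} → Supp k → p ≈ᴵ q → mulTerm (a , k) p ≈ᴵ mulTerm (a , k) q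
  ≈ᴵ-mulTerm a k {p} {q} s i = subst Ideal
    (trans (List.map-++ _ p (scaleP L -1ℤ q)) (cong (mulTerm (a , k) p ++_) (trans (sym (List.map-∘ q))
      (trans (List.map-cong (λ (c , m) → cong (_, k · m) (swap c)) q) (List.map-∘ q)))))
    (ideal-mulTerm a k s i)
    where
    swap : ∀ c → a ℤ.* (-1ℤ ℤ.* c) ≡ -1ℤ ℤ.* (a ℤ.* c)
    swap c = solveℤ 2 (λ a c → a :* (κℤ -1ℤ :* c) := κℤ -1ℤ :* (a :* c)) refl a c

  ≈ᴵ-scale : ∀ a {p q} → p ≈ᴵ q → scaleP L a p ≈ᴵ scaleP L a q
  ≈ᴵ-scale a {p} {q} i = ≡.subst₂ _≈ᴵ_ (mulTerm-one a p) (mulTerm-one a q) (≈ᴵ-mulTerm a one {p} {q} supp-one i)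

  quotient : ℤ-Module
  quotient = record
    { Carrierᴹ = Σ (Poly L) Supported
    ; _≈ᴹ_ = λ (p , _) (q , _) → p ≈ᴵ q
    ; _+ᴹ_ = λ (p , sp) (q , sq) → p ++ q , LAll.++⁺ sp sq
    ; _*ₗ_ = λ a (p , sp) → scaleP L a p , supported-scale a sp
    ; 0ᴹ = [] , []
    ; -ᴹ_ = λ (p , sp) → scaleP L -1ℤ p , supported-scale -1ℤ sp
    ; isLeftModule = record
      { isLeftSemimodule = record
        { +ᴹ-isCommutativeMonoid = record
          { isMonoid = record
            { isSemigroup = record
              { isMagma = record
                { isEquivalence = record
                  { refl = λ {(p , _)} → ≈ᴵ-refl {p}
                  ; sym = λ {(p , _)} {(q , _)} → ≈ᴵ-sym {p} {q}
                  ; trans = λ {(p , _)} {(q , _)} {(r , _)} → ≈ᴵ-trans {p} {q} {r} }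
                ; ∙-cong = λ {(p , _)} {(p′ , _)} {(q , _)} {(q′ , _)} → ≈ᴵ-++ {p} {p′} {q} {q′} }
              ; assoc = λ (p , _) (q , _) (r , _) → ≈ᴵ-reflexive (List.++-assoc p q r) }
            ; identity = (λ (p , _) → ≈ᴵ-refl {p}) , (λ (p , _) → ≈ᴵ-reflexive (List.++-identityʳ p)) }
          ; comm = λ (p , _) (q , _) → ≈P⇒≈ᴵ (p ++ q) (q ++ p) λ m →
              trans (coeff-++ p q m) (trans (ℤ.+-comm (coeff L p m) _) (sym (coeff-++ q p m))) }
        ; isPreleftSemimodule = record
          { *ₗ-cong = λ { {a} {_} {p , _} {q , _} refl i → ≈ᴵ-scale a {p} {q} i }
          ; *ₗ-zeroˡ = λ (p , _) → ≈P⇒≈ᴵ (scaleP L 0ℤ p) [] (coeff-scale 0ℤ p)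
          ; *ₗ-distribʳ = λ (p , _) a b → ≈P⇒≈ᴵ (scaleP L (a ℤ.+ b) p) (scaleP L a p ++ scaleP L b p) λ m →
              trans (coeff-scale (a ℤ.+ b) p m) (trans (ℤ.*-distribʳ-+ (coeff L p m) a b)
                (sym (trans (coeff-++ (scaleP L a p) _ m) (cong₂ ℤ._+_ (coeff-scale a p m) (coeff-scale b p m)))))
          ; *ₗ-identityˡ = λ (p , _) → ≈ᴵ-reflexive (scale-one p)
          ; *ₗ-assoc = λ a b (p , _) → ≈ᴵ-reflexive (trans (List.map-cong (λ (c , m) → cong (_, m) (ℤ.*-assoc a b c)) p) (List.map-∘ p))
          ; *ₗ-zeroʳ = λ a → ≈ᴵ-refl {[]}
          ; *ₗ-distribˡ = λ a (p , _) (q , _) → ≈ᴵ-reflexive (List.map-++ _ p q) } }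
      ; -ᴹ‿cong = λ {(p , _)} {(q , _)} → ≈ᴵ-scale -1ℤ {p} {q}
      ; -ᴹ‿inverse = (λ (p , _) → ≈P⇒≈ᴵ (scaleP L -1ℤ p ++ p) [] λ m → trans (coeff-++ (scaleP L -1ℤ p) p m)
                        (trans (cong (λ s → s ℤ.+ coeff L p m) (coeff-scale -1ℤ p m))
                          (solveℤ 1 (λ x → κℤ -1ℤ :* x :+ x := κℤ 0ℤ) refl (coeff L p m)))) ,
                     (λ (p , _) → ≈P⇒≈ᴵ (p ++ scaleP L -1ℤ p) [] λ m → trans (coeff-difference p p m)
                          (solveℤ 1 (λ x → x :+ κℤ -1ℤ :* x := κℤ 0ℤ) refl (coeff L p m))) } }

  open LeftModule quotient using (Carrierᴹ; _≈ᴹ_; _+ᴹ_; _*ₗ_; 0ᴹ; ≈ᴹ-refl; ≈ᴹ-sym; ≈ᴹ-trans; ≈ᴹ-reflexive; +ᴹ-cong; +ᴹ-congʳ; *ₗ-zeroˡ; +ᴹ-identityˡ; *ₗ-identityˡ)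

  -- Variables outside G act as zero, as the relator `outside` demands; this also keeps the result
  -- `Supported`.
  multiplyBy : ∀ g → Dec (g ∈ G) → Carrierᴹ → Carrierᴹ
  multiplyBy g (yes g∈G) (p , sp) = mulTerm (1ℤ , unit g) p , supported-mulTerm 1ℤ (unit g) (supp-unit g∈G) sp
  multiplyBy g (no _) _ = [] , []

  multiplication : Operators n quotient
  multiplication = record
    { op = λ g → multiplyBy g (g Sub.∈? G)
    ; op-cong = λ g {u} {v} → mult-cong g (g Sub.∈? G) {u} {v}
    ; op-+ = λ g → mult-+ g (g Sub.∈? G)
    ; op-* = λ g → mult-* g (g Sub.∈? G)
    ; op-comm = λ g h → mult-comm g h (g Sub.∈? G) (h Sub.∈? G) }
    where
    mult-cong : ∀ g d {u v} → u ≈ᴹ v → multiplyBy g d u ≈ᴹ multiplyBy g d v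
    mult-cong g (yes g∈G) {p , _} {q , _} i = ≈ᴵ-mulTerm 1ℤ (unit g) {p} {q} (supp-unit g∈G) i
    mult-cong g (no _) i = nil
    mult-+ : ∀ g d u v → multiplyBy g d (u +ᴹ v) ≈ᴹ multiplyBy g d u +ᴹ multiplyBy g d v
    mult-+ g (yes _) (p , _) (q , _) = ≈ᴵ-reflexive (List.map-++ _ p q)
    mult-+ g (no _) _ _ = nil
    mult-* : ∀ g d a v → multiplyBy g d (a *ₗ v) ≈ᴹ a *ₗ multiplyBy g d v
    mult-* g (yes _) a (p , _) = ≈ᴵ-reflexive (trans (sym (List.map-∘ p)) (trans
      (List.map-cong (λ (c , m) → cong (_, unit g · m) (solveℤ 2 (λ a c → κℤ 1ℤ :* (a :* c) := a :* (κℤ 1ℤ :* c)) refl a c)) p) (List.map-∘ p)))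
    mult-* g (no _) a _ = nil
    mult-comm : ∀ g h d d′ v → multiplyBy g d (multiplyBy h d′ v) ≈ᴹ multiplyBy h d′ (multiplyBy g d v)
    mult-comm g h (yes _) (yes _) (p , _) = ≈ᴵ-reflexive (trans (mulTerm-mulTerm 1ℤ (unit g) 1ℤ (unit h) p)
      (trans (cong (λ m → mulTerm (1ℤ , m) p) (·-comm (unit g) (unit h))) (sym (mulTerm-mulTerm 1ℤ (unit h) 1ℤ (unit g) p))))
    mult-comm g h (yes _) (no _) _ = nil
    mult-comm g h (no _) (yes _) _ = nil
    mult-comm g h (no _) (no _) _ = nil

  open Operators multiplication using (op; act; act-cong; act-comm; act-sound)

  infixl 7 _⊛_
  _⊛_ : Carrierᴹ → Carrierᴹ → Carrierᴹ
  (p , sp) ⊛ (q , sq) = _*P_ L p q , supported-* sp sq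

  -- The action of e is right multiplication by w. With the vector on the left, a multiple of a
  -- generator has literally the form of `genTermPoly`, the vector serving as `mult`.
  record Represents (e : Expr n) (w : Poly L) : Set where
    constructor represents
    field
      supported : Supported w
      acts      : ∀ v → act e v ≈ᴹ v ⊛ (w , supported)
  open Represents

  rep-zero : Represents 𝟘 []
  rep-zero = represents [] λ v@(p , _) → ≈ᴹ-trans {0ℤ *ₗ v} {0ᴹ} {v ⊛ 0ᴹ} (*ₗ-zeroˡ v) (≈ᴵ-reflexive (sym (*P-zeroʳ p)))

  rep-one : Represents 𝟙 (oneP L)
  rep-one = represents (supp-one ∷ []) λ (p , _) →
    ≈ᴵ-reflexive (sym (trans (*P-term p (1ℤ , one)) (mulTerm-one 1ℤ p)))

  rep-var : ∀ {g} → g ∈ G → Represents (X g) (var L g)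
  rep-var {g} g∈G = represents (supp-unit g∈G ∷ []) λ v → acts-var (g Sub.∈? G) v
    where
    acts-var : ∀ d v → multiplyBy g d v ≈ᴹ v ⊛ (var L g , supp-unit g∈G ∷ [])
    acts-var (yes _) (p , _) = ≈ᴵ-reflexive (sym (*P-term p (1ℤ , unit g)))
    acts-var (no g∉G) _ = ⊥-elim (g∉G g∈G)

  rep-⊕ : ∀ {e e′ w w′} → Represents e w → Represents e′ w′ → Represents (e ⊕ e′) (w ++ w′)
  rep-⊕ {e} {e′} {w} {w′} (represents s a) (represents s′ a′) = represents (LAll.++⁺ s s′) λ v@(p , _) →
    ≈ᴹ-trans {act (e ⊕ e′) v} {v ⊛ (w , s) +ᴹ v ⊛ (w′ , s′)} {v ⊛ (w ++ w′ , LAll.++⁺ s s′)}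
      (+ᴹ-cong {act e v} {v ⊛ (w , s)} {act e′ v} {v ⊛ (w′ , s′)} (a v) (a′ v))
      (≈P⇒≈ᴵ _ (_*P_ L p (w ++ w′)) (λ m → sym (*P-distribˡ p w w′ m)))

  rep-⊗ : ∀ {e e′ w w′} → Represents e w → Represents e′ w′ → Represents (e ⊗ e′) (_*P_ L w w′)
  rep-⊗ {e} {e′} {w} {w′} (represents s a) (represents s′ a′) = represents (supported-* s s′) λ v@(p , _) →
    ≈ᴹ-trans {act e (act e′ v)} {act e′ (act e v)} {v ⊛ (_*P_ L w w′ , supported-* s s′)} (act-comm e e′ v)
      (≈ᴹ-trans {act e′ (act e v)} {act e′ (v ⊛ (w , s))} {v ⊛ (_*P_ L w w′ , supported-* s s′)}
        (act-cong e′ {act e v} {v ⊛ (w , s)} (a v))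
        (≈ᴹ-trans {act e′ (v ⊛ (w , s))} {v ⊛ (w , s) ⊛ (w′ , s′)} {v ⊛ (_*P_ L w w′ , supported-* s s′)}
          (a′ (v ⊛ (w , s))) (≈ᴵ-reflexive (*P-assoc p w w′))))

  rep-⊕-zero : ∀ {e w} → Represents e w → Represents (𝟘 ⊕ e) w
  rep-⊕-zero {e} {w} (represents s a) = represents s λ v →
    ≈ᴹ-trans {0ℤ *ₗ v +ᴹ act e v} {act e v} {v ⊛ (w , s)}
      (≈ᴹ-trans {0ℤ *ₗ v +ᴹ act e v} {0ᴹ +ᴹ act e v} {act e v} (+ᴹ-congʳ {act e v} {0ℤ *ₗ v} {0ᴹ} (*ₗ-zeroˡ v)) (+ᴹ-identityˡ (act e v)))
      (a v)

  rep-prodVars : ∀ {H} → H ⊆ G → Represents (prodX (elems H)) (prodVars L H)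
  rep-prodVars {H} H⊆G = go (allFin n)
    where
    go : ∀ gs → Represents (prodX (filter (λ g → lookup H g Bool.≟ true) gs))
                           (foldr (λ g acc → if lookup H g then _*P_ L (var L g) acc else acc) (oneP L) gs)
    go [] = rep-one
    go (g ∷ gs) with lookup H g in eq
    ... | true = rep-⊗ (rep-var (H⊆G (Vec.lookup⇒[]= g H eq))) (go gs)
    ... | false = go gs

  rep-sumAbove : ∀ B → Represents (sumUp G B) (sumAbove L G B)
  rep-sumAbove B = go (allFin n)
    where
    go : ∀ gs → Represents (sumOf (above G B) gs)
                           (foldr (λ g acc → if lookup G g ∧ does (B ≤? g) then _+P_ L (var L g) acc else acc) (zeroP L) gs)
    go [] = rep-zero
    go (g ∷ gs) with lookup G g in eq | does (B ≤? g)
    ... | true | true = rep-⊕ (rep-var (Vec.lookup⇒[]= g G eq)) (go gs)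
    ... | true | false = rep-⊕-zero (go gs)
    ... | false | _ = rep-⊕-zero (go gs)

  rep-pow : ∀ {e w} → Represents e w → ∀ d → Represents (Q.pow e d) (_^P_ L w d)
  rep-pow r zero = rep-one
  rep-pow r (suc d) = rep-⊗ r (rep-pow r d)

  kill-generator : ∀ H {B d} → H ⊆ G → B ∈ G → (∀ h → h ∈ H → h ⊏ B) → IsD L I H B d →
                   ∀ v → act (prodX (elems H) ⊗ Q.pow (sumUp G B) d) v ≈ᴹ 0ᴹ
  kill-generator H {B} {d} H⊆G B∈G H⊏B isD v@(p , sp) = ≈ᴹ-trans {act (prodX (elems H) ⊗ Q.pow (sumUp G B) d) v} {v ⊛ (w , rep .supported)} {0ᴹ} (rep .acts v)
    (subst Ideal (sym (List.++-identityʳ (_*P_ L p w))) (gen term sp))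
    where
    w = _*P_ L (prodVars L H) (_^P_ L (sumAbove L G B) d)
    rep : Represents (prodX (elems H) ⊗ Q.pow (sumUp G B) d) w
    rep = rep-⊗ (rep-prodVars H⊆G) (rep-pow (rep-sumAbove B) d)
    term : GenTerm L G I
    term = record { H = H ; B = B ; d = d ; H⊆G = H⊆G ; B∈G = B∈G ; H<B = H⊏B ; isD = isD ; mult = p ; multR = supported⇒InRing sp }

  elems-⊥ : elems {n} Subset.⊥ ≡ []
  elems-⊥ with elems {n} Subset.⊥ in eq
  ... | [] = refl
  ... | g ∷ gs = ⊥-elim (Sub.∉⊥ (∈-elems⁻ {H = Subset.⊥} (subst (g LMem.∈_) (sym eq) (here refl))))

  -- A circuit reaches its join without additional atoms, so its product is a generator of exponent
  -- 0.
  d-circuit : ∀ {H B} → (∀ h → h ∈ H → h ⊏ B) → Covers (λ y → y ∈ H ⊎ (y ∈ I × y ⊏ B)) B → IsD L I H B 0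
  d-circuit {H} {B} H⊏B cov = (Vec.[] , VAll.[] , upper , λ z ub → cov z (λ { y (inj₁ y∈H) → ub y (inj₁ y∈H) ; y (inj₂ i) → ub y (inj₂ (inj₁ i)) })) ,
    λ _ ()
    where
    upper : ∀ y → y ∈ H ⊎ (y ∈ I × y ⊏ B) ⊎ y VMem.∈ Vec.[] → y ≤ B
    upper y (inj₁ y∈H) = H⊏B y y∈H .proj₁
    upper y (inj₂ (inj₁ (_ , y⊏B))) = y⊏B .proj₁

  -- Strictly below an atom there is only 0̂, so exactly one atom is missing. The generator for H =
  -- ∅ and B = a is thus the linear form of a.
  d-atom : ∀ {a} → IsAtom L a → IsD L I Subset.⊥ a 1
  d-atom {a} atom@((_ , 0̂≢a) , cover) =
    (a Vec.∷ Vec.[] , atom VAll.∷ VAll.[] , upper , λ z ub → ub a (inj₂ (inj₂ (VAny.here refl)))) ,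
    λ { zero _ Vec.[] (_ , _ , least) → 0̂≢a (antisym (0̂-min a) (least 0̂ trivial)) ; (suc m) (ℕ.s≤s ()) }
    where
    upper : ∀ y → y ∈ Subset.⊥ ⊎ (y ∈ I × y ⊏ a) ⊎ y VMem.∈ (a Vec.∷ Vec.[]) → y ≤ a
    upper y (inj₁ y∈⊥) = ⊥-elim (Sub.∉⊥ y∈⊥)
    upper y (inj₂ (inj₁ (_ , y⊏a))) = y⊏a .proj₁
    upper y (inj₂ (inj₂ (VAny.here refl))) = ≤-refl
    trivial : ∀ y → y ∈ Subset.⊥ ⊎ (y ∈ I × y ⊏ a) ⊎ y VMem.∈ Vec.[] → y ≤ 0̂
    trivial y (inj₁ y∈⊥) = ⊥-elim (Sub.∉⊥ y∈⊥)
    trivial y (inj₂ (inj₁ (_ , y≤a , y≢a))) with cover y (0̂-min y) y≤a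
    ... | inj₁ eq = ≤-reflexive eq
    ... | inj₂ eq = ⊥-elim (y≢a eq)

  kill : ∀ {p} → Relator G I p → ∀ v → act p v ≈ᴹ 0ᴹ
  kill (outside {g} g∉G) v = vanish (g Sub.∈? G)
    where
    vanish : ∀ d → multiplyBy g d v ≈ᴹ 0ᴹ
    vanish (yes g∈G) = ⊥-elim (g∉G g∈G)
    vanish (no _) = nil
  kill (circuit H {B} H⊆G B∈G H⊏B cov) v =
    ≈ᴹ-trans {act (prodX (elems H)) v} {act (prodX (elems H)) (1ℤ *ₗ v)} {0ᴹ}
      (act-cong (prodX (elems H)) {v} {1ℤ *ₗ v} (≈ᴹ-sym {1ℤ *ₗ v} {v} (*ₗ-identityˡ v)))
      (kill-generator H H⊆G B∈G H⊏B (d-circuit H⊏B cov) v)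
  kill (linear {a} atom) v =
    ≈ᴹ-trans {act (sumUp G a) v} {act (prodX (elems Subset.⊥) ⊗ Q.pow (sumUp G a) 1) v} {0ᴹ}
      (act-sound {Z = λ _ → ⊥} (λ ()) expand v)
      (kill-generator Subset.⊥ (λ y∈⊥ → ⊥-elim (Sub.∉⊥ y∈⊥)) (atom∈G atom) (λ h h∈⊥ → ⊥-elim (Sub.∉⊥ h∈⊥)) (d-atom atom) v)
    where
    open Quotient (λ (_ : Expr n) → ⊥) using () renaming (_∼_ to _≃_; ∼-sym to ≃-sym; ∼-trans to ≃-trans; ⊗-oneˡ to ≃-oneˡ; ⊗-oneʳ to ≃-oneʳ; reflexive to ≃-reflexive; ⊗-cong to ≃-⊗)
    expand : sumUp G a ≃ prodX (elems Subset.⊥) ⊗ Q.pow (sumUp G a) 1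
    expand = ≃-trans (≃-sym (≃-oneˡ _)) (≃-⊗ (≃-reflexive (cong prodX (sym elems-⊥))) (≃-sym (≃-oneʳ _)))

  1# : Carrierᴹ
  1# = oneP L , supp-one ∷ []

  -- Built by the same recursion by which `monoOf f m` acts; for f = id it is the monomial m itself.
  power : ∀ {k} → (Fin k → Fin n) → Vec ℕ k → Mono L
  power f Vec.[] = one
  power f (zero Vec.∷ m) = power (f ∘ suc) m
  power f (suc e Vec.∷ m) = unit (f zero) · power f (e Vec.∷ m)

  lookup-unit-≡ : ∀ g → lookup (unit g) g ≡ 1
  lookup-unit-≡ g = trans (Vec.lookup∘tabulate _ g) (cong (λ d → if d then 1 else 0) (dec-true (g Fin.≟ g) refl))

  lookup-unit-≢ : ∀ {g h} → h ≢ g → lookup (unit g) h ≡ 0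
  lookup-unit-≢ {g} {h} h≢g = trans (Vec.lookup∘tabulate _ h) (cong (λ d → if d then 1 else 0) (dec-false (h Fin.≟ g) h≢g))

  lookup-power-∉ : ∀ {k} (f : Fin k → Fin n) m g → (∀ i → f i ≢ g) → lookup (power f m) g ≡ 0
  lookup-power-∉ f Vec.[] g _ = Vec.lookup-replicate g 0
  lookup-power-∉ f (zero Vec.∷ m) g avoid = lookup-power-∉ (f ∘ suc) m g (avoid ∘ suc)
  lookup-power-∉ f (suc e Vec.∷ m) g avoid = trans (Vec.lookup-zipWith ℕ._+_ g (unit (f zero)) _)
    (cong₂ ℕ._+_ (lookup-unit-≢ (avoid zero ∘ sym)) (lookup-power-∉ f (e Vec.∷ m) g avoid))

  lookup-power : ∀ {k} (f : Fin k → Fin n) → (∀ {i j} → f i ≡ f j → i ≡ j) → ∀ m i → lookup (power f m) (f i) ≡ lookup m i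
  lookup-power f inj (zero Vec.∷ m) zero = lookup-power-∉ (f ∘ suc) m (f zero) (λ i eq → case inj eq of λ ())
  lookup-power f inj (zero Vec.∷ m) (suc i) = lookup-power (f ∘ suc) (Fin.suc-injective ∘ inj) m i
  lookup-power f inj (suc e Vec.∷ m) zero = trans (Vec.lookup-zipWith ℕ._+_ (f zero) (unit (f zero)) _)
    (cong₂ ℕ._+_ (lookup-unit-≡ (f zero)) (lookup-power f inj (e Vec.∷ m) zero))
  lookup-power f inj (suc e Vec.∷ m) (suc i) = trans (Vec.lookup-zipWith ℕ._+_ (f (suc i)) (unit (f zero)) _)
    (cong₂ ℕ._+_ (lookup-unit-≢ (λ eq → case inj eq of λ ())) (lookup-power f inj (e Vec.∷ m) (suc i)))

  act-monoOf : ∀ {k} (f : Fin k → Fin n) m → (∀ i → f i ∈ G ⊎ lookup m i ≡ 0) → ∀ v → act (monoOf f m) v .proj₁ ≈ᴵ mulTerm (1ℤ , power f m) (v .proj₁)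
  act-monoOf f Vec.[] _ (p , _) = ≈ᴵ-reflexive (sym (mulTerm-one 1ℤ p))
  act-monoOf f (zero Vec.∷ m) s v@(p , _) = ≈ᴵ-trans {act (monoOf (f ∘ suc) m) v .proj₁ |> scaleP L 1ℤ} {act (monoOf (f ∘ suc) m) v .proj₁} {mulTerm (1ℤ , power (f ∘ suc) m) p}
    (≈ᴵ-reflexive (scale-one (act (monoOf (f ∘ suc) m) v .proj₁))) (act-monoOf (f ∘ suc) m (s ∘ suc) v)
  act-monoOf f (suc e Vec.∷ m) s v@(p , _) =
    advance (s zero) (λ f0∈G → act-monoOf f (e Vec.∷ m) (λ { zero → inj₁ f0∈G ; (suc i) → s (suc i) }) v)
    where
    u = act (monoOf f (e Vec.∷ m)) v
    q = mulTerm (1ℤ , power f (e Vec.∷ m)) p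
    present : ∀ d → f zero ∈ G → multiplyBy (f zero) d u .proj₁ ≡ mulTerm (1ℤ , unit (f zero)) (u .proj₁)
    present (yes _) _ = refl
    present (no f0∉G) f0∈G = ⊥-elim (f0∉G f0∈G)
    advance : f zero ∈ G ⊎ suc e ≡ 0 → (f zero ∈ G → u .proj₁ ≈ᴵ q) →
           multiplyBy (f zero) (f zero Sub.∈? G) u .proj₁ ≈ᴵ mulTerm (1ℤ , power f (suc e Vec.∷ m)) p
    advance (inj₁ f0∈G) ih = subst (λ r → r ≈ᴵ mulTerm (1ℤ , power f (suc e Vec.∷ m)) p) (sym (present (f zero Sub.∈? G) f0∈G))
      (subst (mulTerm (1ℤ , unit (f zero)) (u .proj₁) ≈ᴵ_) (mulTerm-mulTerm 1ℤ (unit (f zero)) 1ℤ (power f (e Vec.∷ m)) p)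
        (≈ᴵ-mulTerm 1ℤ (unit (f zero)) {u .proj₁} {q} (supp-unit f0∈G) (ih f0∈G)))

  act-toExpr : ∀ p → Supported p → act (toExpr p) 1# .proj₁ ≈ᴵ p
  act-toExpr [] _ = *ₗ-zeroˡ 1#
  act-toExpr ((c , m) ∷ p) (s ∷ sp) = ≈ᴵ-++ {scaleP L c (act (mono m) 1# .proj₁)} {(c , m) ∷ []} {act (toExpr p) 1# .proj₁} {p}
    (≈ᴵ-trans {scaleP L c (act (mono m) 1# .proj₁)} {scaleP L c (mulTerm (1ℤ , power id m) (oneP L))} {(c , m) ∷ []}
      (≈ᴵ-scale c {act (mono m) 1# .proj₁} {mulTerm (1ℤ , power id m) (oneP L)} (act-monoOf id m s 1#))
      (≈ᴵ-reflexive (cong (_∷ []) (cong₂ _,_ (ℤ.*-identityʳ c) (trans (·-oneʳ _) (vec-ext (lookup-power id id m)))))))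
    (act-toExpr p sp)

  toExpr-act : ∀ e v → toExpr (act e v .proj₁) ∼ e ⊗ toExpr (v .proj₁)
  toExpr-act (con a) (p , _) = toExpr-scale a p
  toExpr-act (X g) v@(p , _) = by-cases (g Sub.∈? G)
    where
    by-cases : ∀ d → toExpr (multiplyBy g d v .proj₁) ∼ X g ⊗ toExpr p
    by-cases (yes _) = ∼-trans (toExpr-mulTerm 1ℤ (unit g) p) (⊗-cong (∼-trans (Q.⊗-oneˡ _) (monoOf-unit id g)) ∼-refl)
    by-cases (no g∉G) = ∼-sym (Q.annihilateˡ (Q.vanish (outside g∉G)))
  toExpr-act (e ⊕ e′) v = ∼-trans (toExpr-++ (act e v .proj₁) _) (∼-trans (⊕-cong (toExpr-act e v) (toExpr-act e′ v)) (∼-sym (Q.⊗-distrib _ _ _)))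
  toExpr-act (e ⊗ e′) v = ∼-trans (toExpr-act e (act e′ v)) (∼-trans (⊗-congˡ (toExpr-act e′ v)) (∼-sym (Q.⊗-assoc _ _ _)))

  fromExpr : Expr n → Poly L
  fromExpr e = act e 1# .proj₁

  toExpr-fromExpr : ∀ e → toExpr (fromExpr e) ∼ e
  toExpr-fromExpr e = ∼-trans (toExpr-act e 1#) (∼-trans (⊗-congˡ toExpr-one) (Q.⊗-oneʳ e))

  restrict : Poly L → Poly L
  restrict = keep supp?

  coeff-outside : ∀ {p} → InRing L G p → ∀ m → ¬ Supp m → coeff L p m ≡ 0ℤ
  coeff-outside {p} ring m ¬s with coeff L p m ℤ.≟ 0ℤ
  ... | yes eq = eq
  ... | no c≢0 = ⊥-elim (¬s λ g → case g Sub.∈? G of λ { (yes g∈G) → inj₁ g∈G ; (no g∉G) → inj₂ (ring m c≢0 g g∉G) })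

  restrict-≈ : ∀ {p} → InRing L G p → ∀ m → coeff L (restrict p) m ≡ coeff L p m
  restrict-≈ {p} ring m with supp? m
  ... | yes s = coeff-keep supp? p s
  ... | no ¬s = trans (coeff-dropped supp? p ¬s) (sym (coeff-outside {p} ring m ¬s))

  -- A derivation of `toExpr p ∼ 𝟘` acts as zero on the polynomial quotient, while acting on 1
  -- returns p. For the latter p is first cut down to its terms in the variables of G, which changes
  -- no coefficient.
  ∼𝟘⇒ideal : ∀ {p} → InRing L G p → toExpr p ∼ 𝟘 → InIdeal L G I p
  ∼𝟘⇒ideal {p} ring eq = ideal⇒InIdeal (resp {p′} {p} p′≈p (≈ᴵ⇒ideal (≈ᴵ-trans {p′} {act (toExpr p′) 1# .proj₁} {[]}
      (≈ᴵ-sym {act (toExpr p′) 1# .proj₁} {p′} (act-toExpr p′ (LAll.all-filter (λ t → supp? (t .proj₂)) p)))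
      (≈ᴹ-trans {act (toExpr p′) 1#} {act 𝟘 1#} {0ᴹ} (act-sound kill (∼-trans (toExpr-resp {p′} {p} p′≈p) eq) 1#) (*ₗ-zeroˡ 1#)))))
    where
    p′ = restrict p
    p′≈p : ∀ m → coeff L p′ m ≡ coeff L p m
    p′≈p = restrict-≈ {p} ring
    ≈ᴵ⇒ideal : p′ ≈ᴵ [] → Ideal p′
    ≈ᴵ⇒ideal = subst Ideal (List.++-identityʳ p′)

  private module R = Rank Q.additive

  toExpr-linComb : ∀ {k} (cs : Vec ℤ k) ps → toExpr (linComb L cs ps) ∼ R.lin (lookup cs) (toExpr ∘ lookup ps)
  toExpr-linComb Vec.[] Vec.[] = ∼-refl
  toExpr-linComb (c Vec.∷ cs) (p Vec.∷ ps) = ∼-trans (toExpr-++ (scaleP L c p) _) (⊕-cong (toExpr-scale c p) (toExpr-linComb cs ps))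

  linComb-InRing : ∀ {k} (cs : Vec ℤ k) {ps} → VAll.All (InRing L G) ps → InRing L G (linComb L cs ps)
  linComb-InRing Vec.[] VAll.[] m c≢0 = ⊥-elim (c≢0 refl)
  linComb-InRing (c Vec.∷ cs) {p Vec.∷ ps} (ring VAll.∷ rings) m c≢0 g g∉G with coeff L p m ℤ.≟ 0ℤ
  ... | no p≢0 = ring m p≢0 g g∉G
  ... | yes p≡0 = linComb-InRing cs rings m (λ rest≡0 → c≢0 (trans (coeff-++ (scaleP L c p) _ m)
        (cong₂ ℤ._+_ (trans (coeff-scale c p m) (trans (cong (c ℤ.*_) p≡0) (ℤ.*-zeroʳ c))) rest≡0))) g g∉G

  rank-D : ∀ {r} → IsRankD L G I r → R.HasRank r
  rank-D {r} ((ps , rings , indep) , max) = (toExpr ∘ lookup ps , indep′) , max′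
    where
    indep′ : R.Indep (toExpr ∘ lookup ps)
    indep′ c eq i = trans (sym (Vec.lookup∘tabulate c i)) (VAll.lookup⁺ (indep (tabulate c)
      (∼𝟘⇒ideal {linComb L (tabulate c) ps} (linComb-InRing (tabulate c) rings) (∼-trans (toExpr-linComb (tabulate c) ps)
        (∼-trans (R.sum-cong-≋ (λ j → ⊗-cong (Q.con-reflexive (Vec.lookup∘tabulate c j)) ∼-refl)) eq)))) i)
    max′ : ∀ v → ¬ R.Indep v
    max′ v ind = max qs (VAll.tabulate⁺ {f = fromExpr ∘ v} (λ i → supported⇒InRing (act (v i) 1# .proj₂)))
      λ cs ideal → all-lookup cs (ind (lookup cs) (∼-trans (R.sum-cong-≋ (λ j → ⊗-cong {p = con (lookup cs j)} ∼-refl (∼-sym (lookup-qs j))))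
        (∼-trans (∼-sym (toExpr-linComb cs qs)) (ideal⇒∼𝟘 (linComb L cs qs) ideal))))
      where
      qs : Vec (Poly L) (suc r)
      qs = tabulate (fromExpr ∘ v)
      lookup-qs : ∀ j → toExpr (lookup qs j) ∼ v j
      lookup-qs j = ∼-trans (Q.reflexive (cong toExpr (Vec.lookup∘tabulate (fromExpr ∘ v) j))) (toExpr-fromExpr (v j))
      all-lookup : ∀ {k} (cs : Vec ℤ k) → (∀ i → lookup cs i ≡ 0ℤ) → VAll.All (_≡ 0ℤ) cs
      all-lookup Vec.[] _ = VAll.[]
      all-lookup (c Vec.∷ cs) eq = eq zero VAll.∷ all-lookup cs (eq ∘ suc)

-- The polynomial ring in ε

-- A sequence r stands for Σ_k r_k ∏_{j<k} (x_{f_j} − ε), taken modulo ∏_{j<m} (x_{f_j} − ε) where fs = f_0,…,f_{m−1}.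
module Sequences {n : ℕ} (c : Fin n → ℤ) where

  Seq : Set
  Seq = ℕ → Expr n

  infixl 6 _⊞_
  infixl 7 _•_

  _⊞_ : Seq → Seq → Seq
  (u ⊞ v) k = u k ⊕ v k

  _•_ : ℤ → Seq → Seq
  (a • u) k = con a ⊗ u k

  -- Multiplication by ε; the carry is the coefficient preceding r_0.
  ε : List (Fin n) → Expr n → Seq → Seq
  ε [] a r k = 𝟘
  ε (f ∷ fs) a r zero = X f ⊗ r zero ⊕ neg a
  ε (f ∷ fs) a r (suc k) = ε fs (r zero) (r ∘ suc) k

  opS : List (Fin n) → Fin n → Seq → Seq
  opS fs g r k = X g ⊗ r k ⊕ con (c g) ⊗ ε fs 𝟘 r k

  actS : List (Fin n) → Expr n → Seq → Seq
  actS fs = actOn _⊞_ _•_ (opS fs)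

  -- The value at ε = 0.
  κ : List (Fin n) → Seq → Expr n
  κ [] r = 𝟘
  κ (f ∷ fs) r = r zero ⊕ X f ⊗ κ fs (r ∘ suc)

  -- The coefficient that multiplication by ε pushes beyond the truncation; for an empty list this
  -- is the carry itself.
  lastOr : Expr n → List (Fin n) → Seq → Expr n
  lastOr a [] r = a
  lastOr a (f ∷ fs) r = lastOr (r zero) fs (r ∘ suc)

  lastOr-map : ∀ h a fs r → lastOr (h a) fs (h ∘ r) ≡ h (lastOr a fs r)
  lastOr-map h a [] r = refl
  lastOr-map h a (f ∷ fs) r = lastOr-map h (r zero) fs (r ∘ suc)

  -- Multiplication by x_f - ε, from sequences over `fs` to sequences over `f ∷ fs`.
  shift : Seq → Seq
  shift r zero = 𝟘
  shift r (suc k) = r k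

  δ : Seq
  δ zero = 𝟙
  δ (suc k) = 𝟘

  module Modulo (Z : Expr n → Set) where
    open Quotient Z

    _≈[_]_ : Seq → List (Fin n) → Seq → Set
    u ≈[ fs ] v = ∀ k → k ℕ.< length fs → u k ∼ v k

    ε-cong : ∀ fs {a a′ r r′} → a ∼ a′ → r ≈[ fs ] r′ → ∀ k → ε fs a r k ∼ ε fs a′ r′ k
    ε-cong [] eq eqs k = ∼-refl
    ε-cong (f ∷ fs) eq eqs zero = ⊕-cong (⊗-congˡ (eqs zero ℕ.z<s)) (⊗-congˡ eq)
    ε-cong (f ∷ fs) eq eqs (suc k) = ε-cong fs (eqs zero ℕ.z<s) (λ k lt → eqs (suc k) (ℕ.s<s lt)) k

    ε-+ : ∀ fs a a′ r r′ k → ε fs (a ⊕ a′) (r ⊞ r′) k ∼ ε fs a r k ⊕ ε fs a′ r′ k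
    ε-+ [] a a′ r r′ k = ∼-sym (⊕-zeroˡ 𝟘)
    ε-+ (f ∷ fs) a a′ r r′ zero =
      solve 6 (λ x r r′ m a a′ → x :* (r :+ r′) :+ m :* (a :+ a′) := (x :* r :+ m :* a) :+ (x :* r′ :+ m :* a′)) ∼-refl _ _ _ _ _ _
    ε-+ (f ∷ fs) a a′ r r′ (suc k) = ε-+ fs (r zero) (r′ zero) (r ∘ suc) (r′ ∘ suc) k

    ε-⊗ : ∀ fs p a r k → ε fs (p ⊗ a) (λ k → p ⊗ r k) k ∼ p ⊗ ε fs a r k
    ε-⊗ [] p a r k = ∼-sym (⊗-zeroʳ p)
    ε-⊗ (f ∷ fs) p a r zero = solve 5 (λ x p r m a → x :* (p :* r) :+ m :* (p :* a) := p :* (x :* r :+ m :* a)) ∼-refl _ _ _ _ _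
    ε-⊗ (f ∷ fs) p a r (suc k) = ε-⊗ fs p (r zero) (r ∘ suc) k

    ε₀-+ : ∀ fs r r′ k → ε fs 𝟘 (r ⊞ r′) k ∼ ε fs 𝟘 r k ⊕ ε fs 𝟘 r′ k
    ε₀-+ fs r r′ k = ∼-trans (ε-cong fs (∼-sym (⊕-zeroˡ 𝟘)) (λ _ _ → ∼-refl) k) (ε-+ fs 𝟘 𝟘 r r′ k)

    ε₀-⊗ : ∀ fs p r k → ε fs 𝟘 (λ k → p ⊗ r k) k ∼ p ⊗ ε fs 𝟘 r k
    ε₀-⊗ fs p r k = ∼-trans (ε-cong fs (∼-sym (⊗-zeroʳ p)) (λ _ _ → ∼-refl) k) (ε-⊗ fs p 𝟘 r k)

    ε-zero : ∀ fs {a r} → a ∼ 𝟘 → (∀ k → k ℕ.< length fs → r k ∼ 𝟘) → ∀ k → ε fs a r k ∼ 𝟘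
    ε-zero [] eq eqs k = ∼-refl
    ε-zero (f ∷ fs) eq eqs zero = ⊕-vanish (annihilate _ (eqs zero ℕ.z<s)) (annihilate _ eq)
    ε-zero (f ∷ fs) eq eqs (suc k) = ε-zero fs (eqs zero ℕ.z<s) (λ k lt → eqs (suc k) (ℕ.s<s lt)) k

    opS-cong : ∀ fs g {u v} → u ≈[ fs ] v → opS fs g u ≈[ fs ] opS fs g v
    opS-cong fs g eqs k lt = ⊕-cong (⊗-congˡ (eqs k lt)) (⊗-congˡ (ε-cong fs ∼-refl eqs k))

    opS-+ : ∀ fs g u v k → opS fs g (u ⊞ v) k ∼ opS fs g u k ⊕ opS fs g v k
    opS-+ fs g u v k = ∼-trans (⊕-congˡ (⊗-congˡ (ε₀-+ fs u v k)))
      (solve 6 (λ x c u v eu ev → x :* (u :+ v) :+ c :* (eu :+ ev) := (x :* u :+ c :* eu) :+ (x :* v :+ c :* ev)) ∼-refl _ _ _ _ _ _)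

    opS-⊗ : ∀ fs g p u k → opS fs g (λ k → p ⊗ u k) k ∼ p ⊗ opS fs g u k
    opS-⊗ fs g p u k = ∼-trans (⊕-congˡ (⊗-congˡ (ε₀-⊗ fs p u k)))
      (solve 5 (λ x p u c e → x :* (p :* u) :+ c :* (p :* e) := p :* (x :* u :+ c :* e)) ∼-refl _ _ _ _ _)

    opS-comm : ∀ fs g h r k → opS fs g (opS fs h r) k ∼ opS fs h (opS fs g r) k
    opS-comm fs g h r k = ∼-trans (expand g h)
      (∼-trans (solve 7 (λ xg xh cg ch r e ee → xg :* (xh :* r :+ ch :* e) :+ cg :* (xh :* e :+ ch :* ee)
                                             := xh :* (xg :* r :+ cg :* e) :+ ch :* (xg :* e :+ cg :* ee)) ∼-refl _ _ _ _ _ _ _)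
        (∼-sym (expand h g)))
      where
      expand : ∀ g h → opS fs g (opS fs h r) k ∼
        X g ⊗ (X h ⊗ r k ⊕ con (c h) ⊗ ε fs 𝟘 r k) ⊕ con (c g) ⊗ (X h ⊗ ε fs 𝟘 r k ⊕ con (c h) ⊗ ε fs 𝟘 (ε fs 𝟘 r) k)
      expand g h = ⊕-congˡ (⊗-congˡ (∼-trans (ε₀-+ fs _ _ k) (⊕-cong (ε₀-⊗ fs _ _ k) (ε₀-⊗ fs _ _ k))))

    operators : ∀ fs → Operators n (seqModule additive (length fs))
    operators fs = record
      { op = opS fs
      ; op-cong = opS-cong fs
      ; op-+ = λ g u v k _ → opS-+ fs g u v k
      ; op-* = λ g a v k _ → opS-⊗ fs g (con a) v k
      ; op-comm = λ g h v k _ → opS-comm fs g h v k }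

    module Ops fs = Operators (operators fs)

    κ-cong : ∀ fs {u v} → u ≈[ fs ] v → κ fs u ∼ κ fs v
    κ-cong [] eqs = ∼-refl
    κ-cong (f ∷ fs) eqs = ⊕-cong (eqs zero ℕ.z<s) (⊗-congˡ (κ-cong fs (λ k lt → eqs (suc k) (ℕ.s<s lt))))

    κ-+ : ∀ fs u v → κ fs (u ⊞ v) ∼ κ fs u ⊕ κ fs v
    κ-+ [] u v = ∼-sym (⊕-zeroˡ 𝟘)
    κ-+ (f ∷ fs) u v = ∼-trans (⊕-congˡ (⊗-congˡ (κ-+ fs (u ∘ suc) (v ∘ suc))))
      (solve 5 (λ u v x p q → (u :+ v) :+ x :* (p :+ q) := (u :+ x :* p) :+ (v :+ x :* q)) ∼-refl _ _ _ _ _)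

    κ-⊗ : ∀ fs p u → κ fs (λ k → p ⊗ u k) ∼ p ⊗ κ fs u
    κ-⊗ [] p u = ∼-sym (⊗-zeroʳ p)
    κ-⊗ (f ∷ fs) p u = ∼-trans (⊕-congˡ (⊗-congˡ (κ-⊗ fs p (u ∘ suc))))
      (solve 4 (λ p u x q → p :* u :+ x :* (p :* q) := p :* (u :+ x :* q)) ∼-refl _ _ _ _)

    κ-vanish : ∀ fs {u} → (∀ k → k ℕ.< length fs → u k ∼ 𝟘) → κ fs u ∼ 𝟘
    κ-vanish [] eqs = ∼-refl
    κ-vanish (f ∷ fs) eqs = ⊕-vanish (eqs zero ℕ.z<s) (annihilate _ (κ-vanish fs (λ k lt → eqs (suc k) (ℕ.s<s lt))))

    lastOr-cong : ∀ fs {a a′ r r′} → a ∼ a′ → r ≈[ fs ] r′ → lastOr a fs r ∼ lastOr a′ fs r′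
    lastOr-cong [] eq eqs = eq
    lastOr-cong (f ∷ fs) eq eqs = lastOr-cong fs (eqs zero ℕ.z<s) (λ k lt → eqs (suc k) (ℕ.s<s lt))

    lastOr-vanish : ∀ fs {a r} → a ∼ 𝟘 → (∀ k → k ℕ.< length fs → r k ∼ 𝟘) → lastOr a fs r ∼ 𝟘
    lastOr-vanish [] eq eqs = eq
    lastOr-vanish (f ∷ fs) eq eqs = lastOr-vanish fs (eqs zero ℕ.z<s) (λ k lt → eqs (suc k) (ℕ.s<s lt))

    -- At ε = 0 a multiple of ε vanishes. What is left stems from the carry, which enters with a
    -- minus sign, and from the dropped last term, whose basis element has the value ∏ x_f.
    κ-ε : ∀ fs a r → κ fs (ε fs a r) ⊕ a ∼ prodX fs ⊗ lastOr a fs r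
    κ-ε [] a r = ∼-trans (⊕-zeroˡ a) (∼-sym (⊗-oneˡ a))
    κ-ε (f ∷ fs) a r = begin
      X f ⊗ r₀ ⊕ neg a ⊕ X f ⊗ κε ⊕ a         ≈⟨ solve 5 (λ x r m k a → x :* r :+ m :+ x :* k :+ a := x :* (k :+ r) :+ (m :+ a)) ∼-refl _ _ _ _ _ ⟩
      X f ⊗ (κε ⊕ r₀) ⊕ (neg a ⊕ a)           ≈⟨ ⊕-cong (⊗-congˡ (κ-ε fs r₀ (r ∘ suc))) (neg-⊕ a) ⟩
      X f ⊗ (prodX fs ⊗ last) ⊕ 𝟘             ≈⟨ ⊕-zeroʳ _ ⟩
      X f ⊗ (prodX fs ⊗ last)                 ≈⟨ ⊗-assoc _ _ _ ⟨
      X f ⊗ prodX fs ⊗ last                   ∎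
      where
      open import Relation.Binary.Reasoning.Setoid setoid
      r₀ = r zero
      κε = κ fs (ε fs r₀ (r ∘ suc))
      last = lastOr r₀ fs (r ∘ suc)

    κ-op : ∀ fs g r → κ fs (opS fs g r) ∼ X g ⊗ κ fs r ⊕ con (c g) ⊗ (prodX fs ⊗ lastOr 𝟘 fs r)
    κ-op fs g r = ∼-trans (κ-+ fs _ _) (⊕-cong (κ-⊗ fs (X g) r)
      (∼-trans (κ-⊗ fs _ _) (⊗-congˡ (∼-trans (∼-sym (⊕-zeroʳ _)) (κ-ε fs 𝟘 r)))))

    -- The entry 0 in front is exactly the initial carry of the shorter list, so ε acts behind it as
    -- it does over `fs`.
    act-shift : ∀ f fs p r → actS (f ∷ fs) p (shift r) ≈[ f ∷ fs ] shift (actS fs p r)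
    act-shift f fs (con a) r zero _ = ⊗-zeroʳ _
    act-shift f fs (con a) r (suc k) _ = ∼-refl
    act-shift f fs (X g) r zero _ = ⊕-vanish (⊗-zeroʳ _) (annihilate _ (⊕-vanish (⊗-zeroʳ _) (⊗-zeroʳ _)))
    act-shift f fs (X g) r (suc k) _ = ∼-refl
    act-shift f fs (p ⊕ q) r zero lt = ⊕-vanish (act-shift f fs p r zero lt) (act-shift f fs q r zero lt)
    act-shift f fs (p ⊕ q) r (suc k) lt = ⊕-cong (act-shift f fs p r (suc k) lt) (act-shift f fs q r (suc k) lt)
    act-shift f fs (p ⊗ q) r k lt = ∼-trans (Ops.act-cong (f ∷ fs) p (act-shift f fs q r) k lt) (act-shift f fs p (actS fs q r) k lt)

    neg-neg : ∀ p → neg (neg p) ∼ p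
    neg-neg p = ∼-trans (∼-sym (⊗-assoc _ _ p)) (∼-trans (⊗-cong (∼-sym (con-* -1ℤ -1ℤ)) ∼-refl) (⊗-oneˡ p))

    -- Since c f = -1, the variable acts as x_f - ε, and f heads the list: the two multiples of x_f
    -- cancel in the first position, leaving a multiple of the first basis factor.
    opS-head : ∀ f fs v → c f ≡ -1ℤ → opS (f ∷ fs) f v ≈[ f ∷ fs ] shift (opS (f ∷ fs) f v ∘ suc)
    opS-head f fs v cf zero _ rewrite cf = ∼-trans
      (⊕-congˡ (⊗-congˡ (∼-trans (⊕-congˡ (⊗-zeroʳ _)) (⊕-zeroʳ _)))) (⊕-neg _)
    opS-head f fs v cf (suc k) _ = ∼-refl

    -- The head factor, applied innermost by commutativity, produces a shift, and the remaining
    -- product acts on it over the shorter list. In the end no position is left.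
    act-prodX-kill : ∀ fs → (∀ {f} → f LMem.∈ fs → c f ≡ -1ℤ) → ∀ v k → k ℕ.< length fs → actS fs (prodX fs) v k ∼ 𝟘
    act-prodX-kill (f ∷ fs) cs v k lt = begin
      opS (f ∷ fs) f (actS (f ∷ fs) (prodX fs) v) k           ≈⟨ Ops.op-act (f ∷ fs) f (prodX fs) v k lt ⟩
      actS (f ∷ fs) (prodX fs) (opS (f ∷ fs) f v) k           ≈⟨ Ops.act-cong (f ∷ fs) (prodX fs) (opS-head f fs v (cs (here refl))) k lt ⟩
      actS (f ∷ fs) (prodX fs) (shift (opS (f ∷ fs) f v ∘ suc)) k ≈⟨ act-shift f fs (prodX fs) _ k lt ⟩
      shift (actS fs (prodX fs) (opS (f ∷ fs) f v ∘ suc)) k   ≈⟨ shifted k lt ⟩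
      𝟘 ∎
      where
      open import Relation.Binary.Reasoning.Setoid setoid
      shifted : ∀ k → k ℕ.< suc (length fs) → shift (actS fs (prodX fs) (opS (f ∷ fs) f v ∘ suc)) k ∼ 𝟘
      shifted zero _ = ∼-refl
      shifted (suc k) (ℕ.s≤s lt) = act-prodX-kill fs (cs ∘ there) _ k lt

    opS-δ : ∀ f fs → c f ≡ -1ℤ → opS (f ∷ fs) f δ ≈[ f ∷ fs ] shift δ
    opS-δ f fs cf zero lt = opS-head f fs δ cf zero lt
    opS-δ f (f′ ∷ fs) cf (suc zero) lt rewrite cf = ∼-trans (⊕-cong (⊗-zeroʳ _)
      (⊗-congˡ (⊕-cong (⊗-zeroʳ _) ∼-refl))) (∼-trans (⊕-zeroˡ _) (∼-trans (⊗-congˡ (⊕-zeroˡ _)) (neg-neg 𝟙)))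
    opS-δ f (f′ ∷ fs) cf (suc (suc k)) lt = ⊕-vanish (⊗-zeroʳ _) (annihilate _ (ε-zero fs ∼-refl (λ _ _ → ∼-refl) k))
    opS-δ f [] cf (suc k) (ℕ.s≤s ())

    module Section (b : Fin n) (c-b : c b ≡ 1ℤ) where

      σ : Fin n → Expr n
      σ g = X g ⊕ con (ℤ.- c g) ⊗ X b

      -- Evaluation at ε = x_b with coefficients transported by `σ`. A factor x_f - ε with c f = -1
      -- becomes σ(x_f) - x_b = x_f, which is why `κ` appears.
      Φ : List (Fin n) → Seq → Expr n
      Φ fs r = κ fs (bind σ ∘ r)

      cancel : ∀ a p → con a ⊗ p ⊕ con (ℤ.- a) ⊗ p ∼ 𝟘
      cancel a p = ∼-trans (∼-sym (⊗-distrib _ _ p)) (∼-trans (⊗-cong (∼-trans (∼-sym (con-+ a (ℤ.- a)))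
        (con-reflexive (ℤ.+-inverseʳ a))) ∼-refl) (⊗-zeroˡ p))

      module _ (Xb∼𝟘 : X b ∼ 𝟘) where

        -- As x_b = 0 in the base ring, x_b acts as ε alone; the multiple of it subtracted in `σ`
        -- cancels the multiple of ε in the action of x_g.
        act-σ : ∀ fs p r k → k ℕ.< length fs → actS fs (bind σ p) r k ∼ p ⊗ r k
        act-σ fs (con a) r k lt = ∼-refl
        act-σ fs (X g) r k lt = begin
          X g ⊗ r k ⊕ con (c g) ⊗ e ⊕ con (ℤ.- c g) ⊗ (X b ⊗ r k ⊕ con (c b) ⊗ e)
            ≈⟨ ⊕-congˡ (⊗-congˡ (∼-trans (⊕-cong (annihilateˡ Xb∼𝟘)
                 (∼-trans (⊗-cong (con-reflexive c-b) ∼-refl) (⊗-oneˡ e))) (⊕-zeroˡ e))) ⟩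
          X g ⊗ r k ⊕ con (c g) ⊗ e ⊕ con (ℤ.- c g) ⊗ e     ≈⟨ ⊕-assoc _ _ _ ⟩
          X g ⊗ r k ⊕ (con (c g) ⊗ e ⊕ con (ℤ.- c g) ⊗ e)   ≈⟨ ⊕-congˡ (cancel (c g) e) ⟩
          X g ⊗ r k ⊕ 𝟘                                     ≈⟨ ⊕-zeroʳ _ ⟩
          X g ⊗ r k                                         ∎
          where
          open import Relation.Binary.Reasoning.Setoid setoid
          e = ε fs 𝟘 r k
        act-σ fs (p ⊕ q) r k lt = ∼-trans (⊕-cong (act-σ fs p r k lt) (act-σ fs q r k lt)) (∼-sym (⊗-distrib _ _ _))
        act-σ fs (p ⊗ q) r k lt = ∼-trans (act-σ fs p _ k lt) (∼-trans (⊗-congˡ (act-σ fs q r k lt)) (∼-sym (⊗-assoc _ _ _)))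

        -- Horner's rule: by `act-σ` a transported coefficient acts by plain multiplication, and
        -- every further factor x_f turns the unit sequence into a shift.
        act-Φ : ∀ fs → (∀ {f} → f LMem.∈ fs → c f ≡ -1ℤ) → ∀ r → actS fs (Φ fs r) δ ≈[ fs ] r
        act-Φ (f ∷ fs) cs r k lt = ∼-trans (⊕-cong (act-σ (f ∷ fs) (r zero) δ k lt) inner) (recombine k lt)
          where
          open import Relation.Binary.Reasoning.Setoid setoid
          inner : opS (f ∷ fs) f (actS (f ∷ fs) (Φ fs (r ∘ suc)) δ) k ∼ shift (actS fs (Φ fs (r ∘ suc)) δ) k
          inner = begin
            opS (f ∷ fs) f (actS (f ∷ fs) (Φ fs (r ∘ suc)) δ) k  ≈⟨ Ops.op-act (f ∷ fs) f (Φ fs (r ∘ suc)) δ k lt ⟩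
            actS (f ∷ fs) (Φ fs (r ∘ suc)) (opS (f ∷ fs) f δ) k  ≈⟨ Ops.act-cong (f ∷ fs) (Φ fs (r ∘ suc)) (opS-δ f fs (cs (here refl))) k lt ⟩
            actS (f ∷ fs) (Φ fs (r ∘ suc)) (shift δ) k           ≈⟨ act-shift f fs (Φ fs (r ∘ suc)) δ k lt ⟩
            shift (actS fs (Φ fs (r ∘ suc)) δ) k                 ∎
          recombine : ∀ k → k ℕ.< suc (length fs) → r zero ⊗ δ k ⊕ shift (actS fs (Φ fs (r ∘ suc)) δ) k ∼ r k
          recombine zero _ = ∼-trans (⊕-zeroʳ _) (⊗-oneʳ _)
          recombine (suc k) (ℕ.s≤s lt) = ∼-trans (⊕-cong (⊗-zeroʳ _) (act-Φ fs (cs ∘ there) (r ∘ suc) k lt)) (⊕-zeroˡ _)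

      -- Evaluation turns ε into x_b except for the carry and the term lost to truncation. The lost
      -- basis element becomes ∏ x_f, so its term disappears wherever that product vanishes.
      Φ-ε : ∀ fs → (∀ {f} → f LMem.∈ fs → c f ≡ -1ℤ) → ∀ a r →
            Φ fs (ε fs a r) ⊕ bind σ a ∼ X b ⊗ Φ fs r ⊕ prodX fs ⊗ bind σ (lastOr a fs r)
      Φ-ε [] cs a r = ⊕-cong (∼-sym (⊗-zeroʳ _)) (∼-sym (⊗-oneˡ _))
      Φ-ε (f ∷ fs) cs a r rewrite cs (here refl) = begin
        (X f ⊕ 𝟙 ⊗ X b) ⊗ r₀ ⊕ neg a′ ⊕ X f ⊗ Φε ⊕ a′
          ≈⟨ ⊕-cong (⊕-cong (⊕-cong (⊗-cong (⊕-congˡ (⊗-oneˡ _)) ∼-refl) ∼-refl) ∼-refl) ∼-refl ⟩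
        (X f ⊕ X b) ⊗ r₀ ⊕ neg a′ ⊕ X f ⊗ Φε ⊕ a′
          ≈⟨ solve 6 (λ x y r m p a → (x :+ y) :* r :+ m :+ x :* p :+ a := x :* (p :+ r) :+ y :* r :+ (m :+ a)) ∼-refl _ _ _ _ _ _ ⟩
        X f ⊗ (Φε ⊕ r₀) ⊕ X b ⊗ r₀ ⊕ (neg a′ ⊕ a′)
          ≈⟨ ⊕-cong (⊕-cong (⊗-congˡ (Φ-ε fs (cs ∘ there) (r zero) (r ∘ suc))) ∼-refl) (neg-⊕ a′) ⟩
        X f ⊗ (X b ⊗ Φr ⊕ prodX fs ⊗ last) ⊕ X b ⊗ r₀ ⊕ 𝟘
          ≈⟨ ⊕-zeroʳ _ ⟩
        X f ⊗ (X b ⊗ Φr ⊕ prodX fs ⊗ last) ⊕ X b ⊗ r₀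
          ≈⟨ solve 6 (λ x y p q l r → x :* (y :* p :+ q :* l) :+ y :* r := y :* (r :+ x :* p) :+ x :* q :* l) ∼-refl _ _ _ _ _ _ ⟩
        X b ⊗ (r₀ ⊕ X f ⊗ Φr) ⊕ X f ⊗ prodX fs ⊗ last ∎
        where
        open import Relation.Binary.Reasoning.Setoid setoid
        r₀ = bind σ (r zero)
        a′ = bind σ a
        Φr = Φ fs (r ∘ suc)
        Φε = Φ fs (ε fs (r zero) (r ∘ suc))
        last = bind σ (lastOr (r zero) fs (r ∘ suc))

      module _ (fs : List (Fin n)) (cs : ∀ {f} → f LMem.∈ fs → c f ≡ -1ℤ) (prod∼𝟘 : prodX fs ∼ 𝟘) where

        Φ-op : ∀ g r → Φ fs (opS fs g r) ∼ X g ⊗ Φ fs r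
        Φ-op g r = begin
          κ fs (λ k → σ g ⊗ bind σ (r k) ⊕ con (c g) ⊗ bind σ (ε fs 𝟘 r k))
            ≈⟨ ∼-trans (κ-+ fs _ _) (⊕-cong (κ-⊗ fs _ _) (κ-⊗ fs _ _)) ⟩
          σ g ⊗ Φ fs r ⊕ con (c g) ⊗ Φ fs (ε fs 𝟘 r)
            ≈⟨ ⊕-congˡ (⊗-congˡ Φ-ε₀) ⟩
          σ g ⊗ Φ fs r ⊕ con (c g) ⊗ (X b ⊗ Φ fs r)
            ≈⟨ solve 5 (λ x m y p c → (x :+ m :* y) :* p :+ c :* (y :* p) := x :* p :+ (c :* (y :* p) :+ m :* (y :* p))) ∼-refl _ _ _ _ _ ⟩
          X g ⊗ Φ fs r ⊕ (con (c g) ⊗ (X b ⊗ Φ fs r) ⊕ con (ℤ.- c g) ⊗ (X b ⊗ Φ fs r))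
            ≈⟨ ∼-trans (⊕-congˡ (cancel (c g) _)) (⊕-zeroʳ _) ⟩
          X g ⊗ Φ fs r ∎
          where
          open import Relation.Binary.Reasoning.Setoid setoid
          Φ-ε₀ : Φ fs (ε fs 𝟘 r) ∼ X b ⊗ Φ fs r
          Φ-ε₀ = ∼-trans (∼-sym (⊕-zeroʳ _)) (∼-trans (Φ-ε fs cs 𝟘 r)
            (∼-trans (⊕-congˡ (annihilateˡ prod∼𝟘)) (⊕-zeroʳ _)))

        Φ-act : ∀ p r → Φ fs (actS fs p r) ∼ p ⊗ Φ fs r
        Φ-act (con a) r = κ-⊗ fs _ _
        Φ-act (X g) r = Φ-op g r
        Φ-act (p ⊕ q) r = ∼-trans (κ-+ fs _ _) (∼-trans (⊕-cong (Φ-act p r) (Φ-act q r)) (∼-sym (⊗-distrib _ _ _)))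
        Φ-act (p ⊗ q) r = ∼-trans (Φ-act p _) (∼-trans (⊗-congˡ (Φ-act q r)) (∼-sym (⊗-assoc _ _ _)))

-- The blow-up

sumℤ : ∀ {n} → (Fin n → ℤ) → List (Fin n) → ℤ
sumℤ w = foldr (λ g s → w g ℤ.+ s) 0ℤ

sumℤ-zero : ∀ {n} {w : Fin n → ℤ} → (∀ g → w g ≡ 0ℤ) → ∀ gs → sumℤ w gs ≡ 0ℤ
sumℤ-zero eq [] = refl
sumℤ-zero eq (g ∷ gs) rewrite eq g | sumℤ-zero eq gs = refl

sumℤ-cong : ∀ {n} {w w′ : Fin n → ℤ} → (∀ g → w g ≡ w′ g) → ∀ gs → sumℤ w gs ≡ sumℤ w′ gs
sumℤ-cong eq [] = refl
sumℤ-cong eq (g ∷ gs) = cong₂ ℤ._+_ (eq g) (sumℤ-cong eq gs)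

sumℤ-+ : ∀ {n} (w w′ : Fin n → ℤ) gs → sumℤ (λ g → w g ℤ.+ w′ g) gs ≡ sumℤ w gs ℤ.+ sumℤ w′ gs
sumℤ-+ w w′ [] = refl
sumℤ-+ w w′ (g ∷ gs) rewrite sumℤ-+ w w′ gs = interchange (w g) (w′ g) (sumℤ w gs) (sumℤ w′ gs)
  where
  open import Algebra.Properties.CommutativeSemigroup ℤ.+-commutativeSemigroup using (interchange)

single : ∀ {n} → ℤ → Fin n → Fin n → ℤ
single v g h = if does (h Fin.≟ g) then v else 0ℤ

single-≡ : ∀ {n} v (g : Fin n) → single v g g ≡ v
single-≡ v g rewrite dec-true (g Fin.≟ g) refl = refl

single-≢ : ∀ {n} v {g h : Fin n} → h ≢ g → single v g h ≡ 0ℤ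
single-≢ v {g} {h} h≢g rewrite dec-false (h Fin.≟ g) h≢g = refl

sumℤ-single : ∀ {n} v (g : Fin n) gs → Unique gs → g LMem.∈ gs → sumℤ (single v g) gs ≡ v
sumℤ-single v g (h ∷ gs) (h∉gs ∷ _) (here refl) =
  trans (cong₂ ℤ._+_ (single-≡ v g) (absent gs h∉gs)) (ℤ.+-identityʳ v)
  where
  absent : ∀ gs → LAll.All (g ≢_) gs → sumℤ (single v g) gs ≡ 0ℤ
  absent [] [] = refl
  absent (h ∷ gs) (g≢h ∷ rest) = trans (cong₂ ℤ._+_ (single-≢ v (g≢h ∘ sym)) (absent gs rest)) refl
sumℤ-single v g (h ∷ gs) (h∉gs ∷ unique) (there g∈gs) =
  trans (cong₂ ℤ._+_ (single-≢ v (LAll.lookup h∉gs g∈gs)) (sumℤ-single v g gs unique g∈gs)) (ℤ.+-identityˡ v)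

module Blowup (L : FinLattice) (atomic : Atomic L) (G₁ : Subset (FinLattice.n L)) (b : Fin (FinLattice.n L))
  (b∉G₁ : b ∉ G₁) (building₁ : IsBuildingSet L G₁) (building₂ : IsBuildingSet L (G₁ ∪ ⁅ b ⁆))
  (F : Subset (FinLattice.n L)) (F-factors : ∀ g → (g ∈ F → MaxBelow L G₁ b g) × (MaxBelow L G₁ b g → g ∈ F)) where

  open Lattice L
  private
    module B₁ = Building G₁ building₁
    module B₂ = Building (G₁ ∪ ⁅ b ⁆) building₂

  G₂ : Subset n
  G₂ = G₁ ∪ ⁅ b ⁆

  G₁⊆G₂ : G₁ ⊆ G₂
  G₁⊆G₂ = Sub.p⊆p∪q ⁅ b ⁆

  b∈G₂ : b ∈ G₂
  b∈G₂ = Sub.q⊆p∪q G₁ ⁅ b ⁆ (Sub.x∈⁅x⁆ b)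

  G₂-cases : ∀ {g} → g ∈ G₂ → g ∈ G₁ ⊎ g ≡ b
  G₂-cases g∈G₂ with Sub.x∈p∪q⁻ G₁ ⁅ b ⁆ g∈G₂
  ... | inj₁ g∈G₁ = inj₁ g∈G₁
  ... | inj₂ g∈b = inj₂ (Sub.x∈⁅y⁆⇒x≡y b g∈b)

  G₂∖b : ∀ {g} → g ∈ G₂ → g ≢ b → g ∈ G₁
  G₂∖b g∈G₂ g≢b = [ id , ⊥-elim ∘ g≢b ]′ (G₂-cases g∈G₂)

  b≢0̂ : b ≢ 0̂
  b≢0̂ = B₂.∈G⇒≢0̂ b∈G₂

  G₁⇒≢b : ∀ {g} → g ∈ G₁ → g ≢ b
  G₁⇒≢b g∈G₁ refl = b∉G₁ g∈G₁

  maxBelow : ∀ {f} → f ∈ F → MaxBelow L G₁ b f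
  maxBelow {f} = F-factors f .proj₁

  F⊆G₁ : F ⊆ G₁
  F⊆G₁ f∈F = maxBelow f∈F .proj₁

  F⊏b : ∀ {f} → f ∈ F → f ⊏ b
  F⊏b f∈F = maxBelow f∈F .proj₂ .proj₁ , G₁⇒≢b (F⊆G₁ f∈F)

  factor : ∀ {y} → y ∈ G₁ → y ≤ b → ∃[ f ] f ∈ F × y ≤ f
  factor y∈G₁ y≤b = let f , mb , y≤f = maximal-above G₁ y∈G₁ y≤b in f , F-factors f .proj₂ mb , y≤f

  factor-unique : ∀ {a f f′} → a ≢ 0̂ → a ≤ f → a ≤ f′ → f ∈ F → f′ ∈ F → f ≡ f′
  factor-unique a≢0̂ a≤f a≤f′ f∈F f′∈F = B₁.factor-unique a≢0̂ a≤f a≤f′ (maxBelow f∈F) (maxBelow f′∈F)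

  F-antichain : ∀ {f f′} → f ∈ F → f′ ∈ F → f ≤ f′ → f ≡ f′
  F-antichain f∈F f′∈F f≤f′ = sym (maxBelow f∈F .proj₂ .proj₂ _ (F⊆G₁ f′∈F) (F⊏b f′∈F .proj₁) f≤f′)

  -- By atomicity b is the join of the atoms below it; these belong to G₁, and each lies below some
  -- factor.
  F-covers : Covers (_∈ F) b
  F-covers z ub = atomic b .proj₂ z λ a (atom , a≤b) →
    let f , f∈F , a≤f = factor (B₁.atom∈G atom) a≤b in ≤-trans a≤f (ub f f∈F)

  above-factor : ∀ {f B} → f ∈ F → f ⊏ B → B ∈ G₁ → ¬ (B ≤ b)
  above-factor f∈F (f≤B , f≢B) B∈G₁ B≤b = f≢B (sym (maxBelow f∈F .proj₂ .proj₂ _ B∈G₁ B≤b f≤B))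

  -- B and b share the nonzero element f, so B ∨ b ∈ G₂. It differs from b, since B ≤ b would
  -- contradict the maximality of f.
  join-b : ∀ {f B} → f ∈ F → f ⊏ B → B ∈ G₁ → (B ⊔ b) ∈ G₁
  join-b {f} {B} f∈F f⊏B B∈G₁ =
    G₂∖b (B₂.join-closed (B₁.∈G⇒≢0̂ (F⊆G₁ f∈F)) (f⊏B .proj₁) (F⊏b f∈F .proj₁) (G₁⊆G₂ B∈G₁) b∈G₂)
         (λ eq → above-factor f∈F f⊏B B∈G₁ (≤-trans (x≤x∨y B b) (≤-reflexive eq)))

  -- The multiplicity of ε in the image of x_g: x_b becomes ε, and x_f becomes x_f - ε for f ∈ F,
  -- which undoes x_f ↦ x_f + x_b.
  c : Fin n → ℤ
  c g = if does (g Fin.≟ b) then 1ℤ else if does (g Sub.∈? F) then -1ℤ else 0ℤ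

  c-b : c b ≡ 1ℤ
  c-b rewrite dec-true (b Fin.≟ b) refl = refl

  c-F : ∀ {f} → f ∈ F → c f ≡ -1ℤ
  c-F {f} f∈F rewrite dec-false (f Fin.≟ b) (G₁⇒≢b (F⊆G₁ f∈F)) | dec-true (f Sub.∈? F) f∈F = refl

  c-0 : ∀ {g} → g ≢ b → g ∉ F → c g ≡ 0ℤ
  c-0 {g} g≢b g∉F rewrite dec-false (g Fin.≟ b) g≢b | dec-false (g Sub.∈? F) g∉F = refl

  data Kind (g : Fin n) : Set where
    exceptional : g ≡ b → Kind g
    centre      : g ∈ F → Kind g
    ordinary    : g ≢ b → g ∉ F → Kind g

  kind : ∀ g → Kind g
  kind g with g Fin.≟ b | g Sub.∈? F
  ... | yes g≡b | _ = exceptional g≡b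
  ... | no _ | yes g∈F = centre g∈F
  ... | no g≢b | no g∉F = ordinary g≢b g∉F

  -- The contribution of x_C to the coefficient of ε in the linear form of a over G₂.
  weight : Fin n → Fin n → ℤ
  weight a C = if Vec.lookup G₂ C ∧ does (a ≤? C) then c C else 0ℤ

  weight-in : ∀ {a C} → C ∈ G₂ → a ≤ C → weight a C ≡ c C
  weight-in {a} {C} C∈G₂ a≤C rewrite lookup-∈ C∈G₂ | dec-true (a ≤? C) a≤C = refl

  weight-∉ : ∀ {a C} → C ∉ G₂ → weight a C ≡ 0ℤ
  weight-∉ {a} {C} C∉G₂ rewrite lookup-∉ C∉G₂ = refl

  weight-≰ : ∀ {a C} → ¬ (a ≤ C) → weight a C ≡ 0ℤ
  weight-≰ {a} {C} a≰C rewrite dec-false (a ≤? C) a≰C with Vec.lookup G₂ C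
  ... | true = refl
  ... | false = refl

  weight-ordinary : ∀ {a C} → C ≢ b → C ∉ F → weight a C ≡ 0ℤ
  weight-ordinary {a} {C} C≢b C∉F = by-cases (C Sub.∈? G₂) (a ≤? C)
    where
    by-cases : Dec (C ∈ G₂) → Dec (a ≤ C) → weight a C ≡ 0ℤ
    by-cases (no C∉G₂) _ = weight-∉ {a} C∉G₂
    by-cases (yes _) (no a≰C) = weight-≰ a≰C
    by-cases (yes C∈G₂) (yes a≤C) = trans (weight-in C∈G₂ a≤C) (c-0 C≢b C∉F)

  -- An atom below b lies below exactly one element of F, whose weight cancels that of b.
  weights-balance : ∀ {a} → IsAtom L a → sumℤ (weight a) (allFin n) ≡ 0ℤ
  weights-balance {a} atom with a ≤? b
  ... | no a≰b = sumℤ-zero zero-weight (allFin n)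
    where
    zero-weight : ∀ C → weight a C ≡ 0ℤ
    zero-weight C with kind C
    ... | exceptional refl = weight-≰ a≰b
    ... | centre C∈F = weight-≰ (λ a≤C → a≰b (≤-trans a≤C (F⊏b C∈F .proj₁)))
    ... | ordinary C≢b C∉F = weight-ordinary C≢b C∉F
  ... | yes a≤b = balance (factor (B₁.atom∈G atom) a≤b)
    where
    balance : ∃[ f ] f ∈ F × a ≤ f → sumℤ (weight a) (allFin n) ≡ 0ℤ
    balance (f , f∈F , a≤f) = trans (sumℤ-cong two-terms (allFin n))
      (trans (sumℤ-+ (single 1ℤ b) (single -1ℤ f) (allFin n))
        (cong₂ ℤ._+_ (sumℤ-single 1ℤ b (allFin n) (Unique.allFin⁺ n) (LMem.∈-allFin b))
                     (sumℤ-single -1ℤ f (allFin n) (Unique.allFin⁺ n) (LMem.∈-allFin f))))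
      where
      f≢b : f ≢ b
      f≢b = G₁⇒≢b (F⊆G₁ f∈F)
      two-terms : ∀ C → weight a C ≡ single 1ℤ b C ℤ.+ single -1ℤ f C
      two-terms C with kind C
      ... | exceptional refl = trans (trans (weight-in b∈G₂ a≤b) c-b)
              (sym (cong₂ ℤ._+_ (single-≡ 1ℤ b) (single-≢ -1ℤ (f≢b ∘ sym))))
      ... | ordinary C≢b C∉F = trans (weight-ordinary C≢b C∉F)
              (sym (cong₂ ℤ._+_ (single-≢ 1ℤ C≢b) (single-≢ -1ℤ {f} {C} λ { refl → C∉F f∈F })))
      ... | centre C∈F with C Fin.≟ f
      ...   | yes refl = trans (trans (weight-in (G₁⊆G₂ (F⊆G₁ C∈F)) a≤f) (c-F C∈F))
                (sym (cong₂ ℤ._+_ (single-≢ 1ℤ f≢b) refl))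
      ...   | no C≢f = trans (weight-≰ (λ a≤C → C≢f (factor-unique (B₁.∈G⇒≢0̂ (B₁.atom∈G atom)) a≤C a≤f C∈F f∈F)))
                (sym (cong₂ ℤ._+_ (single-≢ 1ℤ (G₁⇒≢b (F⊆G₁ C∈F))) refl))

  open Sequences c

  module _ {Z : Expr n → Set} where
    open Quotient Z
    open Modulo Z
    open Section b c-b

    sumOf-con : ∀ w p gs → sumOf (λ C → con (ℤ.- w C) ⊗ p) gs ∼ con (ℤ.- sumℤ w gs) ⊗ p
    sumOf-con w p [] = ∼-sym (⊗-zeroˡ p)
    sumOf-con w p (g ∷ gs) = ∼-trans (⊕-congˡ (sumOf-con w p gs)) (∼-trans (∼-sym (⊗-distrib _ _ p))
      (⊗-cong (∼-trans (∼-sym (con-+ _ _)) (con-reflexive (sym (ℤ.neg-distrib-+ (w g) (sumℤ w gs))))) ∼-refl))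

    bind-sumOf : ∀ t gs → bind σ (sumOf t gs) ≡ sumOf (bind σ ∘ t) gs
    bind-sumOf t [] = refl
    bind-sumOf t (g ∷ gs) = cong (bind σ (t g) ⊕_) (bind-sumOf t gs)

    σ-above : ∀ a C → bind σ (above G₁ a C) ∼ above G₂ a C ⊕ con (ℤ.- weight a C) ⊗ X b
    σ-above a C = by-cases (C Fin.≟ b) (C Sub.∈? G₁) (a ≤? C)
      where
      trivial : above G₁ a C ≡ 𝟘 → above G₂ a C ≡ 𝟘 → weight a C ≡ 0ℤ →
                bind σ (above G₁ a C) ∼ above G₂ a C ⊕ con (ℤ.- weight a C) ⊗ X b
      trivial eq₁ eq₂ eq rewrite eq₁ | eq₂ | eq = ∼-sym (⊕-vanish ∼-refl (⊗-zeroˡ _))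
      by-cases : Dec (C ≡ b) → Dec (C ∈ G₁) → Dec (a ≤ C) → bind σ (above G₁ a C) ∼ above G₂ a C ⊕ con (ℤ.- weight a C) ⊗ X b
      by-cases _ _ (no a≰C) = trivial (above-≰ {G₁} a≰C) (above-≰ {G₂} a≰C) (weight-≰ a≰C)
      by-cases (yes refl) _ (yes a≤b) rewrite above-∉ {B = a} b∉G₁ | above-in b∈G₂ a≤b | weight-in b∈G₂ a≤b | c-b = ∼-sym (⊕-neg _)
      by-cases (no C≢b) (no C∉G₁) _ = trivial (above-∉ C∉G₁) (above-∉ (λ C∈ → C∉G₁ (G₂∖b C∈ C≢b))) (weight-∉ {a} (λ C∈ → C∉G₁ (G₂∖b C∈ C≢b)))
      by-cases (no C≢b) (yes C∈G₁) (yes a≤C) rewrite above-in C∈G₁ a≤C | above-in (G₁⊆G₂ C∈G₁) a≤C | weight-in (G₁⊆G₂ C∈G₁) a≤C = ∼-refl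

    -- The multiples of x_b introduced by `σ`, together with the new term x_b if a ≤ b, add up to
    -- the total weight, which is zero.
    σ-sumUp : ∀ {a} → IsAtom L a → bind σ (sumUp G₁ a) ∼ sumUp G₂ a
    σ-sumUp {a} atom = ∼-trans (reflexive (bind-sumOf _ (allFin n))) (∼-trans (sumOf-cong (σ-above a) (allFin n))
      (∼-trans (sumOf-⊕ _ _ (allFin n)) (∼-trans (⊕-congˡ (∼-trans (sumOf-con (weight a) (X b) (allFin n))
        (annihilateˡ (con-reflexive (cong ℤ.-_ (weights-balance atom)))))) (⊕-zeroʳ _))))

    act-above : ∀ fs a C v k → actS fs (above G₂ a C) v k ∼ above G₂ a C ⊗ v k ⊕ con (weight a C) ⊗ ε fs 𝟘 v k
    act-above fs a C v k = by-cases (C Sub.∈? G₂) (a ≤? C)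
      where
      trivial : above G₂ a C ≡ 𝟘 → weight a C ≡ 0ℤ → actS fs (above G₂ a C) v k ∼ above G₂ a C ⊗ v k ⊕ con (weight a C) ⊗ ε fs 𝟘 v k
      trivial eq₂ eq rewrite eq₂ | eq = ∼-sym (∼-trans (⊕-congˡ (⊗-zeroˡ _)) (⊕-zeroʳ _))
      by-cases : Dec (C ∈ G₂) → Dec (a ≤ C) → actS fs (above G₂ a C) v k ∼ above G₂ a C ⊗ v k ⊕ con (weight a C) ⊗ ε fs 𝟘 v k
      by-cases (no C∉G₂) _ = trivial (above-∉ C∉G₂) (weight-∉ {a} C∉G₂)
      by-cases (yes _) (no a≰C) = trivial (above-≰ {G₂} a≰C) (weight-≰ a≰C)
      by-cases (yes C∈G₂) (yes a≤C) rewrite above-in C∈G₂ a≤C | weight-in C∈G₂ a≤C = ∼-refl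

    act-sumOf : ∀ fs a gs v k → actS fs (sumOf (above G₂ a) gs) v k ∼ sumOf (above G₂ a) gs ⊗ v k ⊕ con (sumℤ (weight a) gs) ⊗ ε fs 𝟘 v k
    act-sumOf fs a [] v k = ∼-sym (∼-trans (⊕-congˡ (⊗-zeroˡ _)) (⊕-zeroʳ _))
    act-sumOf fs a (g ∷ gs) v k = ∼-trans (⊕-cong (act-above fs a g v k) (act-sumOf fs a gs v k))
      (∼-trans (solve 6 (λ p w q s v e → (p :* v :+ w :* e) :+ (q :* v :+ s :* e) := (p :+ q) :* v :+ (w :+ s) :* e) ∼-refl _ _ _ _ _ _)
        (⊕-congˡ (⊗-cong (∼-sym (con-+ _ _)) ∼-refl)))

  module Base (I : Subset n) where
    open D G₁ I public
    open Modulo (Relator G₁ I) public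

    Xb∼𝟘 : X b ∼ 𝟘
    Xb∼𝟘 = vanish (outside b∉G₁)

    sumUp-G₂ : ∀ a → sumUp G₂ a ∼ sumUp G₁ a
    sumUp-G₂ a = sumOf-cong termwise (allFin n)
      where
      termwise : ∀ C → above G₂ a C ∼ above G₁ a C
      termwise C = by-cases (a ≤? C) (C Fin.≟ b) (C Sub.∈? G₁)
        where
        by-cases : Dec (a ≤ C) → Dec (C ≡ b) → Dec (C ∈ G₁) → above G₂ a C ∼ above G₁ a C
        by-cases (no a≰C) _ _ = reflexive (trans (above-≰ {G₂} a≰C) (sym (above-≰ {G₁} a≰C)))
        by-cases (yes a≤b) (yes refl) _ = ∼-trans (reflexive (above-in b∈G₂ a≤b)) (∼-trans Xb∼𝟘 (reflexive (sym (above-∉ b∉G₁))))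
        by-cases (yes a≤C) (no C≢b) (yes C∈G₁) = reflexive (trans (above-in (G₁⊆G₂ C∈G₁) a≤C) (sym (above-in C∈G₁ a≤C)))
        by-cases (yes a≤C) (no C≢b) (no C∉G₁) = reflexive (trans (above-∉ (λ C∈ → C∉G₁ (G₂∖b C∈ C≢b))) (sym (above-∉ C∉G₁)))

    kill-outside : ∀ fs {g} → g ∉ G₂ → ∀ v k → actS fs (X g) v k ∼ 𝟘
    kill-outside fs {g} g∉G₂ v k = ⊕-vanish
      (annihilateˡ (vanish (outside (g∉G₂ ∘ G₁⊆G₂))))
      (annihilateˡ (con-reflexive (c-0 (λ { refl → g∉G₂ b∈G₂ }) (g∉G₂ ∘ G₁⊆G₂ ∘ F⊆G₁))))

    kill-linear : ∀ fs {a} → IsAtom L a → ∀ v k → actS fs (sumUp G₂ a) v k ∼ 𝟘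
    kill-linear fs {a} atom v k = ∼-trans (act-sumOf fs a (allFin n) v k) (⊕-vanish
      (annihilateˡ (∼-trans (sumUp-G₂ a) (vanish (linear atom))))
      (annihilateˡ (con-reflexive (weights-balance atom))))

    act-ordinary : ∀ fs hs → (∀ {h} → h LMem.∈ hs → h ≢ b × h ∉ F) → ∀ v k → actS fs (prodX hs) v k ∼ prodX hs ⊗ v k
    act-ordinary fs [] _ v k = ∼-refl
    act-ordinary fs (h ∷ hs) ordinary-hs v k = ∼-trans
      (⊕-cong (⊗-congˡ (act-ordinary fs hs (ordinary-hs ∘ there) v k))
              (annihilateˡ (con-reflexive (let h≢b , h∉F = ordinary-hs (here refl) in c-0 h≢b h∉F))))
      (∼-trans (⊕-zeroʳ _) (∼-sym (⊗-assoc _ _ _)))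

  -- Instantiated with I = S ∪ F, J = S ∪ {b} and with I = J = S. An element of F in the source may
  -- be traded for b in the target, which lies above it.
  module Pullback (I J : Subset n) (I⇒J : ∀ {y} → y ∈ I → y ∈ J ⊎ (y ∈ F × b ∈ J)) where
    private module I = D G₁ I
    open D G₂ J
    open Modulo.Section (Relator G₂ J) b c-b

    -- The product of the σ(x_h) is expanded factor by factor, `ks` recording the choice of h or of
    -- b. If b comes into play and some f ∈ F lies strictly below B, the chosen monomial is a
    -- circuit with join B ∨ b ∈ G₁, where b dominates the elements it replaces. Otherwise nothing
    -- below B was replaced and B is still the join.
    σ-circuit : ∀ hs ks {B} → B ∈ G₁ →
      (∀ {h} → h LMem.∈ hs → h ∈ G₁ × h ⊏ B) →
      (∀ {h} → h LMem.∈ ks → (h ∈ G₁ × h ⊏ B) ⊎ (h ≡ b × ∃[ f ] f ∈ F × f ⊏ B)) →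
      Circuit hs ks I B →
      prodX ks ⊗ bind σ (prodX hs) ∼ 𝟘
    σ-circuit [] ks {B} B∈G₁ _ ks-ok cov = ∼-trans (⊗-oneʳ _)
      (by-cases (memberOf Fin._≟_ b ks ⊎-dec (b Sub.∈? J)) (Fin.any? (λ f → (f Sub.∈? F) ×-dec (f ⊏? B))))
      where
      ks⊆G₂ : ∀ {h} → h LMem.∈ ks → h ∈ G₂
      ks⊆G₂ h∈ with ks-ok h∈
      ... | inj₁ (h∈G₁ , _) = G₁⊆G₂ h∈G₁
      ... | inj₂ (refl , _) = b∈G₂
      plain : ¬ b LMem.∈ ks → (∀ {y} → y ∈ I → y ⊏ B → y ∈ J) → prodX ks ∼ 𝟘
      plain b∉ks I⇒J′ = circuit-list ks ks⊆G₂ (G₁⊆G₂ B∈G₁)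
        (λ h∈ → [ proj₂ , (λ { (refl , _) → ⊥-elim (b∉ks h∈) }) ]′ (ks-ok h∈))
        (covers-⊆ (λ { (inj₂ (inj₁ y∈)) → inj₁ y∈
                     ; (inj₂ (inj₂ (y∈I , y⊏B))) → inj₂ (I⇒J′ y∈I y⊏B , y⊏B) }) cov)
      by-cases : Dec (b LMem.∈ ks ⊎ b ∈ J) → Dec (∃[ f ] f ∈ F × f ⊏ B) → prodX ks ∼ 𝟘
      by-cases (no b∉) _ = plain (b∉ ∘ inj₁) (λ y∈I _ → [ id , (λ (_ , b∈J) → ⊥-elim (b∉ (inj₂ b∈J))) ]′ (I⇒J y∈I))
      by-cases (yes _) (no none) = plain (λ b∈ks → [ (λ (b∈G₁ , _) → b∉G₁ b∈G₁) , none ∘ proj₂ ]′ (ks-ok b∈ks))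
        (λ y∈I y⊏B → [ id , (λ (y∈F , _) → ⊥-elim (none (_ , y∈F , y⊏B))) ]′ (I⇒J y∈I))
      by-cases (yes b∈) (yes (f , f∈F , f⊏B)) = circuit-list ks ks⊆G₂ (G₁⊆G₂ (join-b f∈F f⊏B B∈G₁))
        (λ h∈ → [ (λ (_ , h⊏B) → ⊏-≤-trans h⊏B (x≤x∨y B b)) , (λ { (refl , _) → b⊏B⊔b }) ]′ (ks-ok h∈))
        (λ z ub → let b≤z = [ (λ b∈ks → ub b (inj₁ b∈ks)) , (λ b∈J → ub b (inj₂ (b∈J , b⊏B⊔b))) ]′ b∈ in
          ∨-least (cov z λ { y (inj₂ (inj₁ y∈)) → ub y (inj₁ y∈)
                           ; y (inj₂ (inj₂ (y∈I , y⊏B))) → [ (λ y∈J → ub y (inj₂ (y∈J , ⊏-≤-trans y⊏B (x≤x∨y B b))))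
                                                         , (λ (y∈F , _) → ≤-trans (F⊏b y∈F .proj₁) b≤z) ]′ (I⇒J y∈I) }) b≤z)
        where
        b⊏B⊔b : b ⊏ (B ⊔ b)
        b⊏B⊔b = y≤x∨y B b , λ eq → above-factor f∈F f⊏B B∈G₁ (≤-trans (x≤x∨y B b) (≤-reflexive (sym eq)))
    σ-circuit (h ∷ hs) ks {B} B∈G₁ hs-ok ks-ok cov = begin
      prodX ks ⊗ ((X h ⊕ con (ℤ.- c h) ⊗ X b) ⊗ bind σ (prodX hs))
        ≈⟨ solve 5 (λ k x m y p → k :* ((x :+ m :* y) :* p) := x :* k :* p :+ m :* (y :* k :* p)) ∼-refl _ _ _ _ _ ⟩
      prodX (h ∷ ks) ⊗ bind σ (prodX hs) ⊕ con (ℤ.- c h) ⊗ (prodX (b ∷ ks) ⊗ bind σ (prodX hs))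
        ≈⟨ ⊕-vanish keep replace ⟩
      𝟘 ∎
      where
      open import Relation.Binary.Reasoning.Setoid setoid
      h∈G₁ = hs-ok (here refl) .proj₁
      h⊏B = hs-ok (here refl) .proj₂
      keep : prodX (h ∷ ks) ⊗ bind σ (prodX hs) ∼ 𝟘
      keep = σ-circuit hs (h ∷ ks) B∈G₁ (hs-ok ∘ there)
        (λ { (here refl) → inj₁ (h∈G₁ , h⊏B) ; (there k∈) → ks-ok k∈ })
        (circuit-move cov)
      replace : con (ℤ.- c h) ⊗ (prodX (b ∷ ks) ⊗ bind σ (prodX hs)) ∼ 𝟘
      replace with kind h
      ... | exceptional refl = ⊥-elim (b∉G₁ h∈G₁)
      ... | ordinary h≢b h∉F = annihilateˡ (con-reflexive (cong ℤ.-_ (c-0 h≢b h∉F)))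
      ... | centre h∈F = annihilate _ (σ-circuit hs (b ∷ ks) B∈G₁ (hs-ok ∘ there)
        (λ { (here refl) → inj₂ (refl , h , h∈F , h⊏B) ; (there k∈) → ks-ok k∈ })
        (covers-mono (λ { (inj₁ (here refl)) → b , F⊏b h∈F .proj₁ , inj₂ (inj₁ (here refl))
                        ; {y} (inj₁ (there y∈)) → y , ≤-refl , inj₁ y∈
                        ; {y} (inj₂ (inj₁ y∈)) → y , ≤-refl , inj₂ (inj₁ (there y∈))
                        ; {y} (inj₂ (inj₂ i)) → y , ≤-refl , inj₂ (inj₂ i) }) cov))

    σ-sound : ∀ {p q} → p I.∼ q → bind σ p ∼ bind σ q
    σ-sound = bind-sound σ kill
      where
      kill : ∀ {p} → Relator G₁ I p → bind σ p ∼ 𝟘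
      kill (outside {g} g∉G₁) with kind g
      ... | exceptional refl = ∼-trans (⊕-congˡ (⊗-cong (con-reflexive (cong ℤ.-_ c-b)) ∼-refl)) (⊕-neg _)
      ... | centre g∈F = ⊥-elim (g∉G₁ (F⊆G₁ g∈F))
      ... | ordinary g≢b g∉F = ⊕-vanish (vanish (outside (λ g∈G₂ → g∉G₁ (G₂∖b g∈G₂ g≢b))))
              (annihilateˡ (con-reflexive (cong ℤ.-_ (c-0 g≢b g∉F))))
      kill (linear atom) = ∼-trans (σ-sumUp atom) (vanish (linear atom))
      kill (circuit H {B} H⊆G₁ B∈G₁ H⊏B cov) = ∼-trans (∼-sym (⊗-oneˡ _))
        (σ-circuit (elems H) [] B∈G₁ (λ h∈ → H⊆G₁ (∈-elems⁻ h∈) , H⊏B _ (∈-elems⁻ h∈)) (λ ())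
          (circuit-start cov))

-- Additive structure of the blown-up rings

module BlowupRank (L : FinLattice) (atomic : Atomic L) (G₁ : Subset (FinLattice.n L)) (b : Fin (FinLattice.n L))
  (b∉G₁ : b ∉ G₁) (building₁ : IsBuildingSet L G₁) (building₂ : IsBuildingSet L (G₁ ∪ ⁅ b ⁆))
  (F : Subset (FinLattice.n L)) (F-factors : ∀ g → (g ∈ F → MaxBelow L G₁ b g) × (MaxBelow L G₁ b g → g ∈ F))
  (S : Subset (FinLattice.n L)) (S⊆G₁ : S ⊆ G₁)
  (f₀ : Fin (FinLattice.n L)) (fs₀ : List (Fin (FinLattice.n L))) (fs≡ : elems (F ─ S) ≡ f₀ ∷ fs₀) where

  open Lattice L
  open Blowup L atomic G₁ b b∉G₁ building₁ building₂ F F-factors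
  open Sequences c

  private
    module B₁ = Building G₁ building₁
    module R₁ = Base S
    module R′ = Base (S ∪ F)
    module R₂ = D G₂ S
    module E = D G₂ (S ∪ ⁅ b ⁆)

  fs : List (Fin n)
  fs = f₀ ∷ fs₀

  ∈-fs⁻ : ∀ {f} → f LMem.∈ fs → f ∈ F × f ∉ S
  ∈-fs⁻ f∈ = ∈-─⁻ (∈-elems⁻ (subst (_ LMem.∈_) (sym fs≡) f∈))

  ∈-fs⁺ : ∀ {f} → f ∈ F → f ∉ S → f LMem.∈ fs
  ∈-fs⁺ f∈F f∉S = subst (_ LMem.∈_) fs≡ (∈-elems⁺ (Sub.x∈p∧x∉q⇒x∈p─q f∈F f∉S))

  fs-unique : Unique fs
  fs-unique = subst Unique fs≡ (elems-unique (F ─ S))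

  c-fs : ∀ {f} → f LMem.∈ fs → c f ≡ -1ℤ
  c-fs f∈ = c-F (∈-fs⁻ f∈ .proj₁)

  R₁⇒R′ : ∀ {p q} → p R₁.∼ q → p R′.∼ q
  R₁⇒R′ = enlarge (Sub.p⊆p∪q F)

  -- The elements of F ∖ S are added to S one at a time; each passage costs one factor x_f by
  -- `restrict-multiply`.
  centre-multiply : ∀ {p q} → p R′.∼ q → prodX fs ⊗ p R₁.∼ prodX fs ⊗ q
  centre-multiply = go fs S (F⊆G₁ ∘ proj₁ ∘ ∈-fs⁻)
    (λ y∈ → [ inj₁ , (λ y∈F → case (_ Sub.∈? S) of λ { (yes y∈S) → inj₁ y∈S ; (no y∉S) → inj₂ (∈-fs⁺ y∈F y∉S) }) ]′ (Sub.x∈p∪q⁻ S F y∈))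
    where
    go : ∀ gs I → (∀ {g} → g LMem.∈ gs → g ∈ G₁) → (∀ {y} → y ∈ S ∪ F → y ∈ I ⊎ y LMem.∈ gs) →
         ∀ {p q} → p R′.∼ q → D._∼_ G₁ I (prodX gs ⊗ p) (prodX gs ⊗ q)
    go [] I gs⊆G₁ ⊆I eq = ⊗-congˡ (enlarge (λ y∈ → [ id , (λ ()) ]′ (⊆I y∈)) eq)
      where open D G₁ I
    go (g ∷ gs) I gs⊆G₁ ⊆I {p} {q} eq = ∼-trans (⊗-assoc _ _ _) (∼-trans
      (restrict-multiply {I = I} g (gs⊆G₁ (here refl)) id (go gs (I ∪ ⁅ g ⁆) (gs⊆G₁ ∘ there)
        (λ y∈ → case ⊆I y∈ of λ { (inj₁ y∈I) → inj₁ (Sub.p⊆p∪q ⁅ g ⁆ y∈I)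
                                ; (inj₂ (here refl)) → inj₁ (Sub.q⊆p∪q I ⁅ g ⁆ (Sub.x∈⁅x⁆ g))
                                ; (inj₂ (there y∈gs)) → inj₂ y∈gs }) eq))
      (∼-sym (⊗-assoc _ _ _)))
      where open D G₁ I

  centre-kill : ∀ {p} → p R′.∼ 𝟘 → prodX fs ⊗ p R₁.∼ 𝟘
  centre-kill eq = R₁.∼-trans (centre-multiply eq) (R₁.⊗-zeroʳ _)

  -- Over S ∪ F a factor from F is available from the nested set anyway, and b is bounded by the
  -- join of F, all of which lies strictly below B.
  circuit-drop : ∀ {h hs ks J B} → h ∈ F ⊎ h ≡ b → h ⊏ B → J ⊆ S ∪ F → Circuit (h ∷ hs) ks J B → Circuit hs ks (S ∪ F) B
  circuit-drop {h} {B = B} dropped h⊏B J⊆ cov z ub = cov z λ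
    { y (inj₁ (here refl)) → below dropped
    ; y (inj₁ (there y∈)) → ub y (inj₁ y∈)
    ; y (inj₂ (inj₁ y∈)) → ub y (inj₂ (inj₁ y∈))
    ; y (inj₂ (inj₂ (y∈J , y⊏B))) → ub y (inj₂ (inj₂ (J⊆ y∈J , y⊏B))) }
    where
    below : h ∈ F ⊎ h ≡ b → h ≤ z
    below (inj₁ h∈F) = ub h (inj₂ (inj₂ (Sub.q⊆p∪q S F h∈F , h⊏B)))
    below (inj₂ refl) = F-covers z (λ f f∈F → ub f (inj₂ (inj₂ (Sub.q⊆p∪q S F f∈F , ⊏-≤-trans (F⊏b f∈F) (h⊏B .proj₁)))))

  -- Each factor x_h + c_h ε is expanded. Its first summand moves h to `ks`; the second exists only
  -- for h ∈ F or h = b, whose share of the join is supplied by F. Either way a circuit of R′ with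
  -- join B remains.
  exceptional-circuit : ∀ hs ks {B} → B ∈ G₁ →
    (∀ {h} → h LMem.∈ hs → h ∈ G₂ × h ⊏ B) → (∀ {h} → h LMem.∈ ks → h ∈ G₁ × h ⊏ B) →
    Circuit hs ks (S ∪ F) B →
    ∀ v k → k ℕ.< length fs → prodX ks ⊗ actS fs (prodX hs) v k R′.∼ 𝟘
  exceptional-circuit [] ks B∈G₁ _ ks-ok cov v k lt = R′.annihilateˡ
    (R′.circuit-list ks (proj₁ ∘ ks-ok) B∈G₁ (proj₂ ∘ ks-ok) (covers-⊆ (λ { (inj₂ i) → i }) cov))
  exceptional-circuit (h ∷ hs) ks {B} B∈G₁ hs-ok ks-ok cov v k lt =
    R′.∼-trans (R′.solve 5 (λ p x u c e → p R′.:* (x R′.:* u R′.:+ c R′.:* e) R′.:= x R′.:* p R′.:* u R′.:+ c R′.:* (p R′.:* e)) R′.∼-refl _ _ _ _ _)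
      (R′.⊕-vanish keep drop)
    where
    u = actS fs (prodX hs) v
    h⊏B = hs-ok (here refl) .proj₂
    keep : prodX (h ∷ ks) ⊗ u k R′.∼ 𝟘
    keep with G₂-cases (hs-ok (here refl) .proj₁)
    ... | inj₂ refl = R′.annihilateˡ (R′.annihilateˡ R′.Xb∼𝟘)
    ... | inj₁ h∈G₁ = exceptional-circuit hs (h ∷ ks) B∈G₁ (hs-ok ∘ there)
            (λ { (here refl) → h∈G₁ , h⊏B ; (there k∈) → ks-ok k∈ })
            (circuit-move cov) v k lt
    dropped : Circuit hs ks (S ∪ F) B → con (c h) ⊗ (prodX ks ⊗ ε fs 𝟘 u k) R′.∼ 𝟘
    dropped cov′ = R′.annihilate _ (R′.∼-trans (R′.∼-sym (R′.ε₀-⊗ fs (prodX ks) u k))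
      (R′.ε-zero fs R′.∼-refl (exceptional-circuit hs ks B∈G₁ (hs-ok ∘ there) ks-ok cov′ v) k))
    drop : con (c h) ⊗ (prodX ks ⊗ ε fs 𝟘 u k) R′.∼ 𝟘
    drop with kind h
    ... | ordinary h≢b h∉F = R′.annihilateˡ (R′.con-reflexive (c-0 h≢b h∉F))
    ... | centre h∈F = dropped (circuit-drop (inj₁ h∈F) h⊏B id cov)
    ... | exceptional h≡b = dropped (circuit-drop (inj₂ h≡b) h⊏B id cov)

  -- At ε = 0 the ε-summand of a factor survives only as ∏ x_f times a last coordinate. By
  -- `centre-kill` it is enough that this coordinate, multiplied by `prodX ks`, vanishes in R′,
  -- which `exceptional-circuit` provides.
  total-circuit : ∀ hs ks {B} → B ∈ G₁ →
    (∀ {h} → h LMem.∈ hs → h ∈ G₂ × h ⊏ B) → (∀ {h} → h LMem.∈ ks → h ∈ G₁ × h ⊏ B) →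
    Circuit hs ks S B →
    ∀ v → prodX ks ⊗ κ fs (actS fs (prodX hs) v) R₁.∼ 𝟘
  total-circuit [] ks B∈G₁ _ ks-ok cov v = R₁.annihilateˡ
    (R₁.circuit-list ks (proj₁ ∘ ks-ok) B∈G₁ (proj₂ ∘ ks-ok) (covers-⊆ (λ { (inj₂ i) → i }) cov))
  total-circuit (h ∷ hs) ks {B} B∈G₁ hs-ok ks-ok cov v =
    R₁.∼-trans (R₁.⊗-congˡ (R₁.κ-op fs h u)) (R₁.∼-trans
      (R₁.solve 6 (λ p x u c q l → p R₁.:* (x R₁.:* u R₁.:+ c R₁.:* (q R₁.:* l)) R₁.:= x R₁.:* p R₁.:* u R₁.:+ c R₁.:* (q R₁.:* (p R₁.:* l))) R₁.∼-refl _ _ _ _ _ _)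
      (R₁.⊕-vanish keep drop))
    where
    u = actS fs (prodX hs) v
    h⊏B = hs-ok (here refl) .proj₂
    keep : prodX (h ∷ ks) ⊗ κ fs u R₁.∼ 𝟘
    keep with G₂-cases (hs-ok (here refl) .proj₁)
    ... | inj₂ refl = R₁.annihilateˡ (R₁.annihilateˡ R₁.Xb∼𝟘)
    ... | inj₁ h∈G₁ = total-circuit hs (h ∷ ks) B∈G₁ (hs-ok ∘ there)
            (λ { (here refl) → h∈G₁ , h⊏B ; (there k∈) → ks-ok k∈ })
            (circuit-move cov) v
    dropped : Circuit hs ks (S ∪ F) B →
              con (c h) ⊗ (prodX fs ⊗ (prodX ks ⊗ lastOr 𝟘 fs u)) R₁.∼ 𝟘
    dropped cov′ = R₁.annihilate _ (centre-kill (R′.∼-trans (R′.reflexive (sym (lastOr-map (prodX ks ⊗_) 𝟘 fs u)))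
      (R′.lastOr-vanish fs (R′.⊗-zeroʳ (prodX ks)) (exceptional-circuit hs ks B∈G₁ (hs-ok ∘ there) ks-ok cov′ v))))
    drop : con (c h) ⊗ (prodX fs ⊗ (prodX ks ⊗ lastOr 𝟘 fs u)) R₁.∼ 𝟘
    drop with kind h
    ... | ordinary h≢b h∉F = R₁.annihilateˡ (R₁.con-reflexive (c-0 h≢b h∉F))
    ... | centre h∈F = dropped (circuit-drop (inj₁ h∈F) h⊏B (Sub.p⊆p∪q F) cov)
    ... | exceptional h≡b = dropped (circuit-drop (inj₂ h≡b) h⊏B (Sub.p⊆p∪q F) cov)

  -- A circuit with join b splits along [0̂,b] = ∏_{f ∈ F} [0̂,f]: either some factor f is already the join of a
  -- circuit of G₁, or all of F ∖ S occurs.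
  centre-circuit : ∀ H → H ⊆ G₂ → (∀ h → h ∈ H → h ⊏ b) → Covers (λ y → y ∈ H ⊎ (y ∈ S × y ⊏ b)) b →
                   ∀ v k → k ℕ.< length fs → actS fs (prodX (elems H)) v k R₁.∼ 𝟘
  centre-circuit H H⊆G₂ H⊏b cov with Fin.any? (λ f → (f Sub.∈? F) ×-dec ¬? (f Sub.∈? H) ×-dec ¬? (f Sub.∈? S))
  ... | no none = R₁.Ops.act-prodX-vanish fs (elems H) fs-unique fs⊆H (R₁.act-prodX-kill fs c-fs)
    where
    fs⊆H : ∀ {f} → f LMem.∈ fs → f LMem.∈ elems H
    fs⊆H {f} f∈ with f Sub.∈? H
    ... | yes f∈H = ∈-elems⁺ f∈H
    ... | no f∉H = ⊥-elim (none (f , ∈-fs⁻ f∈ .proj₁ , f∉H , ∈-fs⁻ f∈ .proj₂))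
  -- As f is not in H, the part of H below f lies strictly below f and meets F nowhere, so its
  -- variables act without ε.
  ... | yes (f , f∈F , f∉H , f∉S) = R₁.Ops.act-prodX-vanish fs (elems H) part-unique (λ h∈ → LMem.∈-filter⁻ (_≤? f) h∈ .proj₁)
      (λ v k _ → R₁.∼-trans (R₁.act-ordinary fs part part-ordinary v k) (R₁.annihilateˡ part∼𝟘))
    where
    part : List (Fin n)
    part = filter (_≤? f) (elems H)
    part-unique : Unique part
    part-unique = Unique.filter⁺ (_≤? f) (elems-unique H)
    part⁻ : ∀ {h} → h LMem.∈ part → h ∈ H × h ≤ f
    part⁻ h∈ = let h∈H , h≤f = LMem.∈-filter⁻ (_≤? f) {xs = elems H} h∈ in ∈-elems⁻ h∈H , h≤f
    H⊆G₁ : ∀ {h} → h ∈ H → h ∈ G₁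
    H⊆G₁ h∈H = G₂∖b (H⊆G₂ h∈H) (H⊏b _ h∈H .proj₂)
    part⊏f : ∀ {h} → h LMem.∈ part → h ⊏ f
    part⊏f h∈ = part⁻ h∈ .proj₂ , λ { refl → f∉H (part⁻ h∈ .proj₁) }
    part-ordinary : ∀ {h} → h LMem.∈ part → h ≢ b × h ∉ F
    part-ordinary h∈ = H⊏b _ (part⁻ h∈ .proj₁) .proj₂ , λ h∈F → part⊏f h∈ .proj₂ (F-antichain h∈F f∈F (part⁻ h∈ .proj₂))
    below-b : ∀ {y} → y ∈ H ⊎ (y ∈ S × y ⊏ b) → ∃[ f′ ] MaxBelow L G₁ b f′ × y ≤ f′
    below-b (inj₁ y∈H) = let f′ , f′∈F , y≤f′ = factor (H⊆G₁ y∈H) (H⊏b _ y∈H .proj₁) in f′ , maxBelow f′∈F , y≤f′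
    below-b (inj₂ (y∈S , y⊏b)) = let f′ , f′∈F , y≤f′ = factor (S⊆G₁ y∈S) (y⊏b .proj₁) in f′ , maxBelow f′∈F , y≤f′
    part∼𝟘 : prodX part R₁.∼ 𝟘
    part∼𝟘 = R₁.circuit-list part (H⊆G₁ ∘ proj₁ ∘ part⁻) (F⊆G₁ f∈F) part⊏f
      (covers-⊆ (λ { (inj₁ y∈H , y≤f) → inj₁ (LMem.∈-filter⁺ (_≤? f) (∈-elems⁺ y∈H) y≤f)
                   ; (inj₂ (y∈S , _) , y≤f) → inj₂ (y∈S , y≤f , λ { refl → f∉S y∈S }) })
        (B₁.covers-factor b≢0̂ (maxBelow f∈F) below-b cov))

  -- F is a circuit with join b, its members in S being supplied by I. This is the relation that
  -- truncation of sequences models.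
  centre-product : ∀ I → S ⊆ I → D._∼_ G₂ I (prodX fs) 𝟘
  centre-product I S⊆I = D.circuit-list G₂ I fs (G₁⊆G₂ ∘ F⊆G₁ ∘ proj₁ ∘ ∈-fs⁻) b∈G₂ (F⊏b ∘ proj₁ ∘ ∈-fs⁻)
    (covers-⊆ (λ {f} f∈F → (case (f Sub.∈? S) of λ { (yes f∈S) → inj₂ (S⊆I f∈S , F⊏b f∈F)
                                                               ; (no f∉S) → inj₁ (∈-fs⁺ f∈F f∉S) })) F-covers)

  module ExceptionalDivisor where
    open Pullback (S ∪ F) (S ∪ ⁅ b ⁆)
      (λ y∈ → [ inj₁ ∘ Sub.p⊆p∪q ⁅ b ⁆ , (λ y∈F → inj₂ (y∈F , Sub.q⊆p∪q S ⁅ b ⁆ (Sub.x∈⁅x⁆ b))) ]′ (Sub.x∈p∪q⁻ S F y∈))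
      public
    private module Sec = Modulo.Section (Relator G₂ (S ∪ ⁅ b ⁆)) b c-b
    private module Sec′ = R′.Section b c-b

    kill : ∀ {p} → Relator G₂ (S ∪ ⁅ b ⁆) p → ∀ v k → k ℕ.< length fs → actS fs p v k R′.∼ 𝟘
    kill (outside g∉G₂) v k _ = R′.kill-outside fs g∉G₂ v k
    kill (linear atom) v k _ = R′.kill-linear fs atom v k
    kill (circuit H {B} H⊆G₂ B∈G₂ H⊏B cov) v k lt with G₂-cases B∈G₂
    -- With join b, the member b of S ∪ {b} is not strictly below the join, so this already is a
    -- circuit over S.
    ... | inj₂ refl = R₁⇒R′ (centre-circuit H H⊆G₂ H⊏B
            (covers-⊆ (λ { (inj₁ y∈H) → inj₁ y∈H
                         ; (inj₂ (y∈ , y⊏b)) → inj₂ ([ id , ⊥-elim ∘ y⊏b .proj₂ ∘ Sub.x∈⁅y⁆⇒x≡y b ]′ (Sub.x∈p∪q⁻ S ⁅ b ⁆ y∈) , y⊏b) }) cov)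
            v k lt)
    ... | inj₁ B∈G₁ = R′.∼-trans (R′.∼-sym (R′.⊗-oneˡ _)) (exceptional-circuit (elems H) [] B∈G₁
            (λ h∈ → H⊆G₂ (∈-elems⁻ h∈) , H⊏B _ (∈-elems⁻ h∈)) (λ ())
            (λ z ub → cov z λ { y (inj₁ y∈H) → ub y (inj₁ (∈-elems⁺ y∈H)) ; y (inj₂ (y∈ , y⊏B)) → part z ub y⊏B (Sub.x∈p∪q⁻ S ⁅ b ⁆ y∈) })
            v k lt)
      where
      part : ∀ z → (∀ y → y LMem.∈ elems H ⊎ y LMem.∈ [] ⊎ (y ∈ S ∪ F × y ⊏ B) → y ≤ z) → ∀ {y} → y ⊏ B → y ∈ S ⊎ y ∈ ⁅ b ⁆ → y ≤ z
      part z ub y⊏B (inj₁ y∈S) = ub _ (inj₂ (inj₂ (Sub.p⊆p∪q F y∈S , y⊏B)))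
      part z ub y⊏B (inj₂ y∈b) with Sub.x∈⁅y⁆⇒x≡y b y∈b
      ... | refl = F-covers z (λ f f∈F → ub f (inj₂ (inj₂ (Sub.q⊆p∪q S F f∈F , ⊏-≤-trans (F⊏b f∈F) (y⊏B .proj₁)))))

    module O = R′.Ops fs

    -- The image of p is p acting on the unit sequence. Injectivity comes from the left inverse
    -- `Sec.Φ`, which turns the action back into multiplication and `δ` into 1.
    Ψ : E.additive ↪ seqModule R′.additive (length fs)
    Ψ = record
      { to = λ p → actS fs p δ
      ; cong-to = λ eq → O.act-sound kill eq δ
      ; to-+ = λ _ _ _ _ → R′.∼-refl
      ; to-* = λ _ _ _ _ → R′.∼-refl
      ; reflect = λ p eq → E.∼-trans (E.∼-sym (unit p)) (Φ-vanish eq) }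
      where
      Φ-vanish : ∀ {u} → (∀ k → k ℕ.< length fs → u k R′.∼ 𝟘) → Sec.Φ fs u E.∼ 𝟘
      Φ-vanish eq = Modulo.κ-vanish (Relator G₂ (S ∪ ⁅ b ⁆)) fs (λ k lt → σ-sound (eq k lt))
      Φδ : Sec.Φ fs δ E.∼ 𝟙
      Φδ = E.∼-trans (E.⊕-congˡ (E.annihilate _ (Modulo.κ-vanish (Relator G₂ (S ∪ ⁅ b ⁆)) fs₀ (λ _ _ → E.∼-refl)))) (E.⊕-zeroʳ _)
      unit : ∀ p → Sec.Φ fs (actS fs p δ) E.∼ p
      unit p = E.∼-trans (Sec.Φ-act fs c-fs (centre-product (S ∪ ⁅ b ⁆) (Sub.p⊆p∪q ⁅ b ⁆)) p δ)
        (E.∼-trans (E.⊗-congˡ Φδ) (E.⊗-oneʳ p))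

    -- Well defined on R′ by `σ-sound`. Here acting on `δ` is the left inverse, by `act-Φ`.
    Φ : seqModule R′.additive (length fs) ↪ E.additive
    Φ = record
      { to = Sec.Φ fs
      ; cong-to = λ eq → Modulo.κ-cong (Relator G₂ (S ∪ ⁅ b ⁆)) fs (λ k lt → σ-sound (eq k lt))
      ; to-+ = λ u v → Modulo.κ-+ (Relator G₂ (S ∪ ⁅ b ⁆)) fs (bind Sec.σ ∘ u) (bind Sec.σ ∘ v)
      ; to-* = λ a v → Modulo.κ-⊗ (Relator G₂ (S ∪ ⁅ b ⁆)) fs (con a) (bind Sec.σ ∘ v)
      ; reflect = λ r eq k lt → R′.∼-trans (R′.∼-sym (Sec′.act-Φ R′.Xb∼𝟘 fs c-fs r k lt))
          (R′.∼-trans (O.act-sound kill eq δ k lt) (R′.⊗-zeroˡ _)) }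

    rank : ∀ {r} → Rank.HasRank R′.additive r → Rank.HasRank E.additive (length fs ℕ.* r)
    rank ρ = rank-transport Φ Ψ (rank-seq R′.additive (length fs) ρ)

  module TotalSpace where
    open Pullback S S inj₁ public
    private
      module Sec = Modulo.Section (Relator G₂ S) b c-b
      module Sec₁ = R₁.Section b c-b
      module M₂ = Modulo (Relator G₂ S)

    infix 4 _≈_
    -- Equality in R[ε] / (ε ker(R → R′), ∏ (x_f - ε)). If all coordinates of a difference lie in
    -- the kernel, then ε annihilates them, each basis element multiplies its coordinate as ∏_{j<k}
    -- x_{f_j}, and the difference equals its value at ε = 0. Only this value has to be tested in R.
    _≈_ : Seq → Seq → Set
    u ≈ v = κ fs u R₁.∼ κ fs v × (∀ k → k ℕ.< length fs → u k R′.∼ v k)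

    pointwise : ∀ {u v} → (∀ k → k ℕ.< length fs → u k R₁.∼ v k) → u ≈ v
    pointwise eq = R₁.κ-cong fs eq , λ k lt → R₁⇒R′ (eq k lt)

    +-cong : ∀ {u u′ v v′} → u ≈ u′ → v ≈ v′ → u ⊞ v ≈ u′ ⊞ v′
    +-cong {u} {u′} {v} {v′} (eq , eqs) (eq′ , eqs′) =
      R₁.∼-trans (R₁.κ-+ fs u v) (R₁.∼-trans (R₁.⊕-cong eq eq′) (R₁.∼-sym (R₁.κ-+ fs u′ v′))) ,
      λ k lt → R′.⊕-cong (eqs k lt) (eqs′ k lt)

    ⊗-cong : ∀ p {u v} → u ≈ v → (λ k → p ⊗ u k) ≈ (λ k → p ⊗ v k)
    ⊗-cong p {u} {v} (eq , eqs) =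
      R₁.∼-trans (R₁.κ-⊗ fs p u) (R₁.∼-trans (R₁.⊗-congˡ eq) (R₁.∼-sym (R₁.κ-⊗ fs p v))) ,
      λ k lt → R′.⊗-congˡ (eqs k lt)

    sequences : ℤ-Module
    sequences = record
      { Carrierᴹ = Seq
      ; _≈ᴹ_ = _≈_
      ; _+ᴹ_ = _⊞_
      ; _*ₗ_ = _•_
      ; 0ᴹ = λ _ → 𝟘
      ; -ᴹ_ = λ u k → neg (u k)
      ; isLeftModule = record
        { isLeftSemimodule = record
          { +ᴹ-isCommutativeMonoid = record
            { isMonoid = record
              { isSemigroup = record
                { isMagma = record
                  { isEquivalence = record
                    { refl = pointwise (λ _ _ → R₁.∼-refl)
                    ; sym = λ (eq , eqs) → R₁.∼-sym eq , λ k lt → R′.∼-sym (eqs k lt)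
                    ; trans = λ (eq , eqs) (eq′ , eqs′) → R₁.∼-trans eq eq′ , λ k lt → R′.∼-trans (eqs k lt) (eqs′ k lt) }
                  ; ∙-cong = +-cong }
                ; assoc = λ u v w → pointwise (λ k _ → R₁.⊕-assoc _ _ _) }
              ; identity = (λ u → pointwise (λ k _ → R₁.⊕-zeroˡ _)) , (λ u → pointwise (λ k _ → R₁.⊕-zeroʳ _)) }
            ; comm = λ u v → pointwise (λ k _ → R₁.⊕-comm _ _) }
          ; isPreleftSemimodule = record
            { *ₗ-cong = λ { {x = a} refl eq → ⊗-cong (con a) eq }
            ; *ₗ-zeroˡ = λ u → pointwise (λ k _ → R₁.⊗-zeroˡ _)
            ; *ₗ-distribʳ = λ u x y → pointwise (λ k _ → R₁.∼-trans (R₁.⊗-cong (R₁.con-+ x y) R₁.∼-refl) (R₁.⊗-distrib _ _ _))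
            ; *ₗ-identityˡ = λ u → pointwise (λ k _ → R₁.⊗-oneˡ _)
            ; *ₗ-assoc = λ x y u → pointwise (λ k _ → R₁.∼-trans (R₁.⊗-cong (R₁.con-* x y) R₁.∼-refl) (R₁.⊗-assoc _ _ _))
            ; *ₗ-zeroʳ = λ x → pointwise (λ k _ → R₁.⊗-zeroʳ _)
            ; *ₗ-distribˡ = λ x u v → pointwise (λ k _ → R₁.⊗-distribˡ _ _ _) } }
        ; -ᴹ‿cong = ⊗-cong (con -1ℤ)
        ; -ᴹ‿inverse = (λ u → pointwise (λ k _ → R₁.neg-⊕ _)) , (λ u → pointwise (λ k _ → R₁.⊕-neg _)) } }

    -- Multiplication by ε respects ≈ because ∏_{f ∈ fs} x_f annihilates the kernel of R₁ → R′.
    opS-cong : ∀ g {u v} → u ≈ v → opS fs g u ≈ opS fs g v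
    opS-cong g {u} {v} (eq , eqs) =
      R₁.∼-trans (R₁.κ-op fs g u) (R₁.∼-trans
        (R₁.⊕-cong (R₁.⊗-congˡ eq) (R₁.⊗-congˡ (centre-multiply (R′.lastOr-cong fs {a = 𝟘} R′.∼-refl eqs))))
        (R₁.∼-sym (R₁.κ-op fs g v))) ,
      R′.opS-cong fs g eqs

    operators : Operators n sequences
    operators = record
      { op = opS fs
      ; op-cong = opS-cong
      ; op-+ = λ g u v → pointwise (λ k _ → R₁.opS-+ fs g u v k)
      ; op-* = λ g a v → pointwise (λ k _ → R₁.opS-⊗ fs g (con a) v k)
      ; op-comm = λ g h v → pointwise (λ k _ → R₁.opS-comm fs g h v k) }

    kill : ∀ {p} → Relator G₂ S p → ∀ v → actS fs p v ≈ (λ _ → 𝟘)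
    kill (outside g∉G₂) v = pointwise (λ k _ → R₁.kill-outside fs g∉G₂ v k)
    kill (linear atom) v = pointwise (λ k _ → R₁.kill-linear fs atom v k)
    kill (circuit H {B} H⊆G₂ B∈G₂ H⊏B cov) v with G₂-cases B∈G₂
    ... | inj₂ refl = pointwise (centre-circuit H H⊆G₂ H⊏B cov v)
    ... | inj₁ B∈G₁ =
            R₁.∼-trans (R₁.∼-sym (R₁.⊗-oneˡ _)) (R₁.∼-trans (total-circuit (elems H) [] B∈G₁ H-ok (λ ()) cov′ v)
              (R₁.∼-sym (R₁.κ-vanish fs (λ _ _ → R₁.∼-refl)))) ,
            λ k lt → R′.∼-trans (R′.∼-sym (R′.⊗-oneˡ _)) (exceptional-circuit (elems H) [] B∈G₁ H-ok (λ ())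
              (covers-⊆ (λ { (inj₁ y∈) → inj₁ y∈
                           ; (inj₂ (inj₂ (y∈S , y⊏B))) → inj₂ (inj₂ (Sub.p⊆p∪q F y∈S , y⊏B)) }) cov′) v k lt)
      where
      H-ok : ∀ {h} → h LMem.∈ elems H → h ∈ G₂ × h ⊏ B
      H-ok h∈ = H⊆G₂ (∈-elems⁻ h∈) , H⊏B _ (∈-elems⁻ h∈)
      cov′ : Circuit (elems H) [] S B
      cov′ = circuit-start cov

    module O = Operators operators

    -- The coordinates vanish only in R′, from which `σ` does not descend to D(L,G₂,S), so they
    -- cannot be treated one by one. Instead `σ` is applied to `κ gs u`, which vanishes in R, and
    -- the result is compared with `Sec.Φ gs u`.
    Φ-vanish : ∀ gs {u} → (∀ {g} → g LMem.∈ gs → g ∈ F) → κ gs u R₁.∼ 𝟘 → (∀ k → k ℕ.< length gs → u k R′.∼ 𝟘) → Sec.Φ gs u R₂.∼ 𝟘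
    Φ-vanish gs {u} gs⊆F eq eqs = R₂.∼-trans (R₂.∼-sym (compare gs gs⊆F eqs)) (σ-sound eq)
      where
      -- x_f and σ(x_f) = x_f + x_b agree on classes from the kernel of R₁ → R′.
      exceptional-kill : ∀ {p} → p R′.∼ 𝟘 → X b ⊗ bind Sec.σ p R₂.∼ 𝟘
      exceptional-kill eq = R₂.∼-trans (restrict-multiply b b∈G₂ id (ExceptionalDivisor.σ-sound eq)) (R₂.⊗-zeroʳ _)
      compare : ∀ gs {u} → (∀ {g} → g LMem.∈ gs → g ∈ F) → (∀ k → k ℕ.< length gs → u k R′.∼ 𝟘) →
                bind Sec.σ (κ gs u) R₂.∼ Sec.Φ gs u
      compare [] _ _ = R₂.∼-refl
      compare (g ∷ gs) {u} gs⊆F eqs = R₂.⊕-congˡ (R₂.∼-trans (R₂.⊗-distrib _ _ _)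
        (R₂.∼-trans (R₂.⊕-congˡ (R₂.∼-trans (R₂.⊗-assoc _ _ _) (R₂.annihilate _ (exceptional-kill
            (R′.κ-vanish gs (λ k lt → eqs (suc k) (ℕ.s<s lt)))))))
          (R₂.∼-trans (R₂.⊕-zeroʳ _) (R₂.⊗-congˡ (compare gs (gs⊆F ∘ there) (λ k lt → eqs (suc k) (ℕ.s<s lt)))))))

    -- The first summand holds the value at ε = 0, the second the coordinates beyond the first. The
    -- first coordinate is omitted: modulo ker(R → R′) it is that value minus the contributions of
    -- the others.
    target : ℤ-Module
    target = leftModule R₁.additive (seqModule R′.additive (length fs₀))

    Ψ : R₂.additive ↪ target
    Ψ = record
      { to = λ p → κ fs (actS fs p δ) , actS fs p δ ∘ suc
      ; cong-to = λ eq → O.act-sound kill eq δ .proj₁ , λ k lt → O.act-sound kill eq δ .proj₂ (suc k) (ℕ.s<s lt)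
      ; to-+ = λ p q → R₁.κ-+ fs (actS fs p δ) (actS fs q δ) , λ _ _ → R′.∼-refl
      ; to-* = λ a p → R₁.κ-⊗ fs (con a) (actS fs p δ) , λ _ _ → R′.∼-refl
      ; reflect = λ p (eq , eqs) → R₂.∼-trans (R₂.∼-sym (unit p)) (Φ-vanish fs (proj₁ ∘ ∈-fs⁻) eq (coordinates p eq eqs)) }
      where
      coordinates : ∀ p → κ fs (actS fs p δ) R₁.∼ 𝟘 → (∀ k → k ℕ.< length fs₀ → actS fs p δ (suc k) R′.∼ 𝟘) →
                    ∀ k → k ℕ.< length fs → actS fs p δ k R′.∼ 𝟘
      coordinates p eq eqs (suc k) (ℕ.s≤s lt) = eqs k lt
      coordinates p eq eqs zero _ = R′.∼-trans (R′.∼-sym (R′.⊕-zeroʳ _))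
        (R′.∼-trans (R′.⊕-congˡ (R′.∼-sym (R′.annihilate _ (R′.κ-vanish fs₀ eqs)))) (R₁⇒R′ eq))
      Φδ : Sec.Φ fs δ R₂.∼ 𝟙
      Φδ = R₂.∼-trans (R₂.⊕-congˡ (R₂.annihilate _ (M₂.κ-vanish fs₀ (λ _ _ → R₂.∼-refl)))) (R₂.⊕-zeroʳ _)
      unit : ∀ p → Sec.Φ fs (actS fs p δ) R₂.∼ p
      unit p = R₂.∼-trans (Sec.Φ-act fs c-fs (centre-product S id) p δ)
        (R₂.∼-trans (R₂.⊗-congˡ Φδ) (R₂.⊗-oneʳ p))

    -- The sequence with given value at ε = 0 and given coordinates beyond the first.
    assemble : Expr n × Seq → Seq
    assemble (s , t) zero = s ⊕ neg (X f₀ ⊗ κ fs₀ t)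
    assemble (s , t) (suc k) = t k

    κ-assemble : ∀ s t → κ fs (assemble (s , t)) R₁.∼ s
    κ-assemble s t = R₁.∼-trans (R₁.⊕-assoc _ _ _) (R₁.∼-trans (R₁.⊕-congˡ (R₁.neg-⊕ _)) (R₁.⊕-zeroʳ s))

    assemble-+ : ∀ s t s′ t′ → assemble (s ⊕ s′ , t ⊞ t′) R₁.≈[ fs ] (assemble (s , t) ⊞ assemble (s′ , t′))
    assemble-+ s t s′ t′ zero _ = R₁.∼-trans (R₁.⊕-congˡ (R₁.⊗-congˡ (R₁.⊗-congˡ (R₁.κ-+ fs₀ t t′))))
      (R₁.solve 6 (λ s s′ m x k k′ → (s R₁.:+ s′) R₁.:+ m R₁.:* (x R₁.:* (k R₁.:+ k′)) R₁.:= (s R₁.:+ m R₁.:* (x R₁.:* k)) R₁.:+ (s′ R₁.:+ m R₁.:* (x R₁.:* k′)))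
        R₁.∼-refl _ _ _ _ _ _)
    assemble-+ s t s′ t′ (suc k) _ = R₁.∼-refl

    assemble-* : ∀ a s t → assemble (con a ⊗ s , a • t) R₁.≈[ fs ] (a • assemble (s , t))
    assemble-* a s t zero _ = R₁.∼-trans (R₁.⊕-congˡ (R₁.⊗-congˡ (R₁.⊗-congˡ (R₁.κ-⊗ fs₀ (con a) t))))
      (R₁.solve 5 (λ a s m x k → a R₁.:* s R₁.:+ m R₁.:* (x R₁.:* (a R₁.:* k)) R₁.:= a R₁.:* (s R₁.:+ m R₁.:* (x R₁.:* k))) R₁.∼-refl _ _ _ _ _)
    assemble-* a s t (suc k) _ = R₁.∼-refl

    Φ-cong : ∀ {u v} → u ≈ v → Sec.Φ fs u R₂.∼ Sec.Φ fs v
    Φ-cong {u} {v} (eq , eqs) = R₂.∼-trans (R₂.∼-sym (R₂.⊕-zeroʳ _)) (R₂.∼-trans (R₂.⊕-congˡ (R₂.∼-sym (R₂.neg-⊕ _)))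
      (R₂.∼-trans (R₂.∼-sym (R₂.⊕-assoc _ _ _)) (R₂.∼-trans (R₂.⊕-cong difference R₂.∼-refl) (R₂.⊕-zeroˡ _))))
      where
      difference : Sec.Φ fs u ⊕ neg (Sec.Φ fs v) R₂.∼ 𝟘
      difference = R₂.∼-trans (R₂.∼-sym (R₂.∼-trans (M₂.κ-+ fs (bind Sec.σ ∘ u) (λ k → neg (bind Sec.σ (v k))))
          (R₂.⊕-congˡ (M₂.κ-⊗ fs (con -1ℤ) (bind Sec.σ ∘ v)))))
        (Φ-vanish fs {u ⊞ (λ k → neg (v k))} (proj₁ ∘ ∈-fs⁻)
          (R₁.∼-trans (R₁.κ-+ fs u (λ k → neg (v k))) (R₁.∼-trans (R₁.⊕-cong eq (R₁.κ-⊗ fs (con -1ℤ) v)) (R₁.⊕-neg _)))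
          (λ k lt → R′.∼-trans (R′.⊕-cong (eqs k lt) R′.∼-refl) (R′.⊕-neg _)))

    assemble-cong : ∀ {s s′ t t′} → s R₁.∼ s′ → (∀ k → k ℕ.< length fs₀ → t k R′.∼ t′ k) → assemble (s , t) ≈ assemble (s′ , t′)
    assemble-cong eq eqs = R₁.∼-trans (κ-assemble _ _) (R₁.∼-trans eq (R₁.∼-sym (κ-assemble _ _))) ,
      λ { zero _ → R′.⊕-cong (R₁⇒R′ eq) (R′.⊗-congˡ (R′.⊗-congˡ (R′.κ-cong fs₀ eqs)))
        ; (suc k) (ℕ.s≤s lt) → eqs k lt }

    Φ : target ↪ R₂.additive
    Φ = record
      { to = Sec.Φ fs ∘ assemble
      ; cong-to = λ (eq , eqs) → Φ-cong (assemble-cong eq eqs)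
      ; to-+ = λ (s , t) (s′ , t′) → R₂.∼-trans (Φ-cong (pointwise (assemble-+ s t s′ t′)))
          (M₂.κ-+ fs (bind Sec.σ ∘ assemble (s , t)) (bind Sec.σ ∘ assemble (s′ , t′)))
      ; to-* = λ a (s , t) → R₂.∼-trans (Φ-cong (pointwise (assemble-* a s t)))
          (M₂.κ-⊗ fs (con a) (bind Sec.σ ∘ assemble (s , t)))
      ; reflect = λ (s , t) eq → let eq₁ , eqs = zero-sequence (s , t) eq in
          R₁.∼-trans (R₁.∼-sym (κ-assemble s t)) (R₁.∼-trans eq₁ (R₁.κ-vanish fs (λ _ _ → R₁.∼-refl))) ,
          λ k lt → eqs (suc k) (ℕ.s<s lt) }
      where
      zero-sequence : ∀ st → Sec.Φ fs (assemble st) R₂.∼ 𝟘 → assemble st ≈ (λ _ → 𝟘)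
      zero-sequence st eq = ≈ᴹ-trans (≈ᴹ-sym (pointwise (Sec₁.act-Φ R₁.Xb∼𝟘 fs c-fs (assemble st))))
        (≈ᴹ-trans (O.act-sound kill eq δ) (pointwise (λ k _ → R₁.⊗-zeroˡ _)))
        where open LeftModule sequences using (≈ᴹ-trans; ≈ᴹ-sym)

    rank : ∀ {r r′} → Rank.HasRank R₁.additive r → Rank.HasRank R′.additive r′ →
           Rank.HasRank R₂.additive (r ℕ.+ length fs₀ ℕ.* r′)
    rank ρ ρ′ = rank-transport Φ Ψ (rank-⊕ R₁.additive (seqModule R′.additive (length fs₀)) ρ (rank-seq R′.additive (length fs₀) ρ′))

-- The N-function property

-- A failure of nestedness hands over no witness, so vanishing is available up to double negation
-- only. Refuting independence is a negation, for which this suffices.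
rank-zero : (M : ℤ-Module) → ¬ ¬ (∀ v → LeftModule._≈ᴹ_ M v (LeftModule.0ᴹ M)) → Rank.HasRank M 0
rank-zero M nn = ((λ ()) , λ _ _ ()) , λ v ind → nn λ zero-module →
  case ind (λ _ → 1ℤ) (zero-module _) zero of λ ()

length-filter-tabulate : ∀ {A : Set} {P : A → Set} (P? : ∀ x → Dec (P x)) {k} (H : Subset k) (f : Fin k → A) →
  (∀ i → does (P? (f i)) ≡ Vec.lookup H i) → length (filter P? (List.tabulate f)) ≡ ∣ H ∣
length-filter-tabulate P? Vec.[] f eq = refl
length-filter-tabulate P? (h Vec.∷ H) f eq with does (P? (f zero)) | eq zero
... | true | refl = cong suc (length-filter-tabulate P? H (f ∘ suc) (eq ∘ suc))
... | false | refl = length-filter-tabulate P? H (f ∘ suc) (eq ∘ suc)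

length-elems : ∀ {n} (H : Subset n) → length (elems H) ≡ ∣ H ∣
length-elems H = length-filter-tabulate (λ g → Vec.lookup H g Bool.≟ true) H id λ i → does-≟ (Vec.lookup H i)
  where
  does-≟ : ∀ h → does (h Bool.≟ true) ≡ h
  does-≟ true = refl
  does-≟ false = refl

two-elements : ∀ {n} {T : Subset n} {x y} → x ∈ T → y ∈ T → y ≢ x → 2 ℕ.≤ ∣ T ∣
two-elements {T = T} {x} {y} x∈T y∈T y≢x = subst (ℕ._< ∣ T ∣) (Sub.∣⁅x⁆∣≡1 x)
  (Sub.p⊂q⇒∣p∣<∣q∣ ((λ z∈x → subst (_∈ T) (sym (Sub.x∈⁅y⁆⇒x≡y x z∈x)) x∈T) , y , y∈T , y≢x ∘ Sub.x∈⁅y⁆⇒x≡y x))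

module NFunction (L : FinLattice) (atomic : Atomic L) (G₁ : Subset (FinLattice.n L)) (b : Fin (FinLattice.n L))
  (b∉G₁ : b ∉ G₁) (building₁ : IsBuildingSet L G₁) (building₂ : IsBuildingSet L (G₁ ∪ ⁅ b ⁆))
  (F : Subset (FinLattice.n L)) (F-factors : ∀ g → (g ∈ F → MaxBelow L G₁ b g) × (MaxBelow L G₁ b g → g ∈ F))
  (S : Subset (FinLattice.n L)) (nested : IsNested L (G₁ ∪ ⁅ b ⁆) S) where

  open Lattice L
  open Blowup L atomic G₁ b b∉G₁ building₁ building₂ F F-factors

  -- F is an antichain with join b ∈ G₂, so nestedness excludes it when it has two elements. A
  -- single element would have to equal b, and an empty F would give b = 0̂.
  F⊈S : ¬ (F ⊆ S)
  F⊈S F⊆S with Fin.any? (Sub._∈? F)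
  ... | no empty = b≢0̂ (antisym (F-covers 0̂ (λ f f∈F → ⊥-elim (empty (f , f∈F)))) (0̂-min b))
  ... | yes (f , f∈F) with Fin.any? (λ f′ → (f′ Sub.∈? F) ×-dec ¬? (f′ Fin.≟ f))
  ...   | yes (f′ , f′∈F , f′≢f) = nested .proj₂ F F⊆S (two-elements f∈F f′∈F f′≢f)
            (λ x y x∈F y∈F x≢y x≤y → x≢y (F-antichain x∈F y∈F x≤y)) b ((λ y y∈F → F⊏b y∈F .proj₁) , F-covers) b∈G₂
  ...   | no unique = F⊏b f∈F .proj₂ (antisym (F⊏b f∈F .proj₁) (F-covers f only-f))
    where
    only-f : ∀ f′ → f′ ∈ F → f′ ≤ f
    only-f f′ f′∈F with f′ Fin.≟ f
    ... | yes eq = ≤-reflexive eq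
    ... | no f′≢f = ⊥-elim (unique (f′ , f′∈F , f′≢f))

  -- An antichain in J with join x ∈ G₁ and at least two elements is a circuit with H = ∅, whose
  -- relator is the empty product: 1 = 0 in the ring.
  non-nested-rank : ∀ J → J ⊆ G₁ → ¬ IsNested L G₁ J → Rank.HasRank (D.additive G₁ J) 0
  non-nested-rank J J⊆G₁ ¬nested = rank-zero additive λ ¬zero → ¬nested (J⊆G₁ , λ T T⊆J 2≤∣T∣ incomparable x (upper , least) x∈G₁ →
      ¬zero λ p → ∼-trans (∼-sym (⊗-oneˡ p)) (∼-trans (⊗-cong (one∼𝟘 T T⊆J 2≤∣T∣ incomparable x upper least x∈G₁) ∼-refl) (⊗-zeroˡ p)))
    where
    open D G₁ J
    one∼𝟘 : ∀ T → T ⊆ J → 2 ℕ.≤ ∣ T ∣ → PairwiseIncomparable L T → ∀ x → (∀ y → y ∈ T → y ≤ x) → (∀ z → (∀ y → y ∈ T → y ≤ z) → x ≤ z) →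
            x ∈ G₁ → 𝟙 ∼ 𝟘
    one∼𝟘 T T⊆J 2≤∣T∣ incomparable x upper least x∈G₁ = circuit-list [] (λ ()) x∈G₁ (λ ())
      (covers-⊆ (λ {y} y∈T → inj₂ (T⊆J y∈T , upper y y∈T , λ { refl → x∉T y∈T })) least)
      where
      -- If x belonged to T, every other member would be comparable with it, leaving only x and
      -- contradicting the size of T.
      x∉T : x ∉ T
      x∉T x∈T = ℕ.<⇒≱ 2≤∣T∣ (subst (∣ T ∣ ℕ.≤_) (Sub.∣⁅x⁆∣≡1 x) (Sub.p⊆q⇒∣p∣≤∣q∣ T⊆x))
        where
        T⊆x : T ⊆ ⁅ x ⁆
        T⊆x {y} y∈T with y Fin.≟ x
        ... | yes refl = Sub.x∈⁅x⁆ y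
        ... | no y≢x = ⊥-elim (incomparable y x y∈T x∈T y≢x (upper y y∈T))

  module _ (S₀ : Subset n) (S₀⊆S : S₀ ⊆ S) (b∉S₀ : b ∉ S₀) where

    S₀⊆G₁ : S₀ ⊆ G₁
    S₀⊆G₁ s∈S₀ = G₂∖b (nested .proj₁ (S₀⊆S s∈S₀)) λ { refl → b∉S₀ s∈S₀ }

    nonempty : ∃[ f₀ ] ∃[ fs₀ ] elems (F ─ S₀) ≡ f₀ ∷ fs₀
    nonempty with elems (F ─ S₀) in eq
    ... | f₀ ∷ fs₀ = f₀ , fs₀ , refl
    ... | [] = ⊥-elim (F⊈S F⊆S)
      where
      F⊆S : F ⊆ S
      F⊆S {f} f∈F with f Sub.∈? S₀
      ... | yes f∈S₀ = S₀⊆S f∈S₀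
      ... | no f∉S₀ = case subst (f LMem.∈_) eq (∈-elems⁺ (Sub.x∈p∧x∉q⇒x∈p─q f∈F f∉S₀)) of λ ()

    total-rank : ∀ {r r′} → Rank.HasRank (D.additive G₁ S₀) r → Rank.HasRank (D.additive G₁ (S₀ ∪ F)) r′ →
                 ∃[ k ] ∣ F ─ S₀ ∣ ≡ suc k × Rank.HasRank (D.additive G₂ S₀) (r ℕ.+ k ℕ.* r′)
    total-rank ρ ρ′ with nonempty
    ... | f₀ , fs₀ , eq = length fs₀ , trans (sym (length-elems (F ─ S₀))) (cong length eq) ,
      BlowupRank.TotalSpace.rank L atomic G₁ b b∉G₁ building₁ building₂ F F-factors S₀ S₀⊆G₁ f₀ fs₀ eq ρ ρ′

    divisor-rank : ∀ {r′} → Rank.HasRank (D.additive G₁ (S₀ ∪ F)) r′ →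
                   Rank.HasRank (D.additive G₂ (S₀ ∪ ⁅ b ⁆)) (∣ F ─ S₀ ∣ ℕ.* r′)
    divisor-rank {r′} ρ′ with nonempty
    ... | f₀ , fs₀ , eq = subst (λ m → Rank.HasRank (D.additive G₂ (S₀ ∪ ⁅ b ⁆)) (m ℕ.* r′))
      (trans (cong length (sym eq)) (length-elems (F ─ S₀)))
      (BlowupRank.ExceptionalDivisor.rank L atomic G₁ b b∉G₁ building₁ building₂ F F-factors S₀ S₀⊆G₁ f₀ fs₀ eq ρ′)

  rank₁ : ∀ {J r} → IsRankD L G₁ J r → Rank.HasRank (D.additive G₁ J) r
  rank₁ {J} = Link.rank-D L G₁ J building₁

  rank₂ : ∀ {J r} → IsRankD L G₂ J r → Rank.HasRank (D.additive G₂ J) r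
  rank₂ {J} = Link.rank-D L G₂ J building₂

  not-nested : b ∉ S → ¬ IsNested L G₁ (S ∪ F) → ∀ r₂ r₁ → IsRankD L G₂ S r₂ → IsRankD L G₁ S r₁ → r₂ ≡ r₁
  not-nested b∉S ¬nested r₂ r₁ ρ₂ ρ₁ = from-rank (total-rank S id b∉S (rank₁ ρ₁) (non-nested-rank (S ∪ F) S∪F⊆G₁ ¬nested))
    where
    S∪F⊆G₁ : S ∪ F ⊆ G₁
    S∪F⊆G₁ y∈ = [ S₀⊆G₁ S id b∉S , F⊆G₁ ]′ (Sub.x∈p∪q⁻ S F y∈)
    from-rank : ∃[ k ] ∣ F ─ S ∣ ≡ suc k × Rank.HasRank (D.additive G₂ S) (r₁ ℕ.+ k ℕ.* 0) → r₂ ≡ r₁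
    from-rank (k , _ , ρ) = trans (Rank.rank-unique (D.additive G₂ S) (rank₂ ρ₂) ρ)
      (trans (cong (r₁ ℕ.+_) (ℕ.*-zeroʳ k)) (ℕ.+-identityʳ r₁))

  avoiding : b ∉ S → ∀ r₂ r₁ r′ → IsRankD L G₂ S r₂ → IsRankD L G₁ S r₁ → IsRankD L G₁ (S ∪ F) r′ →
             + r₂ ≡ + r₁ + + r′ * (+ ∣ F ─ S ∣ - 1ℤ)
  avoiding b∉S r₂ r₁ r′ ρ₂ ρ₁ ρ′ = from-rank (total-rank S id b∉S (rank₁ ρ₁) (rank₁ ρ′))
    where
    arithmetic : ∀ {r m k} → r ≡ r₁ ℕ.+ k ℕ.* r′ → m ≡ suc k → + r ≡ + r₁ + + r′ * (+ m - 1ℤ)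
    arithmetic {k = k} refl refl = trans (ℤ.pos-+ r₁ (k ℕ.* r′))
      (cong (λ s → + r₁ + s) (trans (cong +_ (ℕ.*-comm k r′)) (ℤ.pos-* r′ k)))
    from-rank : ∃[ k ] ∣ F ─ S ∣ ≡ suc k × Rank.HasRank (D.additive G₂ S) (r₁ ℕ.+ k ℕ.* r′) →
                + r₂ ≡ + r₁ + + r′ * (+ ∣ F ─ S ∣ - 1ℤ)
    from-rank (k , eq , ρ) = arithmetic (Rank.rank-unique (D.additive G₂ S) (rank₂ ρ₂) ρ) eq

  containing : b ∈ S → ∀ r₂ r′ → IsRankD L G₂ S r₂ → IsRankD L G₁ ((S ─ ⁅ b ⁆) ∪ F) r′ → r₂ ≡ r′ ℕ.* ∣ F ─ S ∣
  containing b∈S r₂ r′ ρ₂ ρ′ = trans (Rank.rank-unique (D.additive G₂ S) (rank₂ ρ₂) ρ) (ℕ.*-comm ∣ F ─ S ∣ r′)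
    where
    S₀ : Subset n
    S₀ = S ─ ⁅ b ⁆
    S₀∪b≡S : S₀ ∪ ⁅ b ⁆ ≡ S
    S₀∪b≡S = Sub.⊆-antisym
      (λ y∈ → [ Sub.p─q⊆p S ⁅ b ⁆ , (λ y∈b → subst (_∈ S) (sym (Sub.x∈⁅y⁆⇒x≡y b y∈b)) b∈S) ]′ (Sub.x∈p∪q⁻ S₀ ⁅ b ⁆ y∈))
      (λ {y} y∈S → case y Sub.∈? ⁅ b ⁆ of λ { (yes y∈b) → Sub.q⊆p∪q S₀ ⁅ b ⁆ y∈b
                                             ; (no y∉b) → Sub.p⊆p∪q ⁅ b ⁆ (Sub.x∈p∧x∉q⇒x∈p─q y∈S y∉b) })
    F─S₀≡F─S : F ─ S₀ ≡ F ─ S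
    F─S₀≡F─S = Sub.⊆-antisym
      (λ y∈ → let y∈F , y∉S₀ = ∈-─⁻ y∈ in Sub.x∈p∧x∉q⇒x∈p─q y∈F λ y∈S →
        y∉S₀ (Sub.x∈p∧x∉q⇒x∈p─q y∈S λ y∈b → G₁⇒≢b (F⊆G₁ y∈F) (Sub.x∈⁅y⁆⇒x≡y b y∈b)))
      (λ y∈ → let y∈F , y∉S = ∈-─⁻ y∈ in Sub.x∈p∧x∉q⇒x∈p─q y∈F (y∉S ∘ Sub.p─q⊆p S ⁅ b ⁆))
    ρ : Rank.HasRank (D.additive G₂ S) (∣ F ─ S ∣ ℕ.* r′)
    ρ = ≡.subst₂ (λ J m → Rank.HasRank (D.additive G₂ J) (∣ m ∣ ℕ.* r′)) S₀∪b≡S F─S₀≡F─S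
      (divisor-rank S₀ (Sub.p─q⊆p S ⁅ b ⁆) (λ b∈S₀ → ∈-─⁻ b∈S₀ .proj₂ (Sub.x∈⁅x⁆ b)) (rank₁ ρ′))

theorem3 : (L : FinLattice) → Ranked L → Atomic L →
    (G₁ : Subset (FinLattice.n L)) (b : Fin (FinLattice.n L)) → b ∉ G₁ →
    IsBuildingSet L G₁ → IsBuildingSet L (G₁ ∪ ⁅ b ⁆) →
    (F : Subset (FinLattice.n L)) → (∀ g → (g ∈ F → MaxBelow L G₁ b g) × (MaxBelow L G₁ b g → g ∈ F)) →
    (S : Subset (FinLattice.n L)) → IsNested L (G₁ ∪ ⁅ b ⁆) S →
    ((b ∉ S → ¬ IsNested L G₁ (S ∪ F) →
    ∀ r₂ r₁ → IsRankD L (G₁ ∪ ⁅ b ⁆) S r₂ → IsRankD L G₁ S r₁ → r₂ ≡ r₁)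
    × (b ∉ S → IsNested L G₁ (S ∪ F) →
    ∀ r₂ r₁ r₁' → IsRankD L (G₁ ∪ ⁅ b ⁆) S r₂ → IsRankD L G₁ S r₁ → IsRankD L G₁ (S ∪ F) r₁' →
    + r₂ ≡ + r₁ + + r₁' * (+ ∣ F ─ S ∣ - 1ℤ))
    × (b ∈ S →
    ∀ r₂ r₁' → IsRankD L (G₁ ∪ ⁅ b ⁆) S r₂ → IsRankD L G₁ ((S ─ ⁅ b ⁆) ∪ F) r₁' →
    r₂ ≡ r₁' ℕ.* ∣ F ─ S ∣))
theorem3 L _ atomic G₁ b b∉G₁ building₁ building₂ F F-factors S nested =
  not-nested , (λ b∉S _ → avoiding b∉S) , containing
  where open NFunction L atomic G₁ b b∉G₁ building₁ building₂ F F-factors S nested
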